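{- Let $q \ge 6$ be a positive integer which is not a prime power. Then there are at most finitely many perfect $2$-error correcting codes over an alphabet of size $q$ (where the word length $n$ is allowed to vary over all positive integers).
   Context: Let $q \ge 2$, $e \ge 1$ be integers and let $Z_q$ be a set with $q$ elements (the alphabet). An $e$-error correcting code $C$ with parameters $(n,M)$ is a subset of $Z_q^n$ of size $M$ such that any two distinct elements of $C$ differ in at least $2e+1$ coordinates. The code is called perfect if $M\sum_{j=0}^{e}\binom{n}{j}(q-1)^j = q^n$. -}

module Defs where

open import Data.Nat using (ℕ; zero; suc; _+_; _*_; _∸_; _^_; _≤_)
open import Data.Nat.Combinatorics using (_C_)
open import Data.Nat.Primality using (Prime)
open import Data.Fin using (Fin)
open import Data.Fin.Properties using (_≟_)
open import Data.Vec using (Vec; []; _∷_)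
open import Data.List using (List; length)
open import Data.List.Membership.Propositional using (_∈_)
open import Data.List.Relation.Unary.Unique.Propositional using (Unique)
open import Data.List.Relation.Binary.Permutation.Propositional using (_↭_)
open import Data.Product using (Σ; ∃; _×_; _,_)
open import Relation.Nullary using (¬_; does)
open import Data.Bool using (if_then_else_)
open import Relation.Binary.PropositionalEquality using (_≡_)

Word : ℕ → ℕ → Set
Word q n = Vec (Fin q) n

dist : ∀ {q n} → Word q n → Word q n → ℕ
dist [] [] = 0
dist (a ∷ x) (b ∷ y) = (if does (a ≟ b) then 0 else 1) + dist x y

-- A code is a duplicate-free list of words; its size M is its length.
-- e-error correcting: distinct codewords differ in at least 2e+1 coordinates.
IsErrorCorrecting : (q e n : ℕ) → List (Word q n) → Set
IsErrorCorrecting q e n C =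
  Unique C × (∀ {x y} → x ∈ C → y ∈ C → ¬ (x ≡ y) → suc (2 * e) ≤ dist x y)

ballSize : (q n e : ℕ) → ℕ
ballSize q n zero    = (n C 0) * (q ∸ 1) ^ 0
ballSize q n (suc e) = ballSize q n e + (n C suc e) * (q ∸ 1) ^ suc e

IsPerfectCode : (q e n : ℕ) → List (Word q n) → Set
IsPerfectCode q e n C =
  IsErrorCorrecting q e n C × (length C * ballSize q n e ≡ q ^ n)

IsPrimePower : ℕ → Set
IsPrimePower q = Σ ℕ λ p → Σ ℕ λ k → Prime p × 1 ≤ k × q ≡ p ^ k

-- There are at most finitely many perfect e-error correcting codes over an
-- alphabet of size q (word length n ≥ 1 varying): a finite list L of pairs
-- (n , code) such that every such code equals (as a set, i.e. up to
-- permutation of the duplicate-free list) some code listed in L.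
FinitelyManyPerfectCodes : (q e : ℕ) → Set
FinitelyManyPerfectCodes q e =
  Σ (List (Σ ℕ λ n → List (Word q n))) λ L →
    ∀ (n : ℕ) (C : List (Word q n)) → 1 ≤ n → IsPerfectCode q e n C →
      ∃ λ (C' : List (Word q n)) → ((n , C') ∈ L) × (C ↭ C')

{-# OPTIONS --safe #-}

-- Decompose the indicator function of a perfect 2-code over the eigenspaces of the Hamming graph.
-- Only two nonzero weights x and x + d occur (Lloyd), with 4 x = q d² - 2 d + 6 - q and
-- 4 (x + d) = q d² + 2 d + 6 - q, and their product divides 2 q^n.  The eigencomponents take values
-- in ℤ[1/q], and at a word at distance two from the code this forces d to divide 2 q^n as well.
-- So x, x + d and d = (x + d) - x have only prime factors at most 2 q, and if s^c is the prime power
-- with the largest exponent in d, then x + d ≡ x modulo s^c, where log x = O(c).  (For q = 6 the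
-- zeros share the factor d, and one uses 3 d + 1 ≡ 1 instead.)
--
-- That is impossible for large c: for fixed numbers p_i prime to s and fixed D, a congruence
-- ∏ p_i^a_i ≡ ∏ p_i^b_i mod s^c with all exponents at most D c is an equality once c is large.  By
-- simultaneous approximation the quotient of the two sides is γ^r ρ, with r bounded and ρ of height
-- much smaller than r.  A polynomial in two variables vanishing to high order at (1 , 1) along
-- X = Y^r, constructed with Siegel's lemma, then has to vanish to high order at the points
-- (ρ^τ , γ^(-τ)) too, which contradicts a zero estimate.  Every step is effective, so d, and with it
-- n = O(d²), is explicitly bounded, and only finitely many codes remain.

module Submission where

-- Since c is the largest exponent in d and x is quadratic in d, all exponents in x and x + d are
-- O(c). So a gap statement that is merely linear in the exponents is enough, and for it a single
-- passage from (1 , 1) to other points suffices, with no induction on the number of primes.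
--
-- The values of the auxiliary polynomial at those points must be small and divisible by a high
-- power of s. Divisibility needs the two products γ₁ and γ₂ to be s-adically close, so all
-- exponents are multiplied by a common g that makes every base congruent to 1 modulo σ = s^w. This
-- g itself contains s^w and enters the size estimate squared. Of the order of vanishing 4 K,
-- derivatives of order below K leave 3 K, so the estimate is made against σ^3, and the remaining
-- factor σ wins for large w.
--
-- Everything stays in the integers. Points are homogenised, and a derivative is replaced by
-- multiplying the coefficient of Y^u by a polynomial function of u; order M means vanishing against
-- all such functions of degree below M.

open import Defs
open import Data.Product using (_,_; _×_; proj₁; proj₂; Σ; ∃)
open import Data.Sum using (_⊎_; inj₁; inj₂)
open import Data.Empty using (⊥; ⊥-elim)
open import Relation.Nullary using (Dec; contradiction; does; no; yes; ¬_)
open import Relation.Nullary.Decidable using (dec-false; dec-true; decidable-stable; ¬?)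
open import Relation.Binary.PropositionalEquality hiding (J)
open import Relation.Binary.Definitions using (Tri; tri<; tri>; tri≈)
open import Data.List.Membership.Propositional using (_∈_)
open import Data.List using (List; []; _++_; _∷_; allFin; cartesianProductWith; concatMap; filter; length; map; upTo)
open import Data.Vec using ([]; _∷_)
open import Relation.Unary using (Decidable)

-- Finite sums and polynomial functions on the natural numbers

module PolynomialFunctions where

  open import Data.Nat as ℕ using (ℕ; zero; suc; z≤n; s≤s; _<_; _≤_)
  import Data.Nat.Properties as ℕP
  open import Data.Integer using (ℤ; +_; _+_; _*_; _-_; -_; _^_; 0ℤ; 1ℤ; ∣_∣)
  open import Data.Integer.Properties
  open import Data.Integer.Tactic.RingSolver using (solve-∀)

  ∑ : ℕ → (ℕ → ℤ) → ℤ
  ∑ zero    f = 0ℤ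
  ∑ (suc n) f = ∑ n f + f n

  ∑-cong : ∀ n {f g : ℕ → ℤ} → (∀ i → i < n → f i ≡ g i) → ∑ n f ≡ ∑ n g
  ∑-cong zero    h = refl
  ∑-cong (suc n) h = cong₂ _+_ (∑-cong n λ i i<n → h i (ℕP.m<n⇒m<1+n i<n)) (h n ℕP.≤-refl)

  ∑-zero : ∀ n {f : ℕ → ℤ} → (∀ i → i < n → f i ≡ 0ℤ) → ∑ n f ≡ 0ℤ
  ∑-zero zero    h = refl
  ∑-zero (suc n) h = cong₂ _+_ (∑-zero n λ i i<n → h i (ℕP.m<n⇒m<1+n i<n)) (h n ℕP.≤-refl)

  ∑-+ : ∀ n (f g : ℕ → ℤ) → ∑ n (λ i → f i + g i) ≡ ∑ n f + ∑ n g
  ∑-+ zero    f g = refl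
  ∑-+ (suc n) f g = trans (cong (_+ (f n + g n)) (∑-+ n f g)) (lemma (∑ n f) (∑ n g) (f n) (g n))
    where
    lemma : ∀ a b c d → (a + b) + (c + d) ≡ (a + c) + (b + d)
    lemma = solve-∀

  *-∑ : ∀ c n (f : ℕ → ℤ) → c * ∑ n f ≡ ∑ n (λ i → c * f i)
  *-∑ c zero    f = *-zeroʳ c
  *-∑ c (suc n) f = trans (*-distribˡ-+ c (∑ n f) (f n)) (cong (_+ c * f n) (*-∑ c n f))

  ∑-* : ∀ c n (f : ℕ → ℤ) → ∑ n f * c ≡ ∑ n (λ i → f i * c)
  ∑-* c zero    f = refl
  ∑-* c (suc n) f = trans (*-distribʳ-+ c (∑ n f) (f n)) (cong (_+ f n * c) (∑-* c n f))

  ∑-swap : ∀ m n (f : ℕ → ℕ → ℤ) → ∑ m (λ i → ∑ n (f i)) ≡ ∑ n (λ j → ∑ m (λ i → f i j))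
  ∑-swap zero    n f = sym (∑-zero n λ _ _ → refl)
  ∑-swap (suc m) n f = trans (cong (_+ ∑ n (f m)) (∑-swap m n f))
    (sym (∑-+ n (λ j → ∑ m (λ i → f i j)) (f m)))

  ∑-++ : ∀ m n (f : ℕ → ℤ) → ∑ (m ℕ.+ n) f ≡ ∑ m f + ∑ n (λ i → f (m ℕ.+ i))
  ∑-++ m zero    f = trans (cong (λ k → ∑ k f) (ℕP.+-identityʳ m)) (sym (+-identityʳ _))
  ∑-++ m (suc n) f = begin
    ∑ (m ℕ.+ suc n) f                                   ≡⟨ cong (λ k → ∑ k f) (ℕP.+-suc m n) ⟩
    ∑ (m ℕ.+ n) f + f (m ℕ.+ n)                         ≡⟨ cong (_+ f (m ℕ.+ n)) (∑-++ m n f) ⟩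
    ∑ m f + ∑ n (λ i → f (m ℕ.+ i)) + f (m ℕ.+ n)       ≡⟨ +-assoc (∑ m f) _ _ ⟩
    ∑ m f + (∑ n (λ i → f (m ℕ.+ i)) + f (m ℕ.+ n))     ∎
    where open ≡-Reasoning

  ∑-suc : ∀ n (f : ℕ → ℤ) → ∑ (suc n) f ≡ f 0 + ∑ n (λ i → f (suc i))
  ∑-suc n f = trans (∑-++ 1 n f) (cong (_+ ∑ n (λ i → f (suc i))) (+-identityˡ (f 0)))

  ∑-blocks : ∀ m n (f : ℕ → ℤ) → ∑ (m ℕ.* n) f ≡ ∑ m (λ i → ∑ n (λ j → f (i ℕ.* n ℕ.+ j)))
  ∑-blocks zero    n f = refl
  ∑-blocks (suc m) n f = begin
    ∑ (n ℕ.+ m ℕ.* n) f          ≡⟨ cong (λ k → ∑ k f) (ℕP.+-comm n (m ℕ.* n)) ⟩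
    ∑ (m ℕ.* n ℕ.+ n) f          ≡⟨ ∑-++ (m ℕ.* n) n f ⟩
    ∑ (m ℕ.* n) f + _            ≡⟨ cong (_+ ∑ n (λ j → f (m ℕ.* n ℕ.+ j))) (∑-blocks m n f) ⟩
    _                            ∎
    where open ≡-Reasoning

  ∑-single : ∀ n (f : ℕ → ℤ) i₀ → i₀ < n → (∀ i → i < n → i ≢ i₀ → f i ≡ 0ℤ) → ∑ n f ≡ f i₀
  ∑-single (suc n) f i₀ i₀<n h with i₀ ℕP.≟ n
  ... | yes refl = trans (cong (_+ f n) (∑-zero n λ i i<n → h i (ℕP.m<n⇒m<1+n i<n) (ℕP.<⇒≢ i<n)))
                         (+-identityˡ (f n))
  ... | no  i₀≢n = trans
    (cong₂ _+_ (∑-single n f i₀ (ℕP.≤∧≢⇒< (ℕP.≤-pred i₀<n) i₀≢n) λ i i<n → h i (ℕP.m<n⇒m<1+n i<n))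
               (h n ℕP.≤-refl (λ e → i₀≢n (sym e))))
    (+-identityʳ (f i₀))

  ∑≢0 : ∀ n (f : ℕ → ℤ) → ∑ n f ≢ 0ℤ → ∃ λ i → i < n × f i ≢ 0ℤ
  ∑≢0 zero    f ne = ⊥-elim (ne refl)
  ∑≢0 (suc n) f ne with f n ≟ 0ℤ
  ... | no  fn≢0 = n , ℕP.≤-refl , fn≢0
  ... | yes fn≡0 with ∑≢0 n f (λ e → ne (cong₂ _+_ e fn≡0))
  ...   | i , i<n , fi≢0 = i , ℕP.m<n⇒m<1+n i<n , fi≢0

  ∣∑∣≤ : ∀ n (f : ℕ → ℤ) B → (∀ i → i < n → ∣ f i ∣ ≤ B) → ∣ ∑ n f ∣ ≤ n ℕ.* B
  ∣∑∣≤ zero    f B h = z≤n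
  ∣∑∣≤ (suc n) f B h = ℕP.≤-trans (∣i+j∣≤∣i∣+∣j∣ (∑ n f) (f n))
    (ℕP.≤-trans (ℕP.+-mono-≤ (∣∑∣≤ n f B λ i i<n → h i (ℕP.m<n⇒m<1+n i<n)) (h n ℕP.≤-refl))
                (ℕP.≤-reflexive (ℕP.+-comm (n ℕ.* B) B)))

  Δ : (ℕ → ℤ) → ℕ → ℤ
  Δ φ u = φ (suc u) - φ u

  -- Deg d φ: φ is a polynomial function of degree < d.
  Deg : ℕ → (ℕ → ℤ) → Set
  Deg zero    φ = ∀ u → φ u ≡ 0ℤ
  Deg (suc d) φ = Deg d (Δ φ)

  Deg-cong : ∀ d {φ ψ : ℕ → ℤ} → (∀ u → φ u ≡ ψ u) → Deg d φ → Deg d ψ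
  Deg-cong zero    e h u = trans (sym (e u)) (h u)
  Deg-cong (suc d) e h   = Deg-cong d (λ u → cong₂ _-_ (e (suc u)) (e u)) h

  Deg-0 : ∀ d → Deg d (λ _ → 0ℤ)
  Deg-0 zero    u = refl
  Deg-0 (suc d)   = Deg-0 d

  Deg-suc : ∀ d {φ : ℕ → ℤ} → Deg d φ → Deg (suc d) φ
  Deg-suc zero    h u = cong₂ _-_ (h (suc u)) (h u)
  Deg-suc (suc d) h   = Deg-suc d h

  Deg-≤ : ∀ {d e} {φ : ℕ → ℤ} → d ≤ e → Deg d φ → Deg e φ
  Deg-≤ {zero} {zero}  z≤n h = h
  Deg-≤ {zero} {suc e} z≤n h = Deg-suc e (Deg-≤ {zero} {e} z≤n h)
  Deg-≤ (s≤s d≤e) h = Deg-≤ d≤e h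

  Deg-+ : ∀ d {φ ψ : ℕ → ℤ} → Deg d φ → Deg d ψ → Deg d (λ u → φ u + ψ u)
  Deg-+ zero    h k u = cong₂ _+_ (h u) (k u)
  Deg-+ (suc d) {φ} {ψ} h k = Deg-cong d (λ u → lemma (φ (suc u)) (φ u) (ψ (suc u)) (ψ u)) (Deg-+ d h k)
    where
    lemma : ∀ a b c e → (a - b) + (c - e) ≡ (a + c) - (b + e)
    lemma = solve-∀

  Deg-shift : ∀ d k {φ : ℕ → ℤ} → Deg d φ → Deg d (λ u → φ (u ℕ.+ k))
  Deg-shift zero    k h u = h (u ℕ.+ k)
  Deg-shift (suc d) k h   = Deg-shift d k h

  -- The Leibniz rule Δ(φψ) = Δφ · Sψ + φ · Δψ.
  Deg-* : ∀ d e {φ ψ : ℕ → ℤ} → Deg (suc d) φ → Deg (suc e) ψ → Deg (suc (d ℕ.+ e)) (λ u → φ u * ψ u)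
  Deg-* d e {φ} {ψ} h k = Deg-cong (d ℕ.+ e) (λ u → lemma (φ (suc u)) (φ u) (ψ (suc u)) (ψ u))
    (Deg-+ (d ℕ.+ e) (left d h) (right e k))
    where
    lemma : ∀ a b c f → (a - b) * c + b * (c - f) ≡ a * c - b * f
    lemma = solve-∀
    left : ∀ d → Deg d (Δ φ) → Deg (d ℕ.+ e) (λ u → Δ φ u * ψ (suc u))
    left zero    h = Deg-cong e (λ u → sym (trans (cong (_* ψ (suc u)) (h u)) refl)) (Deg-0 e)
    left (suc d) h = Deg-* d e {Δ φ} {λ u → ψ (suc u)} h (Deg-cong (suc e) (λ u → cong ψ (ℕP.+-comm u 1)) (Deg-shift (suc e) 1 {ψ} k))
    right : ∀ e → Deg e (Δ ψ) → Deg (d ℕ.+ e) (λ u → φ u * Δ ψ u)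
    right zero    k = Deg-cong (d ℕ.+ 0) (λ u → sym (trans (cong (φ u *_) (k u)) (*-zeroʳ (φ u)))) (Deg-0 (d ℕ.+ 0))
    right (suc e) k = subst (λ m → Deg m (λ u → φ u * Δ ψ u)) (sym (ℕP.+-suc d e)) (Deg-* d e {φ} {Δ ψ} h k)

  Deg-const : ∀ c → Deg 1 (λ _ → c)
  Deg-const c u = +-inverseʳ c

  -- The base is `suc u` rather than `u` because these numbers later serve as nodes of a Vandermonde
  -- system and must not be zero.
  Deg-^ : ∀ k → Deg (suc k) (λ u → (+ suc u) ^ k)
  Deg-^ zero    = Deg-const 1ℤ
  Deg-^ (suc k) = Deg-* 1 k {λ u → + suc u} {λ u → (+ suc u) ^ k} linear (Deg-^ k)
    where
    linear : Deg 2 (λ u → + suc u)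
    linear u = lemma (+ u)
      where
      lemma : ∀ x → (1ℤ + (1ℤ + (1ℤ + x)) - (1ℤ + (1ℤ + x))) - (1ℤ + (1ℤ + x) - (1ℤ + x)) ≡ 0ℤ
      lemma = solve-∀

  -- Pascal's recursion is the definition, so that `Δ` lowers the second argument by one without
  -- factorials.
  bin : ℕ → ℕ → ℕ
  bin u       zero    = 1
  bin zero    (suc k) = 0
  bin (suc u) (suc k) = bin u k ℕ.+ bin u (suc k)

  Δ-bin : ∀ k u → Δ (λ u → + bin u (suc k)) u ≡ + bin u k
  Δ-bin k u = trans (cong (_- + bin u (suc k)) (pos-+ (bin u k) (bin u (suc k)))) (lemma (+ bin u k) (+ bin u (suc k)))
    where
    lemma : ∀ a b → (a + b) - b ≡ a
    lemma = solve-∀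

  Deg-bin : ∀ k → Deg (suc k) (λ u → + bin u k)
  Deg-bin zero    u = refl
  Deg-bin (suc k)   = Deg-cong (suc k) (λ u → sym (Δ-bin k u)) (Deg-bin k)

  -- The coefficients are the iterated differences at 0: those of `Δ φ`, moved up one place, with
  -- `φ 0` in front. Both sides agree at 0 and have the same differences.
  newton : ∀ d (φ : ℕ → ℤ) → Deg d φ → ∃ λ (c : ℕ → ℤ) → ∀ u → φ u ≡ ∑ d (λ k → c k * + bin u k)
  newton zero    φ h = (λ _ → 0ℤ) , h
  newton (suc d) φ h with newton d (Δ φ) h
  ... | c , e = c′ , expand
    where
    c′ : ℕ → ℤ
    c′ zero    = φ 0
    c′ (suc k) = c k
    tail : ∀ u → ∑ (suc d) (λ k → c′ k * + bin u k) ≡ φ 0 + ∑ d (λ k → c k * + bin u (suc k))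
    tail u = trans (∑-suc d _) (cong (_+ ∑ d (λ k → c k * + bin u (suc k))) (*-identityʳ (φ 0)))
    expand : ∀ u → φ u ≡ ∑ (suc d) (λ k → c′ k * + bin u k)
    expand zero    = sym (trans (tail 0) (trans
      (cong (_+_ (φ 0)) (∑-zero d λ k _ → *-zeroʳ (c k))) (+-identityʳ (φ 0))))
    expand (suc u) = begin
      φ (suc u)                                                          ≡⟨ lemma (φ (suc u)) (φ u) ⟩
      φ u + Δ φ u                                                        ≡⟨ cong₂ _+_ (trans (expand u) (tail u)) (e u) ⟩
      (φ 0 + ∑ d (λ k → c k * + bin u (suc k))) + ∑ d (λ k → c k * + bin u k)
        ≡⟨ +-assoc (φ 0) _ _ ⟩
      φ 0 + (∑ d (λ k → c k * + bin u (suc k)) + ∑ d (λ k → c k * + bin u k))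
        ≡⟨ cong (_+_ (φ 0)) (sym (∑-+ d _ _)) ⟩
      φ 0 + ∑ d (λ k → c k * + bin u (suc k) + c k * + bin u k)
        ≡⟨ cong (_+_ (φ 0)) (∑-cong d λ k _ → pascal (c k) k) ⟩
      φ 0 + ∑ d (λ k → c k * + bin (suc u) (suc k))                      ≡⟨ sym (tail (suc u)) ⟩
      ∑ (suc d) (λ k → c′ k * + bin (suc u) k)                           ∎
      where
      open ≡-Reasoning
      lemma : ∀ a b → a ≡ b + (a - b)
      lemma = solve-∀
      distrib : ∀ x a b → x * b + x * a ≡ x * (a + b)
      distrib = solve-∀
      pascal : ∀ x k → x * + bin u (suc k) + x * + bin u k ≡ x * + bin (suc u) (suc k)
      pascal x k = trans (distrib x (+ bin u k) (+ bin u (suc k))) (cong (x *_) (sym (pos-+ (bin u k) (bin u (suc k)))))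

  -- Discrete integration. At a multiple zero it turns a test function of lower degree into one to
  -- which the full multiplicity applies.
  antidifference : ∀ (φ : ℕ → ℤ) → ∃ λ (ψ : ℕ → ℤ) → ∀ u → Δ ψ u ≡ φ u
  antidifference φ = (λ u → ∑ u φ) , λ u → lemma (∑ u φ) (φ u)
    where
    lemma : ∀ a b → (a + b) - a ≡ b
    lemma = solve-∀

-- Small integer solutions of linear systems

module SiegelsLemma where

  open PolynomialFunctions
  open import Data.Nat as ℕ using (ℕ; zero; suc; z≤n; s≤s; _<_; _≤_)
  import Data.Nat.Properties as ℕP
  open import Data.Fin as Fin using (Fin; toℕ; fromℕ<; finToFun; funToFin; combine)
  import Data.Fin.Properties as FinP
  open import Data.Integer as ℤ using (ℤ; +_; -[1+_]; _+_; _*_; _-_; -_; _^_; 0ℤ; -1ℤ; ∣_∣)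
  open import Data.Integer.Properties
  open import Data.Integer.Tactic.RingSolver using (solve-∀)

  ^-distribʳ-* : ∀ n a b → (a ℕ.* b) ℕ.^ n ≡ a ℕ.^ n ℕ.* b ℕ.^ n
  ^-distribʳ-* zero    a b = refl
  ^-distribʳ-* (suc n) a b = trans (cong (a ℕ.* b ℕ.*_) (^-distribʳ-* n a b))
    (ℕP.[m*n]*[o*p]≡[m*o]*[n*p] a b (a ℕ.^ n) (b ℕ.^ n))

  funToFin-cong : ∀ {m n} {f g : Fin m → Fin n} → (∀ i → f i ≡ g i) → funToFin f ≡ funToFin g
  funToFin-cong {zero}  h = refl
  funToFin-cong {suc m} h = cong₂ combine (h Fin.zero) (funToFin-cong (λ i → h (Fin.suc i)))

  finToFun-injective : ∀ {m n} (i j : Fin (m ℕ.^ n)) → (∀ k → finToFun {m} {n} i k ≡ finToFun j k) → i ≡ j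
  finToFun-injective {m} {n} i j h = trans (sym (FinP.funToFin-finToFin {n} {m} i))
    (trans (funToFin-cong h) (FinP.funToFin-finToFin {n} {m} j))

  pigeonhole-vectors : ∀ m n M N → m ℕ.^ M < n ℕ.^ N → (f : (Fin N → Fin n) → Fin M → Fin m) →
    ∃ λ x → ∃ λ y → (∃ λ e → x e ≢ y e) × (∀ k → f x k ≡ f y k)
  pigeonhole-vectors m n M N lt f
    with FinP.pigeonhole lt (λ i → funToFin (f (finToFun i)))
  ... | i , j , i<j , eq = finToFun i , finToFun j , differ , same
    where
    differ : ∃ λ e → finToFun {n} {N} i e ≢ finToFun j e
    differ with FinP.any? (λ e → ¬? (finToFun {n} {N} i e FinP.≟ finToFun j e))
    ... | yes found = found
    ... | no  none  = contradiction
      (finToFun-injective i j λ k → decidable-stable (_ FinP.≟ _) (λ ne → none (k , ne)))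
      (FinP.<⇒≢ i<j)
    same : ∀ k → f (finToFun i) k ≡ f (finToFun j) k
    same k = trans (sym (FinP.finToFun-funToFin (f (finToFun i)) k))
      (trans (cong (λ z → finToFun z k) eq) (FinP.finToFun-funToFin (f (finToFun j)) k))

  -- Vectors have index set `Fin N` for the pigeonhole principle and ℕ for summation; this passes
  -- from the first to the second.
  extend : ∀ {N} → (Fin N → ℤ) → ℕ → ℤ
  extend {N} f e with e ℕP.<? N
  ... | yes e<N = f (fromℕ< e<N)
  ... | no  _   = 0ℤ

  extend-< : ∀ {N} (f : Fin N → ℤ) e (e<N : e < N) → extend f e ≡ f (fromℕ< e<N)
  extend-< {N} f e e<N with e ℕP.<? N
  ... | yes _   = refl
  ... | no  e≮N = contradiction e<N e≮N

  extend-∀ : ∀ {N} (P : ℤ → Set) (f : Fin N → ℤ) → P 0ℤ → (∀ i → P (f i)) → ∀ e → P (extend f e)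
  extend-∀ {N} P f p0 h e with e ℕP.<? N
  ... | yes e<N = h (fromℕ< e<N)
  ... | no  _   = p0

  0≤i+n : ∀ i n → ∣ i ∣ ≤ n → 0ℤ ℤ.≤ i + + n
  0≤i+n (+ m)    n h = ℤ.+≤+ z≤n
  0≤i+n -[1+ m ] n h = subst (0ℤ ℤ.≤_) (sym (⊖-≥ h)) (ℤ.+≤+ z≤n)

  -- There are `h ^ N` vectors with entries below `h`. Each form is at most N B h in absolute value
  -- on them, so it takes at most 2 N B h + 1 values. Two vectors on which all forms agree differ by
  -- a solution.
  siegel : ∀ M N B h (a : ℕ → ℕ → ℤ) → (∀ k e → k < M → e < N → ∣ a k e ∣ ≤ B) →
    suc (N ℕ.* (B ℕ.* h) ℕ.+ N ℕ.* (B ℕ.* h)) ℕ.^ M < h ℕ.^ N →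
    ∃ λ (p : ℕ → ℤ) → (∀ e → ∣ p e ∣ ≤ h) × (∃ λ e → e < N × p e ≢ 0ℤ) ×
      (∀ k → k < M → ∑ N (λ e → a k e * p e) ≡ 0ℤ)
  siegel M N B h a bound lt with pigeonhole-vectors (suc (C ℕ.+ C)) h M N lt code
    where
    C = N ℕ.* (B ℕ.* h)
    value : (Fin N → Fin h) → ℕ → ℤ
    value x k = ∑ N (λ e → a k e * extend (λ i → + toℕ (x i)) e)
    -- Adding `C` makes the value nonnegative, so that its absolute value still determines it.
    code : (Fin N → Fin h) → Fin M → Fin (suc (C ℕ.+ C))
    code x k = fromℕ< {∣ value x (toℕ k) + + C ∣} (s≤s (ℕP.≤-trans (∣i+j∣≤∣i∣+∣j∣ (value x (toℕ k)) (+ C))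
      (ℕP.+-monoˡ-≤ C (∣∑∣≤ N _ (B ℕ.* h) λ e e<N →
        ℕP.≤-trans (ℕP.≤-reflexive (abs-* (a (toℕ k) e) _))
          (ℕP.*-mono-≤ (bound (toℕ k) e (FinP.toℕ<n k) e<N)
            (extend-∀ (λ z → ∣ z ∣ ≤ h) _ z≤n (λ i → ℕP.<⇒≤ (FinP.toℕ<n (x i))) e))))))
  ... | x , y , (e , xe≢ye) , same = p , small , (toℕ e , FinP.toℕ<n e , nonzero) , solves
    where
    C = N ℕ.* (B ℕ.* h)
    X Y : ℕ → ℤ
    X = extend (λ i → + toℕ (x i))
    Y = extend (λ i → + toℕ (y i))
    p : ℕ → ℤ
    p = extend (λ i → + toℕ (x i) - + toℕ (y i))
    p-diff : ∀ e → e < N → p e ≡ X e - Y e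
    p-diff e e<N = trans (extend-< _ e e<N) (sym (cong₂ _-_ (extend-< _ e e<N) (extend-< _ e e<N)))
    small : ∀ e → ∣ p e ∣ ≤ h
    small = extend-∀ (λ z → ∣ z ∣ ≤ h) _ z≤n λ i →
      ℕP.≤-trans (ℕP.≤-reflexive (cong ∣_∣ (m-n≡m⊖n (toℕ (x i)) (toℕ (y i)))))
        (ℕP.≤-trans (∣m⊝n∣≤m⊔n (toℕ (x i)) (toℕ (y i)))
          (ℕP.⊔-lub (ℕP.<⇒≤ (FinP.toℕ<n (x i))) (ℕP.<⇒≤ (FinP.toℕ<n (y i)))))
    nonzero : p (toℕ e) ≢ 0ℤ
    nonzero pe≡0 = xe≢ye (FinP.toℕ-injective (+-injective (i-j≡0⇒i≡j _ _
      (trans (cong (λ i → + toℕ (x i) - + toℕ (y i)) (sym (FinP.fromℕ<-toℕ e (FinP.toℕ<n e))))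
        (trans (sym (extend-< _ (toℕ e) (FinP.toℕ<n e))) pe≡0)))))
    bounded : ∀ (z : Fin N → Fin h) k → k < M → ∣ ∑ N (λ e → a k e * extend (λ i → + toℕ (z i)) e) ∣ ≤ C
    bounded z k k<M = ∣∑∣≤ N _ (B ℕ.* h) λ e e<N →
        ℕP.≤-trans (ℕP.≤-reflexive (abs-* (a k e) _))
          (ℕP.*-mono-≤ (bound k e k<M e<N)
            (extend-∀ (λ z → ∣ z ∣ ≤ h) _ z≤n (λ i → ℕP.<⇒≤ (FinP.toℕ<n (z i))) e))
    equal : ∀ k → k < M → ∑ N (λ e → a k e * X e) ≡ ∑ N (λ e → a k e * Y e)
    equal k k<M = +-cancelʳ (trans (sym (0≤i⇒+∣i∣≡i (0≤i+n (∑ N (λ e → a k e * X e)) C (bounded x k k<M))))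
        (trans (cong +_ abs-eq) (0≤i⇒+∣i∣≡i (0≤i+n (∑ N (λ e → a k e * Y e)) C (bounded y k k<M)))))
      where
      +-cancelʳ : ∀ {a b c} → a + c ≡ b + c → a ≡ b
      +-cancelʳ {a} {b} {c} e = trans (sym (lemma a c)) (trans (cong (_- c) e) (lemma b c))
        where
        lemma : ∀ a c → (a + c) - c ≡ a
        lemma = solve-∀
      abs-eq : ∣ ∑ N (λ e → a k e * X e) + + C ∣ ≡ ∣ ∑ N (λ e → a k e * Y e) + + C ∣
      abs-eq = subst (λ k → ∣ ∑ N (λ e → a k e * X e) + + C ∣ ≡ ∣ ∑ N (λ e → a k e * Y e) + + C ∣)
        (FinP.toℕ-fromℕ< k<M)
        (trans (sym (FinP.toℕ-fromℕ< _)) (trans (cong toℕ (same (fromℕ< k<M))) (FinP.toℕ-fromℕ< _)))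
    solves : ∀ k → k < M → ∑ N (λ e → a k e * p e) ≡ 0ℤ
    solves k k<M = begin
      ∑ N (λ e → a k e * p e)
        ≡⟨ ∑-cong N (λ e e<N → trans (cong (a k e *_) (p-diff e e<N)) (lemma (a k e) (X e) (Y e))) ⟩
      ∑ N (λ e → a k e * X e + -1ℤ * (a k e * Y e))                 ≡⟨ ∑-+ N _ _ ⟩
      ∑ N (λ e → a k e * X e) + ∑ N (λ e → -1ℤ * (a k e * Y e))     ≡⟨ cong₂ _+_ (equal k k<M) (sym (*-∑ -1ℤ N _)) ⟩
      ∑ N (λ e → a k e * Y e) + -1ℤ * ∑ N (λ e → a k e * Y e)       ≡⟨ cancel (∑ N (λ e → a k e * Y e)) ⟩
      0ℤ                                                            ∎
      where
      open ≡-Reasoning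
      lemma : ∀ a b c → a * (b - c) ≡ a * b + -1ℤ * (a * c)
      lemma = solve-∀
      cancel : ∀ a → a + -1ℤ * a ≡ 0ℤ
      cancel = solve-∀

  -- The solution may be arbitrarily large, so `h` is taken above `c ^ M`, where `c * h` bounds the
  -- number of values of a form. Then `(c * h) ^ M < h ^ suc M`, and `M < N` finishes the count.
  homogeneous : ∀ M N (a : ℕ → ℕ → ℤ) → M < N →
    ∃ λ (p : ℕ → ℤ) → (∃ λ e → e < N × p e ≢ 0ℤ) × (∀ k → k < M → ∑ N (λ e → a k e * p e) ≡ 0ℤ)
  homogeneous M N a M<N =
    let (p , _ , nz , eqs) = siegel M N B h a bound count in p , nz , eqs
    where
    maxTo : ℕ → (ℕ → ℕ) → ℕ
    maxTo zero    f = 0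
    maxTo (suc n) f = maxTo n f ℕ.⊔ f n
    ≤maxTo : ∀ n f i → i < n → f i ≤ maxTo n f
    ≤maxTo (suc n) f i i<n with i ℕP.≟ n
    ... | yes refl = ℕP.m≤n⊔m (maxTo n f) (f n)
    ... | no  i≢n  = ℕP.≤-trans (≤maxTo n f i (ℕP.≤∧≢⇒< (ℕP.≤-pred i<n) i≢n)) (ℕP.m≤m⊔n (maxTo n f) (f n))
    B = maxTo M (λ k → maxTo N (λ e → ∣ a k e ∣))
    c = suc (N ℕ.* B ℕ.+ N ℕ.* B)
    h = suc (c ℕ.^ M)
    bound : ∀ k e → k < M → e < N → ∣ a k e ∣ ≤ B
    bound k e k<M e<N = ℕP.≤-trans (≤maxTo N _ e e<N) (≤maxTo M (λ k → maxTo N (λ e → ∣ a k e ∣)) k k<M)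
    step : suc (N ℕ.* (B ℕ.* h) ℕ.+ N ℕ.* (B ℕ.* h)) ≤ c ℕ.* h
    step = ℕP.≤-trans (s≤s (ℕP.≤-reflexive (trans
        (cong₂ ℕ._+_ (sym (ℕP.*-assoc N B h)) (sym (ℕP.*-assoc N B h)))
        (sym (ℕP.*-distribʳ-+ h (N ℕ.* B) (N ℕ.* B))))))
      (ℕP.+-monoˡ-≤ ((N ℕ.* B ℕ.+ N ℕ.* B) ℕ.* h) (s≤s z≤n))
    count : suc (N ℕ.* (B ℕ.* h) ℕ.+ N ℕ.* (B ℕ.* h)) ℕ.^ M < h ℕ.^ N
    count = begin-strict
      suc (N ℕ.* (B ℕ.* h) ℕ.+ N ℕ.* (B ℕ.* h)) ℕ.^ M   ≤⟨ ℕP.^-monoˡ-≤ M step ⟩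
      (c ℕ.* h) ℕ.^ M                                   ≡⟨ ^-distribʳ-* M c h ⟩
      c ℕ.^ M ℕ.* h ℕ.^ M                               <⟨ ℕP.*-monoˡ-< (h ℕ.^ M) {{ℕP.m^n≢0 h M}} (ℕP.n<1+n (c ℕ.^ M)) ⟩
      h ℕ.^ suc M                                       ≤⟨ ℕP.^-monoʳ-≤ h M<N ⟩
      h ℕ.^ N                                           ∎
      where
      open ℕP.≤-Reasoning

-- Hermite interpolation on the projective line

module HermiteInterpolation where

  open PolynomialFunctions
  open import Data.Nat as ℕ using (ℕ; zero; suc; z≤n; s≤s; _<_; _≤_; _∸_)
  import Data.Nat.Properties as ℕP
  open import Data.Integer using (ℤ; +_; _+_; _*_; _-_; -_; _^_; 0ℤ; 1ℤ)
  open import Data.Integer.Properties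
  open import Data.Integer.Tactic.RingSolver using (solve-∀)
  open import Data.List.Relation.Unary.All as All using (All; []; _∷_)
  import Data.List.Relation.Unary.All.Properties as AllP
  open import Data.List.Relation.Unary.AllPairs as AllPairs using (AllPairs; []; _∷_)
  import Data.List.Relation.Unary.AllPairs.Properties as AllPairsP

  ^-*-distrib : ∀ n a b → (a * b) ^ n ≡ a ^ n * b ^ n
  ^-*-distrib zero    a b = refl
  ^-*-distrib (suc n) a b = trans (cong (a * b *_) (^-*-distrib n a b)) (lemma a b (a ^ n) (b ^ n))
    where
    lemma : ∀ a b c d → a * b * (c * d) ≡ a * c * (b * d)
    lemma = solve-∀

  *-≢0 : ∀ {a b} → a ≢ 0ℤ → b ≢ 0ℤ → a * b ≢ 0ℤ
  *-≢0 {a} a≢0 b≢0 e with i*j≡0⇒i≡0∨j≡0 a e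
  ... | inj₁ a≡0 = a≢0 a≡0
  ... | inj₂ b≡0 = b≢0 b≡0

  *-cancel-0 : ∀ {a b} → a ≢ 0ℤ → a * b ≡ 0ℤ → b ≡ 0ℤ
  *-cancel-0 {a} a≢0 e with i*j≡0⇒i≡0∨j≡0 a e
  ... | inj₁ a≡0 = contradiction a≡0 a≢0
  ... | inj₂ b≡0 = b≡0

  ^-≢0 : ∀ {a} n → a ≢ 0ℤ → a ^ n ≢ 0ℤ
  ^-≢0 {a} n a≢0 e = a≢0 (i^n≡0⇒i≡0 a n e)

  -- The point num / den of the projective line.
  record Point : Set where
    constructor point
    field
      num den : ℤ
      mult    : ℕ
  open Point

  Proper : Point → Set
  Proper P = num P ≢ 0ℤ × den P ≢ 0ℤ

  Apart : Point → Point → Set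
  Apart P Q = den Q * num P - den P * num Q ≢ 0ℤ

  total : List Point → ℕ
  total []       = 0
  total (P ∷ Ps) = mult P ℕ.+ total Ps

  -- The form with coefficients `g m * ψ (m + o)` at the point (y : z), homogenised to avoid
  -- fractions. The offset `o` allows test functions of a total exponent that is shifted from row to
  -- row.
  pairing : ℕ → ℕ → (ℕ → ℤ) → ℤ → ℤ → (ℕ → ℤ) → ℤ
  pairing o R g y z ψ = ∑ R (λ m → g m * (y ^ m * z ^ (R ∸ suc m)) * ψ (m ℕ.+ o))

  -- The form Σ g_m Y^m Z^(R-1-m) vanishes to order mult P at P; the derivatives are
  -- replaced by arbitrary polynomial factors ψ of the exponent (shifted by o).
  Vanishes : ℕ → ℕ → (ℕ → ℤ) → Point → Set
  Vanishes o R g P = ∀ ψ → Deg (mult P) ψ → pairing o R g (num P) (den P) ψ ≡ 0ℤ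

  module Deflate (y z : ℤ) (g : ℕ → ℤ) where

    -- The coefficients of the quotient of Σ g_m y^m X^m by 1 - z X.
    quot : ℕ → ℤ
    quot zero    = g 0
    quot (suc m) = z * quot m + y ^ suc m * g (suc m)

    quot-∑ : ∀ R → quot R ≡ ∑ (suc R) (λ m → g m * (y ^ m * z ^ (R ∸ m)))
    quot-∑ zero    = lemma (g 0)
      where
      lemma : ∀ a → a ≡ 0ℤ + a * (1ℤ * 1ℤ)
      lemma = solve-∀
    quot-∑ (suc R) = begin
      z * quot R + y ^ suc R * g (suc R)
        ≡⟨ cong (λ x → z * x + y ^ suc R * g (suc R)) (quot-∑ R) ⟩
      z * ∑ (suc R) (λ m → g m * (y ^ m * z ^ (R ∸ m))) + y ^ suc R * g (suc R)
        ≡⟨ cong₂ _+_ (*-∑ z (suc R) _) (last (y ^ suc R) (g (suc R))) ⟩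
      ∑ (suc R) (λ m → z * (g m * (y ^ m * z ^ (R ∸ m)))) + g (suc R) * (y ^ suc R * 1ℤ)
        ≡⟨ cong₂ _+_ (∑-cong (suc R) raise) (cong (λ k → g (suc R) * (y ^ suc R * z ^ k)) (sym (ℕP.n∸n≡0 R))) ⟩
      ∑ (suc R) (λ m → g m * (y ^ m * z ^ (suc R ∸ m))) + g (suc R) * (y ^ suc R * z ^ (R ∸ R)) ∎
      where
      open ≡-Reasoning
      last : ∀ a b → a * b ≡ b * (a * 1ℤ)
      last = solve-∀
      lemma : ∀ z a b c → z * (a * (b * c)) ≡ a * (b * (z * c))
      lemma = solve-∀
      raise : ∀ m → m < suc R → z * (g m * (y ^ m * z ^ (R ∸ m))) ≡ g m * (y ^ m * z ^ (suc R ∸ m))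
      raise m (s≤s m≤R) = trans (lemma z (g m) (y ^ m) (z ^ (R ∸ m)))
        (cong (λ k → g m * (y ^ m * z ^ k)) (sym (ℕP.+-∸-assoc 1 m≤R)))

    -- Summation by parts: `y ^ m * g m` is the difference of `quot m` and z times its predecessor,
    -- and the last quotient is the boundary term.
    abel : ∀ R (v : ℕ → ℤ) →
      ∑ (suc R) (λ m → g m * y ^ m * v m) ≡ quot R * v R + ∑ R (λ m → quot m * (v m - z * v (suc m)))
    abel zero    v = lemma (g 0) (v 0)
      where
      lemma : ∀ a b → 0ℤ + a * 1ℤ * b ≡ a * b + 0ℤ
      lemma = solve-∀
    abel (suc R) v = trans (cong (_+ g (suc R) * y ^ suc R * v (suc R)) (abel R v))
      (lemma (quot R) (v R) (∑ R (λ m → quot m * (v m - z * v (suc m)))) (g (suc R)) (y ^ suc R) (v (suc R)) z)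
      where
      lemma : ∀ q v s g y v′ z → (q * v + s) + g * y * v′ ≡ (z * q + y * g) * v′ + (s + q * (v - z * v′))
      lemma = solve-∀

    -- A Leibniz rule for linear factor times quotient. The determinant on the left is zero exactly
    -- at the divided point: there, vanishing against `ψ` passes to the quotient and `Δ ψ`;
    -- elsewhere, vanishing of the quotient against `Δ ψ` gives it against `ψ`.
    key : ∀ o R y′ z′ ψ → quot R ≡ 0ℤ → pairing o (suc R) g y′ z′ ψ ≡ 0ℤ →
      (z′ * y - z * y′) * pairing o R quot y′ (z′ * y) ψ ≡ z * y′ * pairing o R quot y′ (z′ * y) (Δ ψ)
    key o R y′ z′ ψ qR h = i-j≡0⇒i≡j _ _ (begin
      (z″ - z * y′) * ∑ R (λ m → quot m * w m * ψ (m ℕ.+ o)) - z * y′ * ∑ R (λ m → quot m * w m * Δ ψ (m ℕ.+ o))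
        ≡⟨ minus (z″ - z * y′) (z * y′) (∑ R (λ m → quot m * w m * ψ (m ℕ.+ o))) (∑ R (λ m → quot m * w m * Δ ψ (m ℕ.+ o))) ⟩
      (z″ - z * y′) * ∑ R (λ m → quot m * w m * ψ (m ℕ.+ o)) + - (z * y′) * ∑ R (λ m → quot m * w m * Δ ψ (m ℕ.+ o))
        ≡⟨ cong₂ _+_ (*-∑ (z″ - z * y′) R _) (*-∑ (- (z * y′)) R _) ⟩
      ∑ R (λ m → (z″ - z * y′) * (quot m * w m * ψ (m ℕ.+ o))) + ∑ R (λ m → - (z * y′) * (quot m * w m * Δ ψ (m ℕ.+ o)))
        ≡⟨ sym (∑-+ R _ _) ⟩
      ∑ R (λ m → (z″ - z * y′) * (quot m * w m * ψ (m ℕ.+ o)) + - (z * y′) * (quot m * w m * Δ ψ (m ℕ.+ o)))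
        ≡⟨ ∑-cong R regroup ⟩
      ∑ R (λ m → quot m * (v m - z * v (suc m)))
        ≡⟨ drop (quot R) (v R) (∑ R (λ m → quot m * (v m - z * v (suc m)))) qR ⟩
      quot R * v R + ∑ R (λ m → quot m * (v m - z * v (suc m)))
        ≡⟨ sym (abel R v) ⟩
      ∑ (suc R) (λ m → g m * y ^ m * v m)
        ≡⟨ ∑-cong (suc R) rescale ⟩
      ∑ (suc R) (λ m → y ^ R * (g m * (y′ ^ m * z′ ^ (R ∸ m)) * ψ (m ℕ.+ o)))
        ≡⟨ sym (*-∑ (y ^ R) (suc R) _) ⟩
      y ^ R * pairing o (suc R) g y′ z′ ψ
        ≡⟨ cong (y ^ R *_) h ⟩
      y ^ R * 0ℤ
        ≡⟨ *-zeroʳ (y ^ R) ⟩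
      0ℤ ∎)
      where
      open ≡-Reasoning
      z″ : ℤ
      z″ = z′ * y
      w v : ℕ → ℤ
      w m = y′ ^ m * z″ ^ (R ∸ suc m)
      v m = y′ ^ m * z″ ^ (R ∸ m) * ψ (m ℕ.+ o)
      minus : ∀ a b s t → a * s - b * t ≡ a * s + - b * t
      minus = solve-∀
      drop : ∀ q v s → q ≡ 0ℤ → s ≡ q * v + s
      drop .0ℤ v s refl = sym (+-identityˡ s)
      regroup : ∀ m → m < R → (z″ - z * y′) * (quot m * w m * ψ (m ℕ.+ o)) + - (z * y′) * (quot m * w m * Δ ψ (m ℕ.+ o))
        ≡ quot m * (v m - z * v (suc m))
      regroup m m<R = trans
        (lemma (quot m) (y′ ^ m) (z″ ^ (R ∸ suc m)) (ψ (m ℕ.+ o)) (ψ (suc m ℕ.+ o)) z y′ z″)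
        (cong (λ k → quot m * (y′ ^ m * z″ ^ k * ψ (m ℕ.+ o) - z * v (suc m)))
          (sym (ℕP.+-∸-assoc 1 m<R)))
        where
        lemma : ∀ q a b s t z y w → (w - z * y) * (q * (a * b) * s) + - (z * y) * (q * (a * b) * (t - s))
          ≡ q * (a * (w * b) * s - z * (y * a * b * t))
        lemma = solve-∀
      rescale : ∀ m → m < suc R → g m * y ^ m * v m ≡ y ^ R * (g m * (y′ ^ m * z′ ^ (R ∸ m)) * ψ (m ℕ.+ o))
      rescale m (s≤s m≤R) = begin
        g m * y ^ m * (y′ ^ m * z″ ^ k * ψ (m ℕ.+ o))
          ≡⟨ cong (λ x → g m * y ^ m * (y′ ^ m * x * ψ (m ℕ.+ o))) (^-*-distrib k z′ y) ⟩
        g m * y ^ m * (y′ ^ m * (z′ ^ k * y ^ k) * ψ (m ℕ.+ o))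
          ≡⟨ lemma (g m) (y ^ m) (y′ ^ m) (z′ ^ k) (y ^ k) (ψ (m ℕ.+ o)) ⟩
        y ^ m * y ^ k * (g m * (y′ ^ m * z′ ^ k) * ψ (m ℕ.+ o))
          ≡⟨ cong (_* (g m * (y′ ^ m * z′ ^ k) * ψ (m ℕ.+ o)))
               (trans (sym (^-distribˡ-+-* y m k)) (cong (y ^_) (ℕP.m+[n∸m]≡n m≤R))) ⟩
        y ^ R * (g m * (y′ ^ m * z′ ^ k) * ψ (m ℕ.+ o)) ∎
        where
        k = R ∸ m
        lemma : ∀ g a b c d s → g * a * (b * (c * d) * s) ≡ a * d * (g * (b * c) * s)
        lemma = solve-∀

  pairing-zero : ∀ o R g y z ψ → (∀ u → ψ u ≡ 0ℤ) → pairing o R g y z ψ ≡ 0ℤ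
  pairing-zero o R g y z ψ h = ∑-zero R λ m _ →
    trans (cong (g m * (y ^ m * z ^ (R ∸ suc m)) *_) (h (m ℕ.+ o))) (*-zeroʳ (g m * (y ^ m * z ^ (R ∸ suc m))))

  pairing-cong : ∀ o R g y z {φ ψ : ℕ → ℤ} → (∀ u → φ u ≡ ψ u) → pairing o R g y z φ ≡ pairing o R g y z ψ
  pairing-cong o R g y z h = ∑-cong R λ m _ → cong (g m * (y ^ m * z ^ (R ∸ suc m)) *_) (h (m ℕ.+ o))

  -- Each step divides by one linear factor, which lowers the multiplicity of that zero only.
  hermite : ∀ o R (Ps : List Point) g → R ≤ total Ps → All Proper Ps → AllPairs Apart Ps →
    All (Vanishes o R g) Ps → ∀ m → m < R → g m ≡ 0ℤ
  hermite o (suc R) (point y z zero ∷ Ps) g R≤ (_ ∷ proper) (_ ∷ apart) (_ ∷ van) =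
    hermite o (suc R) Ps g R≤ proper apart van
  hermite o (suc R) (point y z (suc ℓ) ∷ Ps) g (s≤s R≤) ((y≢0 , z≢0) ∷ proper) (apart₁ ∷ apart) (van₁ ∷ van) = g≡0
    where
    open Deflate y z g
    -- The quotient is a form in Y / (y Z), so a remaining point (y′ : z′) becomes (y′ : z′ y).
    scale : Point → Point
    scale (point y′ z′ l) = point y′ (z′ * y) l
    -- The remainder of the division is the value at the point itself, which is the pairing with the
    -- constant 1.
    quotR : quot R ≡ 0ℤ
    quotR = trans (quot-∑ R) (trans (∑-cong (suc R) λ m _ → sym (*-identityʳ _))
      (van₁ (λ _ → 1ℤ) (Deg-≤ {1} {suc ℓ} {λ _ → 1ℤ} (s≤s z≤n) (Deg-const 1ℤ))))
    -- The determinant is 0 here, so the given test function is written as `Δ ψ` with `ψ` of one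
    -- degree more.
    vanish-same : Vanishes o R quot (point y (z * y) ℓ)
    vanish-same φ hφ with antidifference φ
    ... | ψ , e = *-cancel-0 (*-≢0 z≢0 y≢0) (trans
      (sym (trans (key o R y z ψ quotR (van₁ ψ (Deg-cong ℓ (λ u → sym (e u)) hφ)))
        (cong (z * y *_) (pairing-cong o R quot y (z * y) e))))
      (trans (cong (_* pairing o R quot y (z * y) ψ) (+-inverseʳ (z * y))) refl))
    -- The determinant is nonzero here, and induction on the degree removes the term with `Δ ψ`; no
    -- multiplicity is lost.
    vanish-other : ∀ {P} → Apart (point y z (suc ℓ)) P → Vanishes o (suc R) g P → Vanishes o R quot (scale P)
    vanish-other {point y′ z′ l} ap vP ψ hψ = go l ℕP.≤-refl ψ hψ
      where
      go : ∀ k → k ≤ l → ∀ ψ → Deg k ψ → pairing o R quot y′ (z′ * y) ψ ≡ 0ℤ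
      go zero    k≤l ψ hψ = pairing-zero o R quot y′ (z′ * y) ψ hψ
      go (suc k) k≤l ψ hψ = *-cancel-0 ap (trans
        (key o R y′ z′ ψ quotR (vP ψ (Deg-≤ {suc k} {l} {ψ} k≤l hψ)))
        (trans (cong (z * y′ *_) (go k (ℕP.≤-trans (ℕP.n≤1+n k) k≤l) (Δ ψ) hψ)) (*-zeroʳ (z * y′))))
    total-scale : ∀ Ps → total (map scale Ps) ≡ total Ps
    total-scale []                 = refl
    total-scale (point _ _ l ∷ Ps) = cong (l ℕ.+_) (total-scale Ps)
    proper-scale : ∀ {P} → Proper P → Proper (scale P)
    proper-scale (a , b) = a , *-≢0 b y≢0
    apart-scale : ∀ {P Q} → Apart P Q → Apart (scale P) (scale Q)
    apart-scale {point a b _} {point c d _} ap e = *-≢0 y≢0 ap (trans (lemma y a b c d) e)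
      where
      lemma : ∀ y a b c d → y * (d * a - b * c) ≡ d * y * a - b * y * c
      lemma = solve-∀
    quot≡0 : ∀ m → m < R → quot m ≡ 0ℤ
    quot≡0 = hermite o R (point y (z * y) ℓ ∷ map scale Ps) quot
      (subst (λ t → R ≤ ℓ ℕ.+ t) (sym (total-scale Ps)) R≤)
      ((y≢0 , *-≢0 z≢0 y≢0) ∷ AllP.map⁺ (All.map (λ {P} → proper-scale {P}) proper))
      (AllP.map⁺ (All.map (λ {P} ap → apart-scale {point y z ℓ} {P} ap) apart₁)
        ∷ AllPairsP.map⁺ (AllPairs.map (λ {P} {Q} → apart-scale {P} {Q}) apart))
      (vanish-same ∷ AllP.map⁺ (All.zipWith (λ {P} (ap , vP) → vanish-other {P} ap vP) (apart₁ , van)))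
    quot≡0′ : ∀ m → m ≤ R → quot m ≡ 0ℤ
    quot≡0′ m m≤R with m ℕP.≟ R
    ... | yes refl = quotR
    ... | no  m≢R  = quot≡0 m (ℕP.≤∧≢⇒< m≤R m≢R)
    g≡0 : ∀ m → m < suc R → g m ≡ 0ℤ
    g≡0 zero    _           = quot≡0′ 0 z≤n
    g≡0 (suc m) (s≤s m<R) = *-cancel-0 (^-≢0 (suc m) y≢0) (begin
      y ^ suc m * g (suc m)               ≡⟨ sym (+-identityˡ _) ⟩
      0ℤ + y ^ suc m * g (suc m)          ≡⟨ cong (_+ y ^ suc m * g (suc m)) (sym (trans (cong (z *_) (quot≡0′ m (ℕP.<⇒≤ m<R))) (*-zeroʳ z))) ⟩
      z * quot m + y ^ suc m * g (suc m)  ≡⟨ quot≡0′ (suc m) m<R ⟩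
      0ℤ                                  ∎)
      where open ≡-Reasoning

-- A zero estimate in two variables

module ZeroEstimate where

  open PolynomialFunctions
  open SiegelsLemma
  open HermiteInterpolation
  open import Data.Nat as ℕ using (ℕ; zero; suc; z≤n; _<_; _≤_; _∸_; NonZero; >-nonZero)
  import Data.Nat.Properties as ℕP
  import Data.Nat.DivMod as DM
  open import Data.Integer using (ℤ; +_; _+_; _*_; _-_; -_; _^_; 0ℤ; 1ℤ)
  open import Data.Integer.Properties
  open import Data.Integer.Tactic.RingSolver using (solve-∀)
  open import Data.List.Relation.Unary.All using (All; []; _∷_)
  open import Data.List.Relation.Unary.AllPairs using (AllPairs; []; _∷_)
  open import Data.Nat.Tactic.RingSolver using () renaming (solve-∀ to solveℕ-∀)

  greatest : ∀ {P : ℕ → Set} → Decidable P → ∀ N → (∃ λ i → i < N × P i) →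
    ∃ λ i → i < N × P i × (∀ k → k < N → i < k → ¬ P k)
  greatest P? (suc N) (i , i<N , Pi) with P? N
  ... | yes PN = N , ℕP.≤-refl , PN , λ k k<N N<k → contradiction N<k (ℕP.<⇒≱ k<N)
  ... | no ¬PN with greatest P? N (i , ℕP.≤∧≢⇒< (ℕP.≤-pred i<N) (λ { refl → ¬PN Pi }) , Pi)
  ...   | m , m<N , Pm , above = m , ℕP.m<n⇒m<1+n m<N , Pm , above′
    where
    above′ : ∀ k → k < suc N → m < k → ¬ _
    above′ k k<N m<k with k ℕP.≟ N
    ... | yes refl = ¬PN
    ... | no  k≢N  = above k (ℕP.≤∧≢⇒< (ℕP.≤-pred k<N) k≢N) m<k

  [i*n+j]/n : ∀ i n j .{{_ : NonZero n}} → j < n → (i ℕ.* n ℕ.+ j) DM./ n ≡ i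
  [i*n+j]/n i n j j<n = trans (DM.+-distrib-/-∣ˡ j (divides-refl i)) (trans
    (cong₂ ℕ._+_ (DM.m*n/n≡m i n) (DM.m<n⇒m/n≡0 j<n)) (ℕP.+-identityʳ i))
    where open import Data.Nat.Divisibility using (divides-refl)

  [i*n+j]%n : ∀ i n j .{{_ : NonZero n}} → j < n → (i ℕ.* n ℕ.+ j) DM.% n ≡ j
  [i*n+j]%n i n j j<n = trans (cong (DM._% n) (ℕP.+-comm (i ℕ.* n) j))
    (trans (DM.[m+kn]%n≡m%n j i n) (DM.m<n⇒m%n≡m j<n))

  points : ℕ → (ℕ → ℤ) → (ℕ → ℤ) → ℕ → List Point
  points ℓ y z zero    = []
  points ℓ y z (suc T) = point (y T) (z T) ℓ ∷ points ℓ y z T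

  total-points : ∀ ℓ y z T → total (points ℓ y z T) ≡ T ℕ.* ℓ
  total-points ℓ y z zero    = refl
  total-points ℓ y z (suc T) = cong (ℓ ℕ.+_) (total-points ℓ y z T)

  All-points : ∀ {Q : Point → Set} ℓ y z T → (∀ τ → τ < T → Q (point (y τ) (z τ) ℓ)) → All Q (points ℓ y z T)
  All-points ℓ y z zero    h = []
  All-points ℓ y z (suc T) h = h T ℕP.≤-refl ∷ All-points ℓ y z T λ τ τ<T → h τ (ℕP.m<n⇒m<1+n τ<T)

  Apart-points : ∀ ℓ y z T → (∀ σ τ → σ < T → τ < T → σ ≢ τ → z σ * y τ - z τ * y σ ≢ 0ℤ) →
    AllPairs Apart (points ℓ y z T)
  Apart-points ℓ y z zero    h = []
  Apart-points ℓ y z (suc T) h =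
    All-points ℓ y z T (λ τ τ<T → h τ T (ℕP.m<n⇒m<1+n τ<T) ℕP.≤-refl (ℕP.<⇒≢ τ<T))
    ∷ Apart-points ℓ y z T λ σ τ σ<T τ<T → h σ τ (ℕP.m<n⇒m<1+n σ<T) (ℕP.m<n⇒m<1+n τ<T)

  -- Hermite interpolation with `n` simple zeros: for multiplicity one the test function is constant
  -- and factors out.
  vandermonde : ∀ n (y g : ℕ → ℤ) → (∀ i → i < n → y i ≢ 0ℤ) →
    (∀ i j → i < n → j < n → i ≢ j → y i ≢ y j) →
    (∀ i → i < n → ∑ n (λ k → g k * y i ^ k) ≡ 0ℤ) → ∀ k → k < n → g k ≡ 0ℤ
  vandermonde n y g y≢0 distinct h = hermite 0 n (points 1 y one n) g
    (ℕP.≤-reflexive (sym (trans (total-points 1 y one n) (ℕP.*-identityʳ n))))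
    (All-points 1 y one n λ i i<n → y≢0 i i<n , λ ())
    (Apart-points 1 y one n λ i j i<n j<n i≢j e → distinct j i j<n i<n (λ p → i≢j (sym p))
      (i-j≡0⇒i≡j _ _ (trans (sym (cong₂ _-_ (*-identityˡ (y j)) (*-identityˡ (y i)))) e)))
    (All-points 1 y one n vanish)
    where
    one : ℕ → ℤ
    one _ = 1ℤ
    vanish : ∀ i → i < n → Vanishes 0 n g (point (y i) 1ℤ 1)
    vanish i i<n ψ hψ = trans (∑-cong n λ k _ → cong₂ _*_
        (cong (g k *_) (trans (cong (y i ^ k *_) (^-zeroˡ (n ∸ suc k))) (*-identityʳ (y i ^ k)))) (const (k ℕ.+ 0)))
      (trans (sym (∑-* (ψ 0) n _)) (cong (_* ψ 0) (h i i<n)))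
      where
      const : ∀ u → ψ u ≡ ψ 0
      const zero    = refl
      const (suc u) = trans (i-j≡0⇒i≡j (ψ (suc u)) (ψ u) (hψ u)) (const u)

  δ : ℕ → ℕ → ℤ
  δ i j with i ℕP.≟ j
  ... | yes _ = 1ℤ
  ... | no  _ = 0ℤ

  δ-refl : ∀ i → δ i i ≡ 1ℤ
  δ-refl i with i ℕP.≟ i
  ... | yes _  = refl
  ... | no  ne = contradiction refl ne

  δ-≢ : ∀ {i j} → i ≢ j → δ i j ≡ 0ℤ
  δ-≢ {i} {j} ne with i ℕP.≟ j
  ... | yes e = contradiction e ne
  ... | no  _ = refl

  ∑-δ : ∀ n i (f : ℕ → ℤ) → i < n → ∑ n (λ m → δ i m * f m) ≡ f i
  ∑-δ n i f i<n = trans (∑-single n _ i i<n λ m _ m≢i → trans (cong (_* f m) (δ-≢ (λ e → m≢i (sym e)))) refl)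
    (trans (cong (_* f i) (δ-refl i)) (*-identityˡ (f i)))

  -- F = Σ_ι x_ι Σ_j G_ιj Y^j cannot vanish to order n + ℓ at T points when T ℓ > n J: a linear
  -- system with more unknowns than equations yields a combination Σ A_kb Y^b E^k F (E the Euler
  -- derivation, shifted by 1) in which only the low coefficients of the first row survive, and
  -- that single polynomial in Y still has too many zeros.
  module ZeroEstimate
    (n J T ℓ : ℕ) (x G : ℕ → ℕ → ℤ) (o : ℕ → ℕ) (y z : ℕ → ℤ)
    (1≤n : 1 ≤ n) (nJ<Tℓ : n ℕ.* J < T ℕ.* ℓ)
    (y≢0 : ∀ τ → y τ ≢ 0ℤ) (z≢0 : ∀ τ → z τ ≢ 0ℤ) (x≢0 : ∀ τ ι → x τ ι ≢ 0ℤ)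
    (apart : ∀ σ τ → σ < T → τ < T → σ ≢ τ → z σ * y τ - z τ * y σ ≢ 0ℤ)
    (G≢0 : ∀ ι → ι < n → ∃ λ j → j < J × G ι j ≢ 0ℤ)
    (distinct : ∀ ι κ j k → ι < n → κ < n → j < J → k < J → ι ≢ κ → j ℕ.+ o ι ≢ k ℕ.+ o κ)
    (hyp : ∀ τ → τ < T → ∀ φ → Deg (n ℕ.+ ℓ) φ →
      ∑ n (λ ι → x τ ι * ∑ J (λ j → G ι j * (y τ ^ j * z τ ^ (J ∸ suc j)) * φ (j ℕ.+ o ι))) ≡ 0ℤ)
    where

    a = T ℕ.* ℓ

    instance
      a≢0 : NonZero a
      a≢0 = >-nonZero (ℕP.≤-<-trans z≤n nJ<Tℓ)
      a+J≢0 : NonZero (a ℕ.+ J)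
      a+J≢0 = >-nonZero (ℕP.<-≤-trans (ℕP.≤-<-trans z≤n nJ<Tℓ) (ℕP.m≤m+n a J))

    base : ℕ → ℕ → ℕ → ℤ
    base ι k j = (+ suc (j ℕ.+ o ι)) ^ k * G ι j

    -- The coefficient of Y^m in row ι of Y^b E^k F, where one Euler derivation multiplies a
    -- coefficient by its total exponent plus one.
    coeff : ℕ → ℕ → ℕ → ℕ → ℤ
    coeff ι m k b = ∑ J (λ j → δ (b ℕ.+ j) m * base ι k j)

    equation : ℕ → ℕ → ℤ
    equation v e = coeff ((v ℕ.+ a) DM./ (a ℕ.+ J)) ((v ℕ.+ a) DM.% (a ℕ.+ J)) (e DM./ a) (e DM.% a)

    -- All but `a` of the n (a + J) positions give an equation, against n a unknowns; the surplus is
    -- exactly the hypothesis n J < a.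
    fewer : n ℕ.* (a ℕ.+ J) ∸ a < n ℕ.* a
    fewer = ℕP.+-cancelʳ-< a _ _ (begin-strict
      (n ℕ.* (a ℕ.+ J) ∸ a) ℕ.+ a   ≡⟨ ℕP.m∸n+n≡m (ℕP.≤-trans (ℕP.m≤m+n a J) (ℕP.≤-trans (ℕP.≤-reflexive (sym (ℕP.*-identityˡ (a ℕ.+ J)))) (ℕP.*-monoˡ-≤ (a ℕ.+ J) 1≤n))) ⟩
      n ℕ.* (a ℕ.+ J)                 ≡⟨ ℕP.*-distribˡ-+ n a J ⟩
      n ℕ.* a ℕ.+ n ℕ.* J             <⟨ ℕP.+-monoʳ-< (n ℕ.* a) nJ<Tℓ ⟩
      n ℕ.* a ℕ.+ a                   ∎)
      where open ℕP.≤-Reasoning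

    module Elimination (p : ℕ → ℤ) (p≢0 : ∃ λ e → e < n ℕ.* a × p e ≢ 0ℤ)
      (solves : ∀ v → v < n ℕ.* (a ℕ.+ J) ∸ a → ∑ (n ℕ.* a) (λ e → equation v e * p e) ≡ 0ℤ) where

      A : ℕ → ℕ → ℤ
      A k b = p (k ℕ.* a ℕ.+ b)

      H : ℕ → ℕ → ℤ
      H ι m = ∑ n (λ k → ∑ a (λ b → coeff ι m k b * A k b))

      -- Position (ι , m) is equation number ι (a + J) + m - a; the first a positions are free.
      H-equation : ∀ ι m → ι < n → m < a ℕ.+ J → a ≤ ι ℕ.* (a ℕ.+ J) ℕ.+ m → H ι m ≡ 0ℤ
      H-equation ι m ι<n m<a+J a≤v′ = begin
        ∑ n (λ k → ∑ a (λ b → coeff ι m k b * A k b))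
          ≡⟨ ∑-cong n (λ k _ → ∑-cong a λ b b<a → cong (_* A k b) (sym (cong₂ (coeff ι m)
               ([i*n+j]/n k a b b<a) ([i*n+j]%n k a b b<a)))) ⟩
        ∑ n (λ k → ∑ a (λ b → coeff ι m ((k ℕ.* a ℕ.+ b) DM./ a) ((k ℕ.* a ℕ.+ b) DM.% a) * A k b))
          ≡⟨ sym (∑-blocks n a _) ⟩
        ∑ (n ℕ.* a) (λ e → coeff ι m (e DM./ a) (e DM.% a) * p e)
          ≡⟨ ∑-cong (n ℕ.* a) (λ e _ → cong (_* p e)
               (sym (cong₂ (λ ι m → coeff ι m (e DM./ a) (e DM.% a)) ι-eq m-eq))) ⟩
        ∑ (n ℕ.* a) (λ e → equation v e * p e)
          ≡⟨ solves v v< ⟩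
        0ℤ ∎
        where
        open ≡-Reasoning
        v′ = ι ℕ.* (a ℕ.+ J) ℕ.+ m
        v = v′ ∸ a
        v+a : v ℕ.+ a ≡ v′
        v+a = ℕP.m∸n+n≡m a≤v′
        ι-eq : (v ℕ.+ a) DM./ (a ℕ.+ J) ≡ ι
        ι-eq = trans (cong (DM._/ (a ℕ.+ J)) v+a) ([i*n+j]/n ι (a ℕ.+ J) m m<a+J)
        m-eq : (v ℕ.+ a) DM.% (a ℕ.+ J) ≡ m
        m-eq = trans (cong (DM._% (a ℕ.+ J)) v+a) ([i*n+j]%n ι (a ℕ.+ J) m m<a+J)
        v′< : v′ < n ℕ.* (a ℕ.+ J)
        v′< = ℕP.<-≤-trans (ℕP.+-monoʳ-< (ι ℕ.* (a ℕ.+ J)) m<a+J)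
          (ℕP.≤-trans (ℕP.≤-reflexive (ℕP.+-comm (ι ℕ.* (a ℕ.+ J)) (a ℕ.+ J))) (ℕP.*-monoˡ-≤ (a ℕ.+ J) ι<n))
        v< : v < n ℕ.* (a ℕ.+ J) ∸ a
        v< = ℕP.∸-monoˡ-< v′< a≤v′

      H-row : ∀ ι (h : ℕ → ℤ) →
        ∑ (a ℕ.+ J) (λ m → H ι m * h m) ≡ ∑ n (λ k → ∑ a (λ b → A k b * ∑ J (λ j → base ι k j * h (b ℕ.+ j))))
      H-row ι h = begin
        ∑ (a ℕ.+ J) (λ m → H ι m * h m)
          ≡⟨ ∑-cong (a ℕ.+ J) (λ m _ → trans (∑-* (h m) n _) (∑-cong n λ k _ → ∑-* (h m) a _)) ⟩
        ∑ (a ℕ.+ J) (λ m → ∑ n (λ k → ∑ a (λ b → coeff ι m k b * A k b * h m)))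
          ≡⟨ ∑-swap (a ℕ.+ J) n _ ⟩
        ∑ n (λ k → ∑ (a ℕ.+ J) (λ m → ∑ a (λ b → coeff ι m k b * A k b * h m)))
          ≡⟨ ∑-cong n (λ k _ → ∑-swap (a ℕ.+ J) a _) ⟩
        ∑ n (λ k → ∑ a (λ b → ∑ (a ℕ.+ J) (λ m → coeff ι m k b * A k b * h m)))
          ≡⟨ ∑-cong n (λ k _ → ∑-cong a λ b b<a → inner k b b<a) ⟩
        ∑ n (λ k → ∑ a (λ b → A k b * ∑ J (λ j → base ι k j * h (b ℕ.+ j)))) ∎
        where
        open ≡-Reasoning
        lemma : ∀ d p q → d * p * q ≡ d * (p * q)
        lemma = solve-∀
        lemma′ : ∀ c A h → c * A * h ≡ A * (c * h)
        lemma′ = solve-∀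
        inner : ∀ k b → b < a → ∑ (a ℕ.+ J) (λ m → coeff ι m k b * A k b * h m) ≡ A k b * ∑ J (λ j → base ι k j * h (b ℕ.+ j))
        inner k b b<a = begin
          ∑ (a ℕ.+ J) (λ m → coeff ι m k b * A k b * h m)
            ≡⟨ ∑-cong (a ℕ.+ J) (λ m _ → lemma′ (coeff ι m k b) (A k b) (h m)) ⟩
          ∑ (a ℕ.+ J) (λ m → A k b * (coeff ι m k b * h m))
            ≡⟨ sym (*-∑ (A k b) (a ℕ.+ J) _) ⟩
          A k b * ∑ (a ℕ.+ J) (λ m → coeff ι m k b * h m)
            ≡⟨ cong (A k b *_) (∑-cong (a ℕ.+ J) λ m _ → trans (∑-* (h m) J _) (∑-cong J λ j _ → lemma (δ (b ℕ.+ j) m) (base ι k j) (h m))) ⟩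
          A k b * ∑ (a ℕ.+ J) (λ m → ∑ J (λ j → δ (b ℕ.+ j) m * (base ι k j * h m)))
            ≡⟨ cong (A k b *_) (∑-swap (a ℕ.+ J) J _) ⟩
          A k b * ∑ J (λ j → ∑ (a ℕ.+ J) (λ m → δ (b ℕ.+ j) m * (base ι k j * h m)))
            ≡⟨ cong (A k b *_) (∑-cong J λ j j<J → ∑-δ (a ℕ.+ J) (b ℕ.+ j) (λ m → base ι k j * h m) (ℕP.+-mono-< b<a j<J)) ⟩
          A k b * ∑ J (λ j → base ι k j * h (b ℕ.+ j)) ∎

      weight : ℕ → ℕ → ℤ
      weight τ m = y τ ^ m * z τ ^ (a ℕ.+ J ∸ suc m)

      weight-+ : ∀ τ b j → b < a → j < J →
        weight τ (b ℕ.+ j) ≡ z τ * (y τ ^ b * z τ ^ (a ∸ suc b)) * (y τ ^ j * z τ ^ (J ∸ suc j))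
      weight-+ τ b j b<a j<J = begin
        y τ ^ (b ℕ.+ j) * z τ ^ (a ℕ.+ J ∸ suc (b ℕ.+ j))
          ≡⟨ cong₂ _*_ (^-distribˡ-+-* (y τ) b j) (cong (z τ ^_) exponent) ⟩
        y τ ^ b * y τ ^ j * z τ ^ suc (a ∸ suc b ℕ.+ (J ∸ suc j))
          ≡⟨ cong (λ w → y τ ^ b * y τ ^ j * (z τ * w)) (^-distribˡ-+-* (z τ) (a ∸ suc b) (J ∸ suc j)) ⟩
        y τ ^ b * y τ ^ j * (z τ * (z τ ^ (a ∸ suc b) * z τ ^ (J ∸ suc j)))
          ≡⟨ lemma (y τ ^ b) (y τ ^ j) (z τ) (z τ ^ (a ∸ suc b)) (z τ ^ (J ∸ suc j)) ⟩
        z τ * (y τ ^ b * z τ ^ (a ∸ suc b)) * (y τ ^ j * z τ ^ (J ∸ suc j)) ∎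
        where
        open ≡-Reasoning
        lemma : ∀ p q z r s → p * q * (z * (r * s)) ≡ z * (p * r) * (q * s)
        lemma = solve-∀
        assemble : ∀ p q b j → suc (p ℕ.+ q) ℕ.+ suc (b ℕ.+ j) ≡ (p ℕ.+ suc b) ℕ.+ (q ℕ.+ suc j)
        assemble = solveℕ-∀
        exponent : a ℕ.+ J ∸ suc (b ℕ.+ j) ≡ suc (a ∸ suc b ℕ.+ (J ∸ suc j))
        exponent = trans (cong (_∸ suc (b ℕ.+ j)) (sym (trans (assemble (a ∸ suc b) (J ∸ suc j) b j)
          (cong₂ ℕ._+_ (ℕP.m∸n+n≡m b<a) (ℕP.m∸n+n≡m j<J)))))
          (ℕP.m+n∸n≡m (suc (a ∸ suc b ℕ.+ (J ∸ suc j))) (suc (b ℕ.+ j)))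

      Deg-φ : ∀ k b ψ → k < n → Deg ℓ ψ → Deg (n ℕ.+ ℓ) (λ u → (+ suc u) ^ k * ψ (u ℕ.+ b))
      Deg-φ k b ψ k<n hψ = Deg-≤ {suc (k ℕ.+ ℓ)} (ℕP.+-monoˡ-≤ ℓ k<n)
        (Deg-* k ℓ {λ u → (+ suc u) ^ k} (Deg-^ k) (Deg-suc ℓ (Deg-shift ℓ b {ψ} hψ)))

      Ω : ℕ → (ℕ → ℤ) → ℤ
      Ω τ ψ = ∑ n (λ ι → x τ ι * ∑ (a ℕ.+ J) (λ m → H ι m * (weight τ m * ψ (m ℕ.+ o ι))))

      -- The factor Y^b only shifts the test function, while E^k multiplies it by a polynomial of
      -- degree k < n. So order n + ℓ of F leaves order ℓ for the combination.
      Ω≡0 : ∀ τ → τ < T → ∀ ψ → Deg ℓ ψ → Ω τ ψ ≡ 0ℤ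
      Ω≡0 τ τ<T ψ hψ = begin
        Ω τ ψ
          ≡⟨ ∑-cong n (λ ι _ → trans (cong (x τ ι *_) (H-row ι _)) (trans (*-∑ (x τ ι) n _) (∑-cong n λ k _ → *-∑ (x τ ι) a _))) ⟩
        ∑ n (λ ι → ∑ n (λ k → ∑ a (λ b → x τ ι * (A k b * ∑ J (λ j → base ι k j * (weight τ (b ℕ.+ j) * ψ (b ℕ.+ j ℕ.+ o ι)))))))
          ≡⟨ ∑-swap n n _ ⟩
        ∑ n (λ k → ∑ n (λ ι → ∑ a (λ b → x τ ι * (A k b * ∑ J (λ j → base ι k j * (weight τ (b ℕ.+ j) * ψ (b ℕ.+ j ℕ.+ o ι)))))))
          ≡⟨ ∑-cong n (λ k _ → ∑-swap n a _) ⟩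
        ∑ n (λ k → ∑ a (λ b → ∑ n (λ ι → x τ ι * (A k b * ∑ J (λ j → base ι k j * (weight τ (b ℕ.+ j) * ψ (b ℕ.+ j ℕ.+ o ι)))))))
          ≡⟨ ∑-zero n (λ k k<n → ∑-zero a λ b b<a → inner k b k<n b<a) ⟩
        0ℤ ∎
        where
        open ≡-Reasoning
        swap : ∀ p q r → p * (q * r) ≡ q * (p * r)
        swap = solve-∀
        inner : ∀ k b → k < n → b < a →
          ∑ n (λ ι → x τ ι * (A k b * ∑ J (λ j → base ι k j * (weight τ (b ℕ.+ j) * ψ (b ℕ.+ j ℕ.+ o ι))))) ≡ 0ℤ
        inner k b k<n b<a = begin
          ∑ n (λ ι → x τ ι * (A k b * ∑ J (λ j → base ι k j * (weight τ (b ℕ.+ j) * ψ (b ℕ.+ j ℕ.+ o ι)))))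
            ≡⟨ ∑-cong n (λ ι _ → cong (λ s → x τ ι * (A k b * s)) (trans (∑-cong J λ j j<J → term ι j j<J) (sym (*-∑ C J _)))) ⟩
          ∑ n (λ ι → x τ ι * (A k b * (C * S ι)))
            ≡⟨ ∑-cong n (λ ι _ → trans (swap (x τ ι) (A k b) (C * S ι)) (cong (A k b *_) (swap (x τ ι) C (S ι)))) ⟩
          ∑ n (λ ι → A k b * (C * (x τ ι * S ι)))
            ≡⟨ trans (sym (*-∑ (A k b) n _)) (cong (A k b *_) (sym (*-∑ C n _))) ⟩
          A k b * (C * ∑ n (λ ι → x τ ι * S ι))
            ≡⟨ cong (λ s → A k b * (C * s)) (hyp τ τ<T φ (Deg-φ k b ψ k<n hψ)) ⟩
          A k b * (C * 0ℤ)
            ≡⟨ trans (cong (A k b *_) (*-zeroʳ C)) (*-zeroʳ (A k b)) ⟩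
          0ℤ ∎
          where
          φ : ℕ → ℤ
          φ u = (+ suc u) ^ k * ψ (u ℕ.+ b)
          C = z τ * (y τ ^ b * z τ ^ (a ∸ suc b))
          S : ℕ → ℤ
          S ι = ∑ J (λ j → G ι j * (y τ ^ j * z τ ^ (J ∸ suc j)) * φ (j ℕ.+ o ι))
          lemma : ∀ e g c w s → e * g * (c * w * s) ≡ c * (g * w * (e * s))
          lemma = solve-∀
          reorder : ∀ b j i → b ℕ.+ j ℕ.+ i ≡ j ℕ.+ i ℕ.+ b
          reorder b j i = trans (ℕP.+-assoc b j i) (ℕP.+-comm b (j ℕ.+ i))
          term : ∀ ι j → j < J → base ι k j * (weight τ (b ℕ.+ j) * ψ (b ℕ.+ j ℕ.+ o ι))
            ≡ C * (G ι j * (y τ ^ j * z τ ^ (J ∸ suc j)) * φ (j ℕ.+ o ι))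
          term ι j j<J = trans (cong₂ (λ w u → base ι k j * (w * ψ u)) (weight-+ τ b j b<a j<J) (reorder b j (o ι)))
            (lemma ((+ suc (j ℕ.+ o ι)) ^ k) (G ι j) C (y τ ^ j * z τ ^ (J ∸ suc j)) (ψ (j ℕ.+ o ι ℕ.+ b)))

      -- The linear system has emptied the later rows and the upper `J` places of the first, so the
      -- vanishing of the combination is that of one form of length a = T ℓ at T points, with order
      -- ℓ.
      H₀-vanishes : ∀ τ → τ < T → Vanishes (o 0) a (H 0) (point (y τ) (z τ) ℓ)
      H₀-vanishes τ τ<T ψ hψ = *-cancel-0 (*-≢0 (x≢0 τ 0) (^-≢0 J (z≢0 τ))) (begin
        x τ 0 * z τ ^ J * pairing (o 0) a (H 0) (y τ) (z τ) ψ
          ≡⟨ trans (*-assoc (x τ 0) (z τ ^ J) _) (cong (x τ 0 *_) (*-∑ (z τ ^ J) a _)) ⟩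
        x τ 0 * ∑ a (λ m → z τ ^ J * (H 0 m * (y τ ^ m * z τ ^ (a ∸ suc m)) * ψ (m ℕ.+ o 0)))
          ≡⟨ cong (x τ 0 *_) (∑-cong a λ m m<a → sym (split m m<a)) ⟩
        x τ 0 * ∑ a (λ m → H 0 m * (weight τ m * ψ (m ℕ.+ o 0)))
          ≡⟨ cong (x τ 0 *_) (sym (trans (cong (_+_ (∑ a _)) (∑-zero J λ j j<J → tail j j<J)) (+-identityʳ _))) ⟩
        x τ 0 * (∑ a (λ m → H 0 m * (weight τ m * ψ (m ℕ.+ o 0))) + ∑ J (λ j → H 0 (a ℕ.+ j) * (weight τ (a ℕ.+ j) * ψ (a ℕ.+ j ℕ.+ o 0))))
          ≡⟨ cong (x τ 0 *_) (sym (∑-++ a J _)) ⟩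
        x τ 0 * ∑ (a ℕ.+ J) (λ m → H 0 m * (weight τ m * ψ (m ℕ.+ o 0)))
          ≡⟨ sym (∑-single n _ 0 1≤n λ ι ι<n ι≢0 → trans (cong (x τ ι *_) (∑-zero (a ℕ.+ J) λ m m< → later ι m ι<n m< ι≢0)) (*-zeroʳ (x τ ι))) ⟩
        Ω τ ψ
          ≡⟨ Ω≡0 τ τ<T ψ hψ ⟩
        0ℤ ∎)
        where
        open ≡-Reasoning
        lemma : ∀ w h p q s → h * (p * (q * w) * s) ≡ w * (h * (p * q) * s)
        lemma = solve-∀
        split : ∀ m → m < a → H 0 m * (weight τ m * ψ (m ℕ.+ o 0)) ≡ z τ ^ J * (H 0 m * (y τ ^ m * z τ ^ (a ∸ suc m)) * ψ (m ℕ.+ o 0))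
        split m m<a = trans (cong (λ e → H 0 m * (y τ ^ m * e * ψ (m ℕ.+ o 0)))
            (trans (cong (z τ ^_) (ℕP.+-∸-comm J m<a)) (^-distribˡ-+-* (z τ) (a ∸ suc m) J)))
          (lemma (z τ ^ J) (H 0 m) (y τ ^ m) (z τ ^ (a ∸ suc m)) (ψ (m ℕ.+ o 0)))
        kill : ∀ {h} w → h ≡ 0ℤ → h * w ≡ 0ℤ
        kill w refl = refl
        tail : ∀ j → j < J → H 0 (a ℕ.+ j) * (weight τ (a ℕ.+ j) * ψ (a ℕ.+ j ℕ.+ o 0)) ≡ 0ℤ
        tail j j<J = kill _ (H-equation 0 (a ℕ.+ j) 1≤n (ℕP.+-monoʳ-< a j<J) (ℕP.m≤m+n a j))
        later : ∀ ι m → ι < n → m < a ℕ.+ J → ι ≢ 0 → H ι m * (weight τ m * ψ (m ℕ.+ o ι)) ≡ 0ℤ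
        later zero    m ι<n m< ι≢0 = contradiction refl ι≢0
        later (suc ι) m ι<n m< ι≢0 = kill _ (H-equation (suc ι) m ι<n m< (ℕP.≤-trans (ℕP.m≤m+n a J)
          (ℕP.≤-trans (ℕP.m≤m+n (a ℕ.+ J) (ι ℕ.* (a ℕ.+ J))) (ℕP.m≤m+n _ m))))

      H₀≡0 : ∀ m → m < a → H 0 m ≡ 0ℤ
      H₀≡0 = hermite (o 0) a (points ℓ y z T) (H 0) (ℕP.≤-reflexive (sym (total-points ℓ y z T)))
        (All-points ℓ y z T λ τ _ → y≢0 τ , z≢0 τ)
        (Apart-points ℓ y z T apart)
        (All-points ℓ y z T H₀-vanishes)

      H≡0 : ∀ ι m → ι < n → m < a ℕ.+ J → H ι m ≡ 0ℤ
      H≡0 zero    m ι<n m< with m ℕP.<? a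
      ... | yes m<a = H₀≡0 m m<a
      ... | no  m≮a = H-equation 0 m ι<n m< (ℕP.≮⇒≥ m≮a)
      H≡0 (suc ι) m ι<n m< = H-equation (suc ι) m ι<n m< (ℕP.≤-trans (ℕP.m≤m+n a J)
          (ℕP.≤-trans (ℕP.m≤m+n (a ℕ.+ J) (ι ℕ.* (a ℕ.+ J))) (ℕP.m≤m+n _ m)))

      -- The leading coefficients in Y give a Vandermonde system for the top coefficients A_kb.
      absurd : ⊥
      absurd = top-zero (proj₁ (proj₂ (proj₂ topB)))
        where
        Nonzero : ℕ → Set
        Nonzero b = ∃ λ k → k < n × A k b ≢ 0ℤ
        nonzero? : Decidable Nonzero
        nonzero? b = ℕP.anyUpTo? (λ k → ¬? (A k b ≟ 0ℤ)) n
        some : ∃ λ b → b < a × Nonzero b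
        some = let (e , e< , pe≢0) = p≢0 in e DM.% a , DM.m%n<n e a , e DM./ a , DM.m<n*o⇒m/o<n e< , λ z → pe≢0 (trans
          (cong p (trans (DM.m≡m%n+[m/n]*n e a) (ℕP.+-comm (e DM.% a) _))) z)
        topB = greatest nonzero? a some
        b = proj₁ topB
        b<a = proj₁ (proj₂ topB)
        above : ∀ k c → k < n → c < a → b < c → A k c ≡ 0ℤ
        above k c k<n c<a b<c = decidable-stable (A k c ≟ 0ℤ) λ ne → proj₂ (proj₂ (proj₂ topB)) c c<a b<c (k , k<n , ne)
        topJ : ∀ ι → ι < n → _
        topJ ι ι<n = greatest (λ j → ¬? (G ι j ≟ 0ℤ)) J (G≢0 ι ι<n)
        -- Here `b` is maximal for all k together and `j` is maximal in row ι, so no other pair of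
        -- exponents adds up to b + j with a nonzero contribution.
        leading : ∀ ι → ι < n → ∃ λ j → j < J × ∑ n (λ k → A k b * (+ suc (j ℕ.+ o ι)) ^ k) ≡ 0ℤ
        leading ι ι<n with topJ ι ι<n
        ... | j , j<J , Gj≢0 , beyond = j , j<J , *-cancel-0 Gj≢0 (begin
          G ι j * ∑ n (λ k → A k b * (+ suc (j ℕ.+ o ι)) ^ k)
            ≡⟨ *-∑ (G ι j) n _ ⟩
          ∑ n (λ k → G ι j * (A k b * (+ suc (j ℕ.+ o ι)) ^ k))
            ≡⟨ ∑-cong n (λ k k<n → trans (lemma (G ι j) (A k b) ((+ suc (j ℕ.+ o ι)) ^ k)) (sym (isolate k k<n))) ⟩
          H ι (b ℕ.+ j)
            ≡⟨ H≡0 ι (b ℕ.+ j) ι<n (ℕP.+-mono-< b<a j<J) ⟩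
          0ℤ ∎)
          where
          open ≡-Reasoning
          lemma : ∀ g a e → g * (a * e) ≡ e * g * a
          lemma = solve-∀
          G-beyond : ∀ i → i < J → j < i → G ι i ≡ 0ℤ
          G-beyond i i<J j<i = decidable-stable (G ι i ≟ 0ℤ) (beyond i i<J j<i)
          coeff-top : ∀ k → coeff ι (b ℕ.+ j) k b ≡ base ι k j
          coeff-top k = trans (∑-single J _ j j<J λ i i<J i≢j →
              cong (_* base ι k i) (δ-≢ λ e → i≢j (ℕP.+-cancelˡ-≡ b i j e)))
            (trans (cong (_* base ι k j) (δ-refl (b ℕ.+ j))) (*-identityˡ (base ι k j)))
          coeff-low : ∀ k c → c < b → coeff ι (b ℕ.+ j) k c ≡ 0ℤ
          coeff-low k c c<b = ∑-zero J λ i i<J → vanish i i<J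
            where
            vanish : ∀ i → i < J → δ (c ℕ.+ i) (b ℕ.+ j) * base ι k i ≡ 0ℤ
            vanish i i<J with j ℕP.<? i
            ... | yes j<i = trans (cong (λ g → δ (c ℕ.+ i) (b ℕ.+ j) * ((+ suc (i ℕ.+ o ι)) ^ k * g)) (G-beyond i i<J j<i))
              (trans (cong (δ (c ℕ.+ i) (b ℕ.+ j) *_) (*-zeroʳ ((+ suc (i ℕ.+ o ι)) ^ k))) (*-zeroʳ (δ (c ℕ.+ i) (b ℕ.+ j))))
            ... | no  j≮i = cong (_* base ι k i) (δ-≢ (ℕP.<⇒≢ (ℕP.+-mono-<-≤ c<b (ℕP.≮⇒≥ j≮i))))
          isolate : ∀ k → k < n → ∑ a (λ c → coeff ι (b ℕ.+ j) k c * A k c) ≡ (+ suc (j ℕ.+ o ι)) ^ k * G ι j * A k b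
          isolate k k<n = trans (∑-single a _ b b<a other) (cong (_* A k b) (coeff-top k))
            where
            other : ∀ c → c < a → c ≢ b → coeff ι (b ℕ.+ j) k c * A k c ≡ 0ℤ
            other c c<a c≢b with c ℕP.<? b
            ... | yes c<b = cong (_* A k c) (coeff-low k c c<b)
            ... | no  c≮b = trans (cong (coeff ι (b ℕ.+ j) k c *_) (above k c k<n c<a (ℕP.≤∧≢⇒< (ℕP.≮⇒≥ c≮b) λ e → c≢b (sym e))))
              (*-zeroʳ (coeff ι (b ℕ.+ j) k c))
        node : ℕ → ℤ
        node ι with ι ℕP.<? n
        ... | yes ι<n = + suc (proj₁ (leading ι ι<n) ℕ.+ o ι)
        ... | no  _   = 1ℤ
        node-< : ∀ ι → ι < n → ∃ λ j → j < J × node ι ≡ + suc (j ℕ.+ o ι) × ∑ n (λ k → A k b * node ι ^ k) ≡ 0ℤ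
        node-< ι ι<n with ι ℕP.<? n
        ... | yes p  = proj₁ (leading ι p) , proj₁ (proj₂ (leading ι p)) , refl , proj₂ (proj₂ (leading ι p))
        ... | no ι≮n = contradiction ι<n ι≮n
        top≡0 : ∀ k → k < n → A k b ≡ 0ℤ
        top≡0 = vandermonde n node (λ k → A k b)
          (λ ι ι<n e → node≢0 (trans (sym (proj₁ (proj₂ (proj₂ (node-< ι ι<n))))) e))
          (λ ι κ ι<n κ<n ι≢κ e →
            let (j , j<J , ej , _) = node-< ι ι<n ; (k , k<J , ek , _) = node-< κ κ<n in
            distinct ι κ j k ι<n κ<n j<J k<J ι≢κ (ℕP.suc-injective (+-injective (trans (sym ej) (trans e ek)))))
          (λ ι ι<n → proj₂ (proj₂ (proj₂ (node-< ι ι<n))))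
          where
          node≢0 : ∀ {m} → + suc m ≢ 0ℤ
          node≢0 ()
        top-zero : Nonzero b → ⊥
        top-zero (k , k<n , ne) = ne (top≡0 k k<n)

    absurd : ⊥
    absurd = let (p , p≢0 , solves) = homogeneous (n ℕ.* (a ℕ.+ J) ∸ a) (n ℕ.* a) equation fewer
             in Elimination.absurd p p≢0 solves

-- Discarding zero rows, and Taylor expansion at y = z

module Vanishing where

  open PolynomialFunctions
  open SiegelsLemma
  open HermiteInterpolation
  open ZeroEstimate
  open import Data.Nat as ℕ using (ℕ; zero; suc; z≤n; s≤s; _<_; _≤_; _∸_)
  import Data.Nat.Properties as ℕP
  open import Data.Integer using (ℤ; +_; _+_; _*_; _-_; -_; _^_; 0ℤ; 1ℤ; ∣_∣)
  open import Data.Integer.Properties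
  open import Data.Integer.Divisibility.Signed using (_∣_; divides)
  open import Data.Integer.Tactic.RingSolver using (solve-∀)

  -- The elimination argument needs every row to be nonzero, so the zero rows are dropped and the
  -- others renumbered.
  record Compression (P : ℕ → Set) (n : ℕ) : Set where
    field
      size      : ℕ
      size≤     : size ≤ n
      index     : ℕ → ℕ
      index<    : ∀ i → i < size → index i < n
      index-P   : ∀ i → i < size → P (index i)
      index-inj : ∀ i j → i < size → j < size → i ≢ j → index i ≢ index j
      nonempty  : ∀ i → i < n → P i → 1 ≤ size
      ∑-index   : ∀ f → (∀ i → i < n → ¬ P i → f i ≡ 0ℤ) → ∑ n f ≡ ∑ size (λ i → f (index i))

  compress : ∀ {P : ℕ → Set} → Decidable P → ∀ n → Compression P n
  compress P? zero = record
    { size = 0 ; size≤ = z≤n ; index = λ i → i ; index< = λ _ () ; index-P = λ _ () ; index-inj = λ _ _ ()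
    ; nonempty = λ _ () ; ∑-index = λ _ _ → refl }
  compress {P} P? (suc n) with P? n | compress P? n
  ... | no ¬Pn | c = record
    { size = size ; size≤ = ℕP.m≤n⇒m≤1+n size≤ ; index = index
    ; index< = λ i i< → ℕP.m<n⇒m<1+n (index< i i<) ; index-P = index-P ; index-inj = index-inj
    ; nonempty = λ i i< Pi → nonempty i (ℕP.≤∧≢⇒< (ℕP.≤-pred i<) λ { refl → ¬Pn Pi }) Pi
    ; ∑-index = λ f h → trans (cong₂ _+_ (∑-index f λ i i< → h i (ℕP.m<n⇒m<1+n i<)) (h n ℕP.≤-refl ¬Pn)) (+-identityʳ _)
    }
    where open Compression c
  ... | yes Pn | c = record
    { size = suc size ; size≤ = s≤s size≤ ; index = index′
    ; index< = λ i i< → below i (ℕP.≤-pred i<) ; index-P = λ i i< → holds i (ℕP.≤-pred i<)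
    ; index-inj = injective
    ; nonempty = λ _ _ _ → s≤s z≤n
    ; ∑-index = λ f h → cong₂ _+_
        (trans (∑-index f λ i i< → h i (ℕP.m<n⇒m<1+n i<)) (∑-cong size λ i i< → cong f (sym (index′-< i i<))))
        (cong f (sym index′-size))
    }
    where
    open Compression c
    index′ : ℕ → ℕ
    index′ i with i ℕP.<? size
    ... | yes _ = index i
    ... | no  _ = n
    index′-< : ∀ i → i < size → index′ i ≡ index i
    index′-< i i< with i ℕP.<? size
    ... | yes _  = refl
    ... | no  i≮ = contradiction i< i≮
    index′-size : index′ size ≡ n
    index′-size with size ℕP.<? size
    ... | yes p = contradiction refl (ℕP.<⇒≢ p)
    ... | no  _ = refl
    below : ∀ i → i ≤ size → index′ i < suc n
    below i i≤ with i ℕP.<? size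
    ... | yes i< = ℕP.m<n⇒m<1+n (index< i i<)
    ... | no  _  = ℕP.≤-refl
    holds : ∀ i → i ≤ size → P (index′ i)
    holds i i≤ with i ℕP.<? size
    ... | yes i< = index-P i i<
    ... | no  _  = Pn
    injective : ∀ i j → i < suc size → j < suc size → i ≢ j → index′ i ≢ index′ j
    injective i j i≤ j≤ i≢j with i ℕP.<? size | j ℕP.<? size
    ... | yes i< | yes j< = index-inj i j i< j< i≢j
    ... | yes i< | no  _  = ℕP.<⇒≢ (index< i i<)
    ... | no  _  | yes j< = λ e → ℕP.<⇒≢ (index< j j<) (sym e)
    ... | no  i≮ | no  j≮ = λ _ → i≢j (trans (ℕP.≤-antisym (ℕP.≤-pred i≤) (ℕP.≮⇒≥ i≮)) (ℕP.≤-antisym (ℕP.≮⇒≥ j≮) (ℕP.≤-pred j≤)))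

  -- One nonzero coefficient would leave at least one row after compression, and having fewer rows
  -- only relaxes the counting condition and the order that is required.
  zero-estimate : ∀ (n J T ℓ : ℕ) (x G : ℕ → ℕ → ℤ) (o : ℕ → ℕ) (y z : ℕ → ℤ) →
    n ℕ.* J < T ℕ.* ℓ →
    (∀ τ → y τ ≢ 0ℤ) → (∀ τ → z τ ≢ 0ℤ) → (∀ τ ι → x τ ι ≢ 0ℤ) →
    (∀ σ τ → σ < T → τ < T → σ ≢ τ → z σ * y τ - z τ * y σ ≢ 0ℤ) →
    (∀ ι κ j k → ι < n → κ < n → j < J → k < J → ι ≢ κ → j ℕ.+ o ι ≢ k ℕ.+ o κ) →
    (∀ τ → τ < T → ∀ φ → Deg (n ℕ.+ ℓ) φ →
      ∑ n (λ ι → x τ ι * ∑ J (λ j → G ι j * (y τ ^ j * z τ ^ (J ∸ suc j)) * φ (j ℕ.+ o ι))) ≡ 0ℤ) →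
    ∀ ι j → ι < n → j < J → G ι j ≡ 0ℤ
  zero-estimate n J T ℓ x G o y z nJ<Tℓ y≢0 z≢0 x≢0 apart distinct hyp ι j ι<n j<J =
    decidable-stable (G ι j ≟ 0ℤ) λ Gιj≢0 →
      ZeroEstimate.absurd size J T ℓ (λ τ i → x τ (index i)) (λ i → G (index i)) (λ i → o (index i)) y z
        (nonempty ι ι<n (j , j<J , Gιj≢0))
        (ℕP.≤-<-trans (ℕP.*-monoˡ-≤ J size≤) nJ<Tℓ) y≢0 z≢0 (λ τ i → x≢0 τ (index i)) apart index-P
        (λ i k a b i< k< a<J b<J i≢k → distinct (index i) (index k) a b (index< i i<) (index< k k<) a<J b<J (index-inj i k i< k< i≢k))
        (λ τ τ<T φ hφ → trans (sym (∑-index _ λ i i<n none → zero-row τ φ i none))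
          (hyp τ τ<T φ (Deg-≤ {size ℕ.+ ℓ} {n ℕ.+ ℓ} {φ} (ℕP.+-monoˡ-≤ ℓ size≤) hφ)))
    where
    Nonzero : ℕ → Set
    Nonzero i = ∃ λ j → j < J × G i j ≢ 0ℤ
    open Compression (compress {Nonzero} (λ i → ℕP.anyUpTo? (λ j → ¬? (G i j ≟ 0ℤ)) J) n)
    zero-row : ∀ τ φ i → ¬ Nonzero i →
      x τ i * ∑ J (λ j → G i j * (y τ ^ j * z τ ^ (J ∸ suc j)) * φ (j ℕ.+ o i)) ≡ 0ℤ
    zero-row τ φ i none = trans (cong (x τ i *_) (∑-zero J λ j j<J →
        cong (λ g → g * (y τ ^ j * z τ ^ (J ∸ suc j)) * φ (j ℕ.+ o i))
          (decidable-stable (G i j ≟ 0ℤ) λ ne → none (j , j<J , ne))))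
      (*-zeroʳ (x τ i))

  moments : ∀ N M (p : ℕ → ℤ) (u : ℕ → ℕ) → (∀ k → k < M → ∑ N (λ e → p e * + bin (u e) k) ≡ 0ℤ) →
    ∀ φ → Deg M φ → ∑ N (λ e → p e * φ (u e)) ≡ 0ℤ
  moments N M p u h φ hφ with newton M φ hφ
  ... | c , expand = begin
    ∑ N (λ e → p e * φ (u e))
      ≡⟨ ∑-cong N (λ e _ → trans (cong (p e *_) (expand (u e))) (*-∑ (p e) M _)) ⟩
    ∑ N (λ e → ∑ M (λ k → p e * (c k * + bin (u e) k)))
      ≡⟨ ∑-swap N M _ ⟩
    ∑ M (λ k → ∑ N (λ e → p e * (c k * + bin (u e) k)))
      ≡⟨ ∑-zero M (λ k k<M → trans (∑-cong N λ e _ → lemma (p e) (c k) (+ bin (u e) k))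
           (trans (sym (*-∑ (c k) N _)) (trans (cong (c k *_) (h k k<M)) (*-zeroʳ (c k))))) ⟩
    0ℤ ∎
    where
    open ≡-Reasoning
    lemma : ∀ p c b → p * (c * b) ≡ c * (p * b)
    lemma = solve-∀

  -- The induction is Pascal's rule, applied to y^(u+1) = y^u z + (y - z) y^u. Of the remainder only
  -- its divisibility by (y - z)^m will matter, so the cofactor is left unspecified.
  taylor : ∀ (y z : ℤ) m U u → u ≤ U → ∃ λ q →
    y ^ u * z ^ (U ∸ u) ≡ ∑ m (λ k → + bin u k * ((y - z) ^ k * z ^ (U ∸ k))) + q * (y - z) ^ m
  taylor y z zero    U       u       u≤U = y ^ u * z ^ (U ∸ u) , lemma (y ^ u * z ^ (U ∸ u))
    where
    lemma : ∀ a → a ≡ 0ℤ + a * 1ℤ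
    lemma = solve-∀
  taylor y z (suc m) U       zero    u≤U = 0ℤ , sym (trans (+-identityʳ _) (trans (∑-suc m _)
    (trans (cong (_+_ (1ℤ * (1ℤ * z ^ U))) (∑-zero m λ k _ → refl)) (lemma (z ^ U)))))
    where
    lemma : ∀ a → 1ℤ * (1ℤ * a) + 0ℤ ≡ 1ℤ * a
    lemma = solve-∀
  taylor y z (suc m) (suc U) (suc u) (s≤s u≤U)
    with taylor y z (suc m) (suc U) u (ℕP.m≤n⇒m≤1+n u≤U) | taylor y z m U u u≤U
  ... | q₁ , e₁ | q₂ , e₂ = q₁ + q₂ , (begin
    y * y ^ u * z ^ (U ∸ u)
      ≡⟨ split y z (y ^ u) (z ^ (U ∸ u)) ⟩
    y ^ u * (z * z ^ (U ∸ u)) + h * (y ^ u * z ^ (U ∸ u))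
      ≡⟨ cong₂ (λ a b → y ^ u * z ^ a + h * b) (sym (ℕP.+-∸-assoc 1 u≤U)) e₂ ⟩
    y ^ u * z ^ (suc U ∸ u) + h * (∑ m t + q₂ * h ^ m)
      ≡⟨ cong₂ _+_ e₁ (*-distribˡ-+ h (∑ m t) (q₂ * h ^ m)) ⟩
    ∑ (suc m) t₁ + q₁ * h ^ suc m + (h * ∑ m t + h * (q₂ * h ^ m))
      ≡⟨ regroup (∑ (suc m) t₁) (h * ∑ m t) q₁ q₂ h (h ^ m) ⟩
    ∑ (suc m) t₁ + h * ∑ m t + (q₁ + q₂) * h ^ suc m
      ≡⟨ cong (_+ (q₁ + q₂) * h ^ suc m) pascal ⟩
    ∑ (suc m) (λ k → + bin (suc u) k * (h ^ k * z ^ (suc U ∸ k))) + (q₁ + q₂) * h ^ suc m ∎)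
    where
    open ≡-Reasoning
    h = y - z
    t t₁ : ℕ → ℤ
    t k = + bin u k * (h ^ k * z ^ (U ∸ k))
    t₁ k = + bin u k * (h ^ k * z ^ (suc U ∸ k))
    split : ∀ y z a b → y * a * b ≡ a * (z * b) + (y - z) * (a * b)
    split = solve-∀
    regroup : ∀ s t q r h k → s + q * (h * k) + (t + h * (r * k)) ≡ s + t + (q + r) * (h * k)
    regroup = solve-∀
    rejoin : ∀ a b c h k → a * (h * c * k) + h * (b * (c * k)) ≡ (b + a) * (h * c * k)
    rejoin = solve-∀
    pascal : ∑ (suc m) t₁ + h * ∑ m t ≡ ∑ (suc m) (λ k → + bin (suc u) k * (h ^ k * z ^ (suc U ∸ k)))
    pascal = begin
      ∑ (suc m) t₁ + h * ∑ m t
        ≡⟨ cong₂ _+_ (∑-suc m t₁) (*-∑ h m t) ⟩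
      t₁ 0 + ∑ m (λ k → t₁ (suc k)) + ∑ m (λ k → h * t k)
        ≡⟨ trans (+-assoc (t₁ 0) _ _) (cong (_+_ (t₁ 0)) (sym (∑-+ m _ _))) ⟩
      t₁ 0 + ∑ m (λ k → t₁ (suc k) + h * t k)
        ≡⟨ cong (_+_ (t₁ 0)) (∑-cong m λ k _ → trans
             (rejoin (+ bin u (suc k)) (+ bin u k) (h ^ k) h (z ^ (U ∸ k)))
             (cong (_* (h * h ^ k * z ^ (U ∸ k))) (sym (pos-+ (bin u k) (bin u (suc k)))))) ⟩
      t₁ 0 + ∑ m (λ k → + bin (suc u) (suc k) * (h ^ suc k * z ^ (U ∸ k)))
        ≡⟨ sym (∑-suc m _) ⟩
      ∑ (suc m) (λ k → + bin (suc u) k * (h ^ k * z ^ (suc U ∸ k))) ∎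

  -- The Taylor term of order k < m is a sum against `bin _ l * bin _ k`, a polynomial function of
  -- degree l + k < M, so it vanishes and only the remainders survive.
  vanishing⇒divisible : ∀ N M l m (p : ℕ → ℤ) (u : ℕ → ℕ) U y z → l ℕ.+ m ≤ M →
    (∀ e → e < N → u e ≤ U) →
    (∀ φ → Deg M φ → ∑ N (λ e → p e * φ (u e)) ≡ 0ℤ) →
    (y - z) ^ m ∣ ∑ N (λ e → p e * + bin (u e) l * (y ^ u e * z ^ (U ∸ u e)))
  vanishing⇒divisible N M l m p u U y z l+m≤M u≤U h =
    divides (∑ N (λ e → p e * + bin (u e) l * q e)) (begin
      ∑ N (λ e → p e * + bin (u e) l * (y ^ u e * z ^ (U ∸ u e)))
        ≡⟨ ∑-cong N (λ e e<N → trans (cong (p e * + bin (u e) l *_) (q-eq e e<N)) (*-distribˡ-+ (p e * + bin (u e) l) _ _)) ⟩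
      ∑ N (λ e → p e * + bin (u e) l * ∑ m (λ k → + bin (u e) k * c k) + p e * + bin (u e) l * (q e * H))
        ≡⟨ ∑-+ N _ _ ⟩
      ∑ N (λ e → p e * + bin (u e) l * ∑ m (λ k → + bin (u e) k * c k)) + ∑ N (λ e → p e * + bin (u e) l * (q e * H))
        ≡⟨ cong₂ _+_ main (trans (∑-cong N λ e _ → sym (*-assoc (p e * + bin (u e) l) (q e) H)) (sym (∑-* H N _))) ⟩
      0ℤ + ∑ N (λ e → p e * + bin (u e) l * q e) * H
        ≡⟨ +-identityˡ _ ⟩
      ∑ N (λ e → p e * + bin (u e) l * q e) * H ∎)
    where
    open ≡-Reasoning
    H = (y - z) ^ m
    c : ℕ → ℤ
    c k = (y - z) ^ k * z ^ (U ∸ k)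
    q : ℕ → ℤ
    q e with u e ℕP.≤? U
    ... | yes ue≤U = proj₁ (taylor y z m U (u e) ue≤U)
    ... | no  _    = 0ℤ
    q-eq : ∀ e → e < N → y ^ u e * z ^ (U ∸ u e) ≡ ∑ m (λ k → + bin (u e) k * c k) + q e * H
    q-eq e e<N with u e ℕP.≤? U
    ... | yes ue≤U = proj₂ (taylor y z m U (u e) ue≤U)
    ... | no  ue≰U = contradiction (u≤U e e<N) ue≰U
    lemma : ∀ p b d c → p * b * (d * c) ≡ c * (p * (b * d))
    lemma = solve-∀
    main : ∑ N (λ e → p e * + bin (u e) l * ∑ m (λ k → + bin (u e) k * c k)) ≡ 0ℤ
    main = begin
      ∑ N (λ e → p e * + bin (u e) l * ∑ m (λ k → + bin (u e) k * c k))
        ≡⟨ ∑-cong N (λ e _ → *-∑ (p e * + bin (u e) l) m _) ⟩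
      ∑ N (λ e → ∑ m (λ k → p e * + bin (u e) l * (+ bin (u e) k * c k)))
        ≡⟨ ∑-swap N m _ ⟩
      ∑ m (λ k → ∑ N (λ e → p e * + bin (u e) l * (+ bin (u e) k * c k)))
        ≡⟨ ∑-zero m (λ k k<m → trans (∑-cong N λ e _ → lemma (p e) (+ bin (u e) l) (+ bin (u e) k) (c k))
             (trans (sym (*-∑ (c k) N _)) (trans (cong (c k *_) (h (λ v → + bin v l * + bin v k)
               (Deg-≤ {suc (l ℕ.+ k)} (ℕP.≤-trans (ℕP.≤-trans (ℕP.≤-reflexive (sym (ℕP.+-suc l k))) (ℕP.+-monoʳ-≤ l k<m)) l+m≤M)
                 (Deg-* l k {λ v → + bin v l} {λ v → + bin v k} (Deg-bin l) (Deg-bin k))))) (*-zeroʳ (c k))))) ⟩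
      0ℤ ∎

-- Elementary inequalities and coprimality

module NaturalBounds where

  open PolynomialFunctions
  open SiegelsLemma
  open import Data.Nat using (zero; suc; z≤n; s≤s; _+_; _*_; _^_; _∸_; _≤_; _<_)
  open import Data.Nat.Properties
  open import Data.Nat.Divisibility
  open import Data.Nat.Coprimality as Cop using (Coprime; coprime-divisor)
  open import Data.Nat.Tactic.RingSolver using (solve-∀)

  n<2^n : ∀ n → n < 2 ^ n
  n<2^n zero    = s≤s z≤n
  n<2^n (suc n) = ≤-trans (s≤s (n<2^n n)) (≤-trans (+-monoˡ-≤ (2 ^ n) (m^n>0 2 n)) (≤-reflexive (lemma (2 ^ n))))
    where
    lemma : ∀ a → a + a ≡ 2 * a
    lemma = solve-∀

  coprime-*ʳ : ∀ {a b c} → Coprime a b → Coprime a c → Coprime a (b * c)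
  coprime-*ʳ ab ac (d∣a , d∣bc) =
    ac (d∣a , coprime-divisor (λ (e∣d , e∣b) → ab (∣-trans e∣d d∣a , e∣b)) d∣bc)

  coprime-^ʳ : ∀ {a b} n → Coprime a b → Coprime a (b ^ n)
  coprime-^ʳ zero    ab = Cop.sym (Cop.1-coprimeTo _)
  coprime-^ʳ (suc n) ab = coprime-*ʳ ab (coprime-^ʳ n ab)

  coprime-^ˡ : ∀ {a b} n → Coprime a b → Coprime (a ^ n) b
  coprime-^ˡ n ab = Cop.sym (coprime-^ʳ n (Cop.sym ab))

  -- In fractions: (1 + 1/x)^j is at most (x + 1) / (x + 1 - j). For j equal to half of x + 1 this
  -- is the bound 2.
  bernoulli : ∀ x j t → j + t ≡ suc x → suc x ^ j * t ≤ x ^ j * suc x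
  bernoulli x zero    t e = ≤-reflexive (cong (1 *_) e)
  bernoulli x (suc j) t e = begin
    suc x * suc x ^ j * t       ≡⟨ lemma₁ (suc x) (suc x ^ j) t ⟩
    suc x ^ j * (suc x * t)     ≤⟨ *-monoʳ-≤ (suc x ^ j) at≤ ⟩
    suc x ^ j * (x * suc t)     ≡⟨ lemma₂ (suc x ^ j) x (suc t) ⟩
    x * (suc x ^ j * suc t)     ≤⟨ *-monoʳ-≤ x (bernoulli x j (suc t) (trans (+-suc j t) e)) ⟩
    x * (x ^ j * suc x)         ≡⟨ sym (*-assoc x (x ^ j) (suc x)) ⟩
    x * x ^ j * suc x           ∎
    where
    open ≤-Reasoning
    lemma₁ : ∀ a b t → a * b * t ≡ b * (a * t)
    lemma₁ = solve-∀
    lemma₂ : ∀ a x t → a * (x * t) ≡ x * (a * t)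
    lemma₂ = solve-∀
    lemma₃ : ∀ x t → x + x * t ≡ x * suc t
    lemma₃ = solve-∀
    at≤ : suc x * t ≤ x * suc t
    at≤ = ≤-trans (+-monoˡ-≤ (x * t) (≤-trans (m≤n+m t j) (≤-reflexive (suc-injective e)))) (≤-reflexive (lemma₃ x t))

  -- A single term of the expansion of (1 + y)^u, multiplied by y^k to keep the exponents natural.
  bin-generating : ∀ u k y → bin u k * y ^ u ≤ suc y ^ u * y ^ k
  bin-generating u       zero    y = ≤-trans (≤-reflexive (+-identityʳ (y ^ u)))
    (≤-trans (^-monoˡ-≤ u (n≤1+n y)) (≤-reflexive (sym (*-identityʳ (suc y ^ u)))))
  bin-generating zero    (suc k) y = z≤n
  bin-generating (suc u) (suc k) y = begin
    (bin u k + bin u (suc k)) * (y * y ^ u)                          ≡⟨ lemma₁ (bin u k) (bin u (suc k)) y (y ^ u) ⟩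
    y * (bin u k * y ^ u) + y * (bin u (suc k) * y ^ u)
      ≤⟨ +-mono-≤ (*-monoʳ-≤ y (bin-generating u k y)) (*-monoʳ-≤ y (bin-generating u (suc k) y)) ⟩
    y * (suc y ^ u * y ^ k) + y * (suc y ^ u * (y * y ^ k))          ≡⟨ lemma₂ y (suc y ^ u) (y ^ k) ⟩
    suc y * suc y ^ u * (y * y ^ k)                                  ∎
    where
    open ≤-Reasoning
    lemma₁ : ∀ a b y z → (a + b) * (y * z) ≡ y * (a * z) + y * (b * z)
    lemma₁ = solve-∀
    lemma₂ : ∀ y a b → y * (a * b) + y * (a * (y * b)) ≡ suc y * a * (y * b)
    lemma₂ = solve-∀

  -- The binomial is at most (1 + 1/x)^u x^k. For x = 10 Z - 1 each block of 5 Z factors contributes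
  -- at most 2, and 4 K blocks give 16^K. The crude bound u^k would have a base growing with K.
  bin-bound : ∀ K Z u k → 1 ≤ Z → u ≤ 4 * K * (5 * Z) → bin u k ≤ 16 ^ K * (10 * Z) ^ k
  bin-bound K (suc Z) u k _ u≤U = ≤-trans
    (*-cancelʳ-≤ (bin u k) (16 ^ K * x ^ k) (x ^ U) {{m^n≢0 x U}} scaled)
    (*-monoʳ-≤ (16 ^ K) (^-monoˡ-≤ k (≤-trans (n≤1+n x) (≤-reflexive a≡))))
    where
    open ≤-Reasoning
    h = 5 * suc Z
    x = 9 + 10 * Z
    U = 4 * K * h
    a≡ : suc x ≡ 10 * suc Z
    a≡ = lemma Z
      where
      lemma : ∀ Z → suc (9 + 10 * Z) ≡ 10 * suc Z
      lemma = solve-∀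
    h+h : h + h ≡ suc x
    h+h = lemma Z
      where
      lemma : ∀ Z → 5 * suc Z + 5 * suc Z ≡ suc (9 + 10 * Z)
      lemma = solve-∀
    double : suc x ^ h ≤ 2 * x ^ h
    double = *-cancelʳ-≤ (suc x ^ h) (2 * x ^ h) h (begin
      suc x ^ h * h      ≤⟨ bernoulli x h h h+h ⟩
      x ^ h * suc x      ≡⟨ cong (x ^ h *_) (sym h+h) ⟩
      x ^ h * (h + h)    ≡⟨ lemma (x ^ h) h ⟩
      2 * x ^ h * h      ∎)
      where
      lemma : ∀ a h → a * (h + h) ≡ 2 * a * h
      lemma = solve-∀
    power : suc x ^ U ≤ 16 ^ K * x ^ U
    power = begin
      suc x ^ (4 * K * h)               ≡⟨ cong (suc x ^_) (*-comm (4 * K) h) ⟩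
      suc x ^ (h * (4 * K))             ≡⟨ sym (^-*-assoc (suc x) h (4 * K)) ⟩
      (suc x ^ h) ^ (4 * K)             ≤⟨ ^-monoˡ-≤ (4 * K) double ⟩
      (2 * x ^ h) ^ (4 * K)             ≡⟨ ^-distribʳ-* (4 * K) 2 (x ^ h) ⟩
      2 ^ (4 * K) * (x ^ h) ^ (4 * K)   ≡⟨ cong₂ _*_ (sym (^-*-assoc 2 4 K)) (trans (^-*-assoc x h (4 * K)) (cong (x ^_) (*-comm h (4 * K)))) ⟩
      16 ^ K * x ^ (4 * K * h)          ∎
    split : ∀ b → b ^ u * b ^ (U ∸ u) ≡ b ^ U
    split b = trans (sym (^-distribˡ-+-* b u (U ∸ u))) (cong (b ^_) (m+[n∸m]≡n u≤U))
    scaled : bin u k * x ^ U ≤ 16 ^ K * x ^ k * x ^ U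
    scaled = begin
      bin u k * x ^ U                            ≡⟨ cong (bin u k *_) (sym (split x)) ⟩
      bin u k * (x ^ u * x ^ (U ∸ u))            ≡⟨ sym (*-assoc (bin u k) (x ^ u) _) ⟩
      bin u k * x ^ u * x ^ (U ∸ u)              ≤⟨ *-mono-≤ (bin-generating u k x) (^-monoˡ-≤ (U ∸ u) (n≤1+n x)) ⟩
      suc x ^ u * x ^ k * suc x ^ (U ∸ u)        ≡⟨ lemma (suc x ^ u) (x ^ k) (suc x ^ (U ∸ u)) ⟩
      suc x ^ u * suc x ^ (U ∸ u) * x ^ k        ≡⟨ cong (_* x ^ k) (split (suc x)) ⟩
      suc x ^ U * x ^ k                          ≤⟨ *-monoˡ-≤ (x ^ k) power ⟩
      16 ^ K * x ^ U * x ^ k                     ≡⟨ lemma (16 ^ K) (x ^ U) (x ^ k) ⟩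
      16 ^ K * x ^ k * x ^ U                     ∎
      where
      lemma : ∀ a b c → a * b * c ≡ a * c * b
      lemma = solve-∀

  40K+1<16^K : ∀ K → 40 * (2 + K) + 1 < 16 ^ (2 + K)
  40K+1<16^K zero    = m≤m+n 82 174
  40K+1<16^K (suc K) = begin-strict
    40 * (3 + K) + 1          ≡⟨ lemma K ⟩
    40 * (2 + K) + 1 + 40     <⟨ +-mono-<-≤ ih (≤-trans (m≤m+n 40 42) (≤-trans (+-monoʳ-≤ 80 (m≤n+m 2 (40 * K))) (≤-trans (≤-reflexive (lemma₂ K)) ih))) ⟩
    16 ^ (2 + K) + 16 ^ (2 + K)   ≤⟨ m≤m+n _ _ ⟩
    16 ^ (2 + K) + 16 ^ (2 + K) + 14 * 16 ^ (2 + K)  ≡⟨ lemma₃ (16 ^ (2 + K)) ⟩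
    16 ^ (3 + K)              ∎
    where
    open ≤-Reasoning
    ih : 40 * (2 + K) + 1 < 16 ^ (2 + K)
    ih = 40K+1<16^K K
    lemma : ∀ K → 40 * (3 + K) + 1 ≡ 40 * (2 + K) + 1 + 40
    lemma = solve-∀
    lemma₂ : ∀ K → 80 + (40 * K + 2) ≡ suc (40 * (2 + K) + 1)
    lemma₂ = solve-∀
    lemma₃ : ∀ a → a + a + 14 * a ≡ 16 * a
    lemma₃ = solve-∀

-- The auxiliary polynomial

module AuxiliaryPolynomial where

  open PolynomialFunctions
  open SiegelsLemma
  open HermiteInterpolation
  open ZeroEstimate
  open Vanishing
  open NaturalBounds
  open import Data.Nat as ℕ using (ℕ; zero; suc; z≤n; s≤s; _<_; _≤_; _∸_; NonZero; >-nonZero)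
  import Data.Nat.Properties as ℕP
  import Data.Nat.DivMod as DM
  import Data.Nat.Divisibility as ℕD
  open import Data.Nat.Coprimality using (Coprime; coprime-divisor)
  open import Data.Integer using (ℤ; +_; _+_; _*_; _-_; -_; _^_; 0ℤ; 1ℤ; ∣_∣)
  open import Data.Integer.Properties
  open import Data.Integer.Divisibility.Signed
  open import Data.Integer.Tactic.RingSolver using (solve-∀)
  open import Data.Nat.Tactic.RingSolver using () renaming (solve-∀ to solveℕ-∀)

  pos-^ : ∀ m n → + (m ℕ.^ n) ≡ (+ m) ^ n
  pos-^ m zero    = refl
  pos-^ m (suc n) = trans (pos-* m (m ℕ.^ n)) (cong (+ m *_) (pos-^ m n))

  abs-^ : ∀ i n → ∣ i ^ n ∣ ≡ ∣ i ∣ ℕ.^ n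
  abs-^ i zero    = refl
  abs-^ i (suc n) = trans (abs-* i (i ^ n)) (cong (∣ i ∣ ℕ.*_) (abs-^ i n))

  ∣-^ : ∀ {a b} n → a ∣ b → a ^ n ∣ b ^ n
  ∣-^ zero    d = ∣-refl
  ∣-^ {a} {b} (suc n) d = ∣-trans (*-monoʳ-∣ a (∣-^ n d)) (*-monoˡ-∣ (b ^ n) d)

  module Mod (d : ℤ) where

    _≈_ : ℤ → ℤ → Set
    a ≈ b = d ∣ a - b

    ≈-refl : ∀ a → a ≈ a
    ≈-refl a = divides 0ℤ (+-inverseʳ a)

    *-≈ : ∀ {a b c e} → a ≈ b → c ≈ e → (a * c) ≈ (b * e)
    *-≈ {a} {b} {c} {e} p q = subst (d ∣_) (lemma a b c e) (∣m∣n⇒∣m+n (∣m⇒∣m*n c p) (∣n⇒∣m*n b q))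
      where
      lemma : ∀ a b c e → (a - b) * c + b * (c - e) ≡ a * c - b * e
      lemma = solve-∀

    ^-≈ : ∀ {a b} n → a ≈ b → (a ^ n) ≈ (b ^ n)
    ^-≈ zero    p = ≈-refl 1ℤ
    ^-≈ {a} {b} (suc n) p = *-≈ {a} {b} p (^-≈ n p)

    ∑-≈ : ∀ n {f g : ℕ → ℤ} → (∀ i → i < n → f i ≈ g i) → ∑ n f ≈ ∑ n g
    ∑-≈ zero    h = ≈-refl 0ℤ
    ∑-≈ (suc n) {f} {g} h = subst (d ∣_) (lemma (∑ n f) (∑ n g) (f n) (g n))
      (∣m∣n⇒∣m+n (∑-≈ n λ i i<n → h i (ℕP.m<n⇒m<1+n i<n)) (h n ℕP.≤-refl))
      where
      lemma : ∀ a b c e → (a - b) + (c - e) ≡ (a + c) - (b + e)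
      lemma = solve-∀

  +suc≢0 : ∀ {m} → 1 ≤ m → + m ≢ 0ℤ
  +suc≢0 (s≤s _) ()

  -- The auxiliary polynomial Σ p_ij X^i Y^j has 20 K coefficients and vanishes to order 4 K at (1 , 1)
  -- along the curve X = Y^r; the surplus of unknowns keeps the p_ij small.  Its derivatives of order
  -- < K at the 41 points ((ρ₁/ρ₂)^τ , (γ₂/γ₁)^τ), which lie σ-adically near that curve, are then
  -- divisible by σ^(3 K) but smaller than that, hence zero; this contradicts the zero estimate.
  module Core
    (σ Z J k : ℕ) (ρ₁ ρ₂ γ₁ γ₂ R Γ : ℕ)
    (1≤Z : 1 ≤ Z) (40≤J : 40 ≤ J) (1≤k : 1 ≤ k)
    (1≤ρ₁ : 1 ≤ ρ₁) (1≤ρ₂ : 1 ≤ ρ₂) (1≤γ₁ : 1 ≤ γ₁) (1≤γ₂ : 1 ≤ γ₂)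
    (ρ₁≤R : ρ₁ ≤ R) (ρ₂≤R : ρ₂ ≤ R) (γ₁≤Γ : γ₁ ≤ Γ) (γ₂≤Γ : γ₂ ≤ Γ)
    (R-small : R ℕ.^ (41 ℕ.* (20 ℕ.* k)) ≤ 2 ℕ.^ (J ℕ.* k))
    (Γ-small : Γ ℕ.^ (41 ℕ.* J) ≤ 2 ℕ.^ (J ℕ.* k))
    (σ-large : 16 ℕ.* (40 ℕ.* Z ℕ.* (160 ℕ.* Z) ℕ.* (2 ℕ.* 2)) ≤ σ ℕ.^ 3)
    (coprime : Coprime σ γ₁)
    (γ-close : + σ ∣ + γ₂ - + γ₁)
    (relation : (+ σ) ^ (3 ℕ.* (J ℕ.* k)) ∣ (+ γ₁) ^ (Z ℕ.* J) * + ρ₁ - (+ γ₂) ^ (Z ℕ.* J) * + ρ₂)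
    (γ₁≢γ₂ : γ₁ ≢ γ₂)
    where

    K n r M N U : ℕ
    K = J ℕ.* k
    n = 20 ℕ.* k
    r = Z ℕ.* J
    M = 4 ℕ.* K
    N = n ℕ.* J
    U = r ℕ.* n ℕ.+ J

    instance
      J≢0 : NonZero J
      J≢0 = >-nonZero (ℕP.<-≤-trans (s≤s z≤n) 40≤J)

    2≤K : 2 ≤ K
    2≤K = ℕP.≤-trans (s≤s (s≤s z≤n)) (ℕP.*-mono-≤ 40≤J 1≤k)

    J≤r : J ≤ r
    J≤r = ℕP.≤-trans (ℕP.≤-reflexive (sym (ℕP.*-identityˡ J))) (ℕP.*-monoˡ-≤ J 1≤Z)

    N≡20K : N ≡ 20 ℕ.* K
    N≡20K = trans (ℕP.*-assoc 20 k J) (cong (20 ℕ.*_) (ℕP.*-comm k J))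

    -- The exponent of Y in X^i Y^j after the substitution X = Y^r, where e = i J + j. No two
    -- coincide because J ≤ r.
    u : ℕ → ℕ
    u e = e DM.% J ℕ.+ r ℕ.* (e DM./ J)

    u<rn : ∀ e → e < N → u e < r ℕ.* n
    u<rn e e<N = ℕP.<-≤-trans (ℕP.+-monoˡ-< (r ℕ.* (e DM./ J)) (ℕP.<-≤-trans (DM.m%n<n e J) J≤r))
      (ℕP.≤-trans (ℕP.≤-reflexive (sym (ℕP.*-suc r (e DM./ J)))) (ℕP.*-monoʳ-≤ r (DM.m<n*o⇒m/o<n e<N)))

    rn≡ : r ℕ.* n ≡ 4 ℕ.* K ℕ.* (5 ℕ.* Z)
    rn≡ = lemma Z J k
      where
      lemma : ∀ Z J k → Z ℕ.* J ℕ.* (20 ℕ.* k) ≡ 4 ℕ.* (J ℕ.* k) ℕ.* (5 ℕ.* Z)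
      lemma = solveℕ-∀

    bin-u : ∀ e l → e < N → bin (u e) l ≤ 16 ℕ.^ K ℕ.* (10 ℕ.* Z) ℕ.^ l
    bin-u e l e<N = bin-bound K Z (u e) l 1≤Z (ℕP.≤-trans (ℕP.<⇒≤ (u<rn e e<N)) (ℕP.≤-reflexive rn≡))

    1≤10Z : 1 ≤ 10 ℕ.* Z
    1≤10Z = ℕP.*-mono-≤ (s≤s (z≤n {9})) 1≤Z

    instance
      10Z≢0 : NonZero (10 ℕ.* Z)
      10Z≢0 = >-nonZero 1≤10Z

    B h : ℕ
    B = (20 ℕ.* Z) ℕ.^ M
    h = (40 ℕ.* Z) ℕ.^ K

    16^K : 16 ℕ.^ K ≡ 2 ℕ.^ M
    16^K = ℕP.^-*-assoc 2 4 K

    bin-B : ∀ l e → l < M → e < N → ∣ + bin (u e) l ∣ ≤ B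
    bin-B l e l<M e<N = begin
      bin (u e) l                          ≤⟨ bin-u e l e<N ⟩
      16 ℕ.^ K ℕ.* (10 ℕ.* Z) ℕ.^ l        ≤⟨ ℕP.*-monoʳ-≤ (16 ℕ.^ K) (ℕP.^-monoʳ-≤ (10 ℕ.* Z) (ℕP.<⇒≤ l<M)) ⟩
      16 ℕ.^ K ℕ.* (10 ℕ.* Z) ℕ.^ M        ≡⟨ cong (ℕ._* (10 ℕ.* Z) ℕ.^ M) 16^K ⟩
      2 ℕ.^ M ℕ.* (10 ℕ.* Z) ℕ.^ M         ≡⟨ sym (^-distribʳ-* M 2 (10 ℕ.* Z)) ⟩
      (2 ℕ.* (10 ℕ.* Z)) ℕ.^ M             ≡⟨ cong (ℕ._^ M) (sym (ℕP.*-assoc 2 10 Z)) ⟩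
      B                                    ∎
      where open ℕP.≤-Reasoning

    bin-small : ∀ l e → l ≤ K → e < N → bin (u e) l ≤ (160 ℕ.* Z) ℕ.^ K
    bin-small l e l≤K e<N = begin
      bin (u e) l                          ≤⟨ bin-u e l e<N ⟩
      16 ℕ.^ K ℕ.* (10 ℕ.* Z) ℕ.^ l        ≤⟨ ℕP.*-monoʳ-≤ (16 ℕ.^ K) (ℕP.^-monoʳ-≤ (10 ℕ.* Z) l≤K) ⟩
      16 ℕ.^ K ℕ.* (10 ℕ.* Z) ℕ.^ K        ≡⟨ sym (^-distribʳ-* K 16 (10 ℕ.* Z)) ⟩
      (16 ℕ.* (10 ℕ.* Z)) ℕ.^ K            ≡⟨ cong (ℕ._^ K) (sym (ℕP.*-assoc 16 10 Z)) ⟩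
      (160 ℕ.* Z) ℕ.^ K                    ∎
      where open ℕP.≤-Reasoning

    1≤^ : ∀ {a} b → 1 ≤ a → 1 ≤ a ℕ.^ b
    1≤^ {a} b 1≤a = ℕP.m^n>0 a {{>-nonZero 1≤a}} b

    40K+1< : 40 ℕ.* K ℕ.+ 1 < 16 ℕ.^ K
    40K+1< = subst (λ K → 40 ℕ.* K ℕ.+ 1 < 16 ℕ.^ K) (ℕP.m+[n∸m]≡n 2≤K) (40K+1<16^K (K ∸ 2))

    -- A form takes at most (40 K + 1) B h values, fewer than 16^K B h = h^5. Since N = 5 M, the
    -- M-th power of this is h^N. This fivefold surplus of unknowns is what makes a height with base
    -- linear in Z possible.
    count : suc (N ℕ.* (B ℕ.* h) ℕ.+ N ℕ.* (B ℕ.* h)) ℕ.^ M < h ℕ.^ N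
    count = begin-strict
      suc (N ℕ.* (B ℕ.* h) ℕ.+ N ℕ.* (B ℕ.* h)) ℕ.^ M   <⟨ ℕP.^-monoˡ-< M {{M≢0}} base< ⟩
      (h ℕ.^ 5) ℕ.^ M                                   ≡⟨ ℕP.^-*-assoc h 5 M ⟩
      h ℕ.^ (5 ℕ.* (4 ℕ.* K))                           ≡⟨ cong (h ℕ.^_) (trans (sym (ℕP.*-assoc 5 4 K)) (sym N≡20K)) ⟩
      h ℕ.^ N                                           ∎
      where
      open ℕP.≤-Reasoning
      M≢0 : NonZero M
      M≢0 = >-nonZero (ℕP.*-mono-≤ (s≤s (z≤n {3})) (ℕP.≤-trans (s≤s z≤n) 2≤K))
      1≤Bh : 1 ≤ B ℕ.* h
      1≤Bh = ℕP.*-mono-≤ (1≤^ M (ℕP.*-mono-≤ (s≤s (z≤n {19})) 1≤Z)) (1≤^ K (ℕP.*-mono-≤ (s≤s (z≤n {39})) 1≤Z))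
      collect : ∀ N b → b ℕ.+ (N ℕ.* b ℕ.+ N ℕ.* b) ≡ (2 ℕ.* N ℕ.+ 1) ℕ.* b
      collect = solveℕ-∀
      h⁴ : 16 ℕ.^ K ℕ.* B ≡ h ℕ.^ 4
      h⁴ = trans (cong (ℕ._* B) 16^K) (trans (sym (^-distribʳ-* M 2 (20 ℕ.* Z)))
        (trans (cong (ℕ._^ M) (sym (ℕP.*-assoc 2 20 Z))) (trans (cong ((40 ℕ.* Z) ℕ.^_) (ℕP.*-comm 4 K)) (sym (ℕP.^-*-assoc (40 ℕ.* Z) K 4)))))
      base< : suc (N ℕ.* (B ℕ.* h) ℕ.+ N ℕ.* (B ℕ.* h)) < h ℕ.^ 5
      base< = begin-strict
        1 ℕ.+ (N ℕ.* (B ℕ.* h) ℕ.+ N ℕ.* (B ℕ.* h))            ≤⟨ ℕP.+-monoˡ-≤ _ 1≤Bh ⟩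
        B ℕ.* h ℕ.+ (N ℕ.* (B ℕ.* h) ℕ.+ N ℕ.* (B ℕ.* h))      ≡⟨ collect N (B ℕ.* h) ⟩
        (2 ℕ.* N ℕ.+ 1) ℕ.* (B ℕ.* h)                          ≡⟨ cong (λ x → (x ℕ.+ 1) ℕ.* (B ℕ.* h)) (trans (cong (2 ℕ.*_) N≡20K) (sym (ℕP.*-assoc 2 20 K))) ⟩
        (40 ℕ.* K ℕ.+ 1) ℕ.* (B ℕ.* h)                         <⟨ ℕP.*-monoˡ-< (B ℕ.* h) {{>-nonZero 1≤Bh}} 40K+1< ⟩
        16 ℕ.^ K ℕ.* (B ℕ.* h)                                 ≡⟨ sym (ℕP.*-assoc (16 ℕ.^ K) B h) ⟩
        16 ℕ.^ K ℕ.* B ℕ.* h                                   ≡⟨ cong (ℕ._* h) h⁴ ⟩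
        h ℕ.^ 4 ℕ.* h                                          ≡⟨ ℕP.*-comm (h ℕ.^ 4) h ⟩
        h ℕ.^ 5                                                ∎

    module Auxiliary (p : ℕ → ℤ) (p≤h : ∀ e → ∣ p e ∣ ≤ h) (p≢0 : ∃ λ e → e < N × p e ≢ 0ℤ)
      (solves : ∀ l → l < M → ∑ N (λ e → + bin (u e) l * p e) ≡ 0ℤ) where

      order-M : ∀ φ → Deg M φ → ∑ N (λ e → p e * φ (u e)) ≡ 0ℤ
      order-M = moments N M p u λ l l<M → trans (∑-cong N λ e _ → *-comm (p e) (+ bin (u e) l)) (solves l l<M)

      y z P₁ P₂ : ℕ → ℤ
      y τ = (+ γ₂) ^ τ
      z τ = (+ γ₁) ^ τ
      P₁ τ = (+ ρ₁) ^ τ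
      P₂ τ = (+ ρ₂) ^ τ

      x : ℕ → ℕ → ℤ
      x τ i = P₁ τ ^ i * P₂ τ ^ (n ∸ i)

      θ : ℕ → ℕ → ℤ
      θ τ e = x τ (e DM./ J) * (y τ ^ (e DM.% J) * z τ ^ (J ∸ suc (e DM.% J)))

      value : ℕ → ℕ → ℤ
      value τ l = ∑ N (λ e → p e * θ τ e * + bin (u e) l)

      D : ℤ
      D = (+ σ) ^ (3 ℕ.* K)

      open Mod D

      power-swap : ∀ a m l → (a ^ m) ^ l ≡ (a ^ l) ^ m
      power-swap a m l = trans (^-*-assoc a m l) (trans (cong (a ^_) (ℕP.*-comm m l)) (sym (^-*-assoc a l m)))

      relation-τ : ∀ τ → (z τ ^ r * P₁ τ) ≈ (y τ ^ r * P₂ τ)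
      relation-τ τ = subst₂ _≈_ (shape γ₁ ρ₁) (shape γ₂ ρ₂) (^-≈ {(+ γ₁) ^ r * + ρ₁} {(+ γ₂) ^ r * + ρ₂} τ relation)
        where
        shape : ∀ γ ρ → ((+ γ) ^ r * + ρ) ^ τ ≡ ((+ γ) ^ τ) ^ r * (+ ρ) ^ τ
        shape γ ρ = trans (^-*-distrib τ ((+ γ) ^ r) (+ ρ)) (cong (_* (+ ρ) ^ τ) (power-swap (+ γ) r τ))

      -- Clears denominators: z^r for each of the n possible powers of X, and one more z because `θ`
      -- is homogeneous of degree J - 1 in its second part. It is prime to σ and is cancelled again
      -- in `D∣value`.
      unit : ℕ → ℤ
      unit τ = z τ * (z τ ^ r) ^ n

      -- Modulo `D` the relation says that X = (ρ₁/ρ₂)^τ agrees with Y^r at Y = (γ₂/γ₁)^τ, so a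
      -- monomial may be replaced by its restriction to the curve.
      term : ∀ τ i j → i < n → j < J →
        (unit τ * (x τ i * (y τ ^ j * z τ ^ (J ∸ suc j)))) ≈ (P₂ τ ^ n * (y τ ^ (j ℕ.+ r ℕ.* i) * z τ ^ (U ∸ (j ℕ.+ r ℕ.* i))))
      term τ i j i<n j<J = subst₂ _≈_ (sym left) (sym right)
        (*-≈ {(zʳ * P₁ τ) ^ i} {(yʳ * P₂ τ) ^ i} (^-≈ {zʳ * P₁ τ} {yʳ * P₂ τ} i (relation-τ τ)) (≈-refl rest))
        where
        open ≡-Reasoning
        zʳ = z τ ^ r
        yʳ = y τ ^ r
        rest = (zʳ * P₂ τ) ^ (n ∸ i) * (y τ ^ j * (z τ * z τ ^ (J ∸ suc j)))
        i≤n = ℕP.<⇒≤ i<n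
        split : ∀ a → a ^ n ≡ a ^ i * a ^ (n ∸ i)
        split a = trans (cong (a ^_) (sym (ℕP.m+[n∸m]≡n i≤n))) (^-distribˡ-+-* a i (n ∸ i))
        lemma₁ : ∀ z a b p q y w → z * (a * b) * (p * q * (y * w)) ≡ a * p * (b * q * (y * (z * w)))
        lemma₁ = solve-∀
        left : unit τ * (x τ i * (y τ ^ j * z τ ^ (J ∸ suc j))) ≡ (zʳ * P₁ τ) ^ i * rest
        left = begin
          z τ * zʳ ^ n * (P₁ τ ^ i * P₂ τ ^ (n ∸ i) * (y τ ^ j * z τ ^ (J ∸ suc j)))
            ≡⟨ cong (λ a → z τ * a * (P₁ τ ^ i * P₂ τ ^ (n ∸ i) * (y τ ^ j * z τ ^ (J ∸ suc j)))) (split zʳ) ⟩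
          z τ * (zʳ ^ i * zʳ ^ (n ∸ i)) * (P₁ τ ^ i * P₂ τ ^ (n ∸ i) * (y τ ^ j * z τ ^ (J ∸ suc j)))
            ≡⟨ lemma₁ (z τ) (zʳ ^ i) (zʳ ^ (n ∸ i)) (P₁ τ ^ i) (P₂ τ ^ (n ∸ i)) (y τ ^ j) (z τ ^ (J ∸ suc j)) ⟩
          zʳ ^ i * P₁ τ ^ i * (zʳ ^ (n ∸ i) * P₂ τ ^ (n ∸ i) * (y τ ^ j * (z τ * z τ ^ (J ∸ suc j))))
            ≡⟨ cong₂ (λ a b → a * (b * (y τ ^ j * (z τ * z τ ^ (J ∸ suc j))))) (sym (^-*-distrib i zʳ (P₁ τ))) (sym (^-*-distrib (n ∸ i) zʳ (P₂ τ))) ⟩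
          (zʳ * P₁ τ) ^ i * rest ∎
        lemma₂ : ∀ a b c d y w → a * b * (c * d) * (y * w) ≡ a * c * (b * y * (d * w))
        lemma₂ = solve-∀
        exponent : U ∸ (j ℕ.+ r ℕ.* i) ≡ r ℕ.* (n ∸ i) ℕ.+ suc (J ∸ suc j)
        exponent = trans (cong (_∸ (j ℕ.+ r ℕ.* i)) (sym total-exp)) (ℕP.m+n∸n≡m _ (j ℕ.+ r ℕ.* i))
          where
          arrange : ∀ a b c d → (a ℕ.+ suc b) ℕ.+ (c ℕ.+ d) ≡ (d ℕ.+ a) ℕ.+ (b ℕ.+ suc c)
          arrange = solveℕ-∀
          total-exp : r ℕ.* (n ∸ i) ℕ.+ suc (J ∸ suc j) ℕ.+ (j ℕ.+ r ℕ.* i) ≡ U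
          total-exp = trans (arrange (r ℕ.* (n ∸ i)) (J ∸ suc j) j (r ℕ.* i))
            (cong₂ ℕ._+_ (trans (sym (ℕP.*-distribˡ-+ r i (n ∸ i))) (cong (r ℕ.*_) (ℕP.m+[n∸m]≡n i≤n))) (ℕP.m∸n+n≡m j<J))
        right : P₂ τ ^ n * (y τ ^ (j ℕ.+ r ℕ.* i) * z τ ^ (U ∸ (j ℕ.+ r ℕ.* i))) ≡ (yʳ * P₂ τ) ^ i * rest
        right = begin
          P₂ τ ^ n * (y τ ^ (j ℕ.+ r ℕ.* i) * z τ ^ (U ∸ (j ℕ.+ r ℕ.* i)))
            ≡⟨ cong₂ (λ a b → a * (b * z τ ^ (U ∸ (j ℕ.+ r ℕ.* i)))) (split (P₂ τ))
                 (trans (^-distribˡ-+-* (y τ) j (r ℕ.* i)) (cong (y τ ^ j *_) (sym (^-*-assoc (y τ) r i)))) ⟩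
          P₂ τ ^ i * P₂ τ ^ (n ∸ i) * (y τ ^ j * yʳ ^ i * z τ ^ (U ∸ (j ℕ.+ r ℕ.* i)))
            ≡⟨ cong (λ w → P₂ τ ^ i * P₂ τ ^ (n ∸ i) * (y τ ^ j * yʳ ^ i * w))
                 (trans (cong (z τ ^_) exponent) (trans (^-distribˡ-+-* (z τ) (r ℕ.* (n ∸ i)) (suc (J ∸ suc j)))
                   (cong (_* z τ ^ suc (J ∸ suc j)) (sym (^-*-assoc (z τ) r (n ∸ i)))))) ⟩
          P₂ τ ^ i * P₂ τ ^ (n ∸ i) * (y τ ^ j * yʳ ^ i * (zʳ ^ (n ∸ i) * (z τ * z τ ^ (J ∸ suc j))))
            ≡⟨ lemma₃ (P₂ τ ^ i) (P₂ τ ^ (n ∸ i)) (y τ ^ j) (yʳ ^ i) (zʳ ^ (n ∸ i)) (z τ * z τ ^ (J ∸ suc j)) ⟩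
          yʳ ^ i * P₂ τ ^ i * (zʳ ^ (n ∸ i) * P₂ τ ^ (n ∸ i) * (y τ ^ j * (z τ * z τ ^ (J ∸ suc j))))
            ≡⟨ cong₂ (λ a b → a * (b * (y τ ^ j * (z τ * z τ ^ (J ∸ suc j))))) (sym (^-*-distrib i yʳ (P₂ τ))) (sym (^-*-distrib (n ∸ i) zʳ (P₂ τ))) ⟩
          (yʳ * P₂ τ) ^ i * rest ∎
          where
          lemma₃ : ∀ a b c d e f → a * b * (c * d * (e * f)) ≡ d * a * (e * b * (c * f))
          lemma₃ = solve-∀

      form : ℕ → ℕ → ℤ
      form τ l = ∑ N (λ e → p e * + bin (u e) l * (y τ ^ u e * z τ ^ (U ∸ u e)))

      value≈form : ∀ τ l → (unit τ * value τ l) ≈ (P₂ τ ^ n * form τ l)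
      value≈form τ l = subst₂ _≈_ (sym (*-∑ (unit τ) N _)) (sym (*-∑ (P₂ τ ^ n) N _)) (∑-≈ N pointwise)
        where
        lemmaˡ : ∀ c a t b → a * b * (c * t) ≡ c * (a * t * b)
        lemmaˡ = solve-∀
        lemmaʳ : ∀ a b c w → a * b * (c * w) ≡ c * (a * b * w)
        lemmaʳ = solve-∀
        pointwise : ∀ e → e < N → (unit τ * (p e * θ τ e * + bin (u e) l)) ≈ (P₂ τ ^ n * (p e * + bin (u e) l * (y τ ^ u e * z τ ^ (U ∸ u e))))
        pointwise e e<N = subst₂ _≈_ (lemmaˡ (unit τ) (p e) (θ τ e) (+ bin (u e) l)) (lemmaʳ (p e) (+ bin (u e) l) (P₂ τ ^ n) _)
          (*-≈ {p e * + bin (u e) l} (≈-refl (p e * + bin (u e) l))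
            (term τ (e DM./ J) (e DM.% J) (DM.m<n*o⇒m/o<n e<N) (DM.m%n<n e J)))

      -- σ divides y - z at every point, and a derivative of order l < K leaves at least 3 K of the
      -- order 4 K of vanishing.
      D∣form : ∀ τ l → l < K → D ∣ form τ l
      D∣form τ l l<K = ∣-trans (∣-^ (3 ℕ.* K) close)
        (vanishing⇒divisible N M l (3 ℕ.* K) p u U (y τ) (z τ) orders
          (λ e e<N → ℕP.≤-trans (ℕP.<⇒≤ (u<rn e e<N)) (ℕP.m≤m+n (r ℕ.* n) J)) order-M)
        where
        close : + σ ∣ y τ - z τ
        close = Mod.^-≈ (+ σ) {+ γ₂} {+ γ₁} τ γ-close
        orders : l ℕ.+ 3 ℕ.* K ≤ M
        orders = ℕP.+-monoˡ-≤ (3 ℕ.* K) (ℕP.<⇒≤ l<K)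

      D∣value : ∀ τ l → l < K → σ ℕ.^ (3 ℕ.* K) ℕD.∣ ∣ value τ l ∣
      D∣value τ l l<K = coprime-divisor cop (subst₂ ℕD._∣_ (abs-^ (+ σ) (3 ℕ.* K)) (abs-* (unit τ) (value τ l))
        (∣⇒∣ᵤ (subst (D ∣_) (lemma (unit τ * value τ l) (P₂ τ ^ n * form τ l))
          (∣m∣n⇒∣m+n (value≈form τ l) (∣n⇒∣m*n (P₂ τ ^ n) (D∣form τ l l<K))))))
        where
        lemma : ∀ a b → (a - b) + b ≡ a
        lemma = solve-∀
        unit-abs : ∣ unit τ ∣ ≡ γ₁ ℕ.^ τ ℕ.* ((γ₁ ℕ.^ τ) ℕ.^ r) ℕ.^ n
        unit-abs = trans (abs-* (z τ) _) (cong₂ ℕ._*_ (abs-^ (+ γ₁) τ)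
          (trans (abs-^ (z τ ^ r) n) (cong (ℕ._^ n) (trans (abs-^ (z τ) r) (cong (ℕ._^ r) (abs-^ (+ γ₁) τ))))))
        cop : Coprime (σ ℕ.^ (3 ℕ.* K)) ∣ unit τ ∣
        cop = subst (Coprime (σ ℕ.^ (3 ℕ.* K))) (sym unit-abs) (coprime-^ˡ (3 ℕ.* K)
          (coprime-*ʳ (coprime-^ʳ τ coprime) (coprime-^ʳ n (coprime-^ʳ r (coprime-^ʳ τ coprime)))))

      power-bound : ∀ τ {a b c} i j m E → τ ≤ 41 → i ℕ.+ j ≤ m → 1 ≤ a → a ≤ c → b ≤ c →
        c ℕ.^ (41 ℕ.* m) ≤ E → ∣ ((+ a) ^ τ) ^ i * ((+ b) ^ τ) ^ j ∣ ≤ E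
      power-bound τ {a} {b} {c} i j m E τ≤ i+j≤m 1≤a a≤c b≤c c≤E = begin
        ∣ ((+ a) ^ τ) ^ i * ((+ b) ^ τ) ^ j ∣     ≡⟨ trans (abs-* (((+ a) ^ τ) ^ i) _) (cong₂ ℕ._*_ (unfold a i) (unfold b j)) ⟩
        a ℕ.^ (τ ℕ.* i) ℕ.* b ℕ.^ (τ ℕ.* j)       ≤⟨ ℕP.*-mono-≤ (ℕP.^-monoˡ-≤ (τ ℕ.* i) a≤c) (ℕP.^-monoˡ-≤ (τ ℕ.* j) b≤c) ⟩
        c ℕ.^ (τ ℕ.* i) ℕ.* c ℕ.^ (τ ℕ.* j)       ≡⟨ trans (sym (ℕP.^-distribˡ-+-* c (τ ℕ.* i) (τ ℕ.* j))) (cong (c ℕ.^_) (sym (ℕP.*-distribˡ-+ τ i j))) ⟩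
        c ℕ.^ (τ ℕ.* (i ℕ.+ j))                   ≤⟨ ℕP.^-monoʳ-≤ c {{>-nonZero (ℕP.≤-trans 1≤a a≤c)}} (ℕP.*-mono-≤ τ≤ i+j≤m) ⟩
        c ℕ.^ (41 ℕ.* m)                          ≤⟨ c≤E ⟩
        E                                         ∎
        where
        open ℕP.≤-Reasoning
        unfold : ∀ a i → ∣ ((+ a) ^ τ) ^ i ∣ ≡ a ℕ.^ (τ ℕ.* i)
        unfold a i = trans (abs-^ ((+ a) ^ τ) i) (trans (cong (ℕ._^ i) (abs-^ (+ a) τ)) (ℕP.^-*-assoc a τ i))

      θ-bound : ∀ τ e → τ ≤ 41 → e < N → ∣ θ τ e ∣ ≤ 2 ℕ.^ K ℕ.* 2 ℕ.^ K
      θ-bound τ e τ≤ e<N = ℕP.≤-trans (ℕP.≤-reflexive (abs-* (x τ (e DM./ J)) _)) (ℕP.*-mono-≤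
        (power-bound τ (e DM./ J) (n ∸ e DM./ J) n (2 ℕ.^ K) τ≤ (ℕP.≤-reflexive (ℕP.m+[n∸m]≡n (ℕP.<⇒≤ (DM.m<n*o⇒m/o<n e<N)))) 1≤ρ₁ ρ₁≤R ρ₂≤R R-small)
        (power-bound τ (e DM.% J) (J ∸ suc (e DM.% J)) J (2 ℕ.^ K) τ≤
          (ℕP.≤-trans (ℕP.n≤1+n _) (ℕP.≤-reflexive (ℕP.m+[n∸m]≡n (DM.m%n<n e J)))) 1≤γ₂ γ₂≤Γ γ₁≤Γ Γ-small))

      -- The hypothesis on σ collects the K-th roots of all contributions: 40 Z for the
      -- coefficients, 160 Z for the binomials, 2 * 2 for the two coordinates of the point, and 16
      -- to beat the number 20 K of terms.
      value-small : ∀ τ l → τ ≤ 41 → l ≤ K → ∣ value τ l ∣ < σ ℕ.^ (3 ℕ.* K)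
      value-small τ l τ≤ l≤K = begin-strict
        ∣ value τ l ∣                    ≤⟨ ∣∑∣≤ N _ X each ⟩
        N ℕ.* X                          ≡⟨ cong (ℕ._* X) N≡20K ⟩
        20 ℕ.* K ℕ.* X                   <⟨ ℕP.*-monoˡ-< X {{>-nonZero 1≤X}} (ℕP.≤-<-trans (ℕP.≤-trans (ℕP.*-monoˡ-≤ K (ℕP.m≤m+n 20 20)) (ℕP.m≤m+n (40 ℕ.* K) 1)) 40K+1<) ⟩
        16 ℕ.^ K ℕ.* X                   ≡⟨ cong (16 ℕ.^ K ℕ.*_) (trans (cong₂ ℕ._*_ (sym (^-distribʳ-* K (40 ℕ.* Z) (160 ℕ.* Z))) (sym (^-distribʳ-* K 2 2)))
                                              (sym (^-distribʳ-* K (40 ℕ.* Z ℕ.* (160 ℕ.* Z)) (2 ℕ.* 2)))) ⟩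
        16 ℕ.^ K ℕ.* (40 ℕ.* Z ℕ.* (160 ℕ.* Z) ℕ.* (2 ℕ.* 2)) ℕ.^ K ≡⟨ sym (^-distribʳ-* K 16 (40 ℕ.* Z ℕ.* (160 ℕ.* Z) ℕ.* (2 ℕ.* 2))) ⟩
        (16 ℕ.* (40 ℕ.* Z ℕ.* (160 ℕ.* Z) ℕ.* (2 ℕ.* 2))) ℕ.^ K ≤⟨ ℕP.^-monoˡ-≤ K σ-large ⟩
        (σ ℕ.^ 3) ℕ.^ K                  ≡⟨ ℕP.^-*-assoc σ 3 K ⟩
        σ ℕ.^ (3 ℕ.* K)                  ∎
        where
        open ℕP.≤-Reasoning
        X = (40 ℕ.* Z) ℕ.^ K ℕ.* (160 ℕ.* Z) ℕ.^ K ℕ.* (2 ℕ.^ K ℕ.* 2 ℕ.^ K)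
        1≤X : 1 ≤ X
        1≤X = ℕP.*-mono-≤ (ℕP.*-mono-≤ (1≤^ K (ℕP.*-mono-≤ (s≤s (z≤n {39})) 1≤Z)) (1≤^ K (ℕP.*-mono-≤ (s≤s (z≤n {159})) 1≤Z)))
          (ℕP.*-mono-≤ (1≤^ {2} K (s≤s z≤n)) (1≤^ {2} K (s≤s z≤n)))
        rearrange : ∀ a b c → a ℕ.* b ℕ.* c ≡ a ℕ.* c ℕ.* b
        rearrange a b c = trans (ℕP.*-assoc a b c) (trans (cong (a ℕ.*_) (ℕP.*-comm b c)) (sym (ℕP.*-assoc a c b)))
        each : ∀ e → e < N → ∣ p e * θ τ e * + bin (u e) l ∣ ≤ X
        each e e<N = ℕP.≤-trans (ℕP.≤-reflexive (trans (abs-* (p e * θ τ e) (+ bin (u e) l)) (cong (ℕ._* bin (u e) l) (abs-* (p e) (θ τ e)))))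
          (ℕP.≤-trans (ℕP.*-mono-≤ (ℕP.*-mono-≤ (p≤h e) (θ-bound τ e τ≤ e<N)) (bin-small l e l≤K e<N))
            (ℕP.≤-reflexive (rearrange h (2 ℕ.^ K ℕ.* 2 ℕ.^ K) ((160 ℕ.* Z) ℕ.^ K))))

      value≡0 : ∀ τ l → τ < 41 → l < K → value τ l ≡ 0ℤ
      value≡0 τ l τ< l<K = ∣i∣≡0⇒i≡0 (small⇒0 (D∣value τ l l<K) (value-small τ l (ℕP.<⇒≤ τ<) (ℕP.<⇒≤ l<K)))
        where
        small⇒0 : ∀ {a b} → a ℕD.∣ b → b < a → b ≡ 0
        small⇒0 {a} {zero}  a∣b b<a = refl
        small⇒0 {a} {suc b} a∣b b<a = contradiction (ℕD.∣⇒≤ a∣b) (ℕP.<⇒≱ b<a)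

      order-K : ∀ τ → τ < 41 → ∀ φ → Deg K φ → ∑ N (λ e → p e * θ τ e * φ (u e)) ≡ 0ℤ
      order-K τ τ< = moments N K (λ e → p e * θ τ e) u λ l l<K → value≡0 τ l τ< l<K

      G : ℕ → ℕ → ℤ
      G i j = p (i ℕ.* J ℕ.+ j)

      rows : ∀ τ → τ < 41 → ∀ φ → Deg K φ →
        ∑ n (λ i → x τ i * ∑ J (λ j → G i j * (y τ ^ j * z τ ^ (J ∸ suc j)) * φ (j ℕ.+ r ℕ.* i))) ≡ 0ℤ
      rows τ τ< φ hφ = trans (∑-cong n λ i _ → trans (*-∑ (x τ i) J _) (∑-cong J λ j j<J → sym (entry i j j<J)))
        (trans (sym (∑-blocks n J _)) (order-K τ τ< φ hφ))
        where
        lemma : ∀ g x w f → g * (x * w) * f ≡ x * (g * w * f)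
        lemma = solve-∀
        entry : ∀ i j → j < J → p (i ℕ.* J ℕ.+ j) * θ τ (i ℕ.* J ℕ.+ j) * φ (u (i ℕ.* J ℕ.+ j))
          ≡ x τ i * (G i j * (y τ ^ j * z τ ^ (J ∸ suc j)) * φ (j ℕ.+ r ℕ.* i))
        entry i j j<J = trans
          (cong₂ (λ i′ j′ → G i j * (x τ i′ * (y τ ^ j′ * z τ ^ (J ∸ suc j′))) * φ (j′ ℕ.+ r ℕ.* i′))
            ([i*n+j]/n i J j j<J) ([i*n+j]%n i J j j<J))
          (lemma (G i j) (x τ i) (y τ ^ j * z τ ^ (J ∸ suc j)) (φ (j ℕ.+ r ℕ.* i)))

      ℓ : ℕ
      ℓ = K ∸ n

      n≤K : n ≤ K
      n≤K = ℕP.*-monoˡ-≤ k (ℕP.≤-trans (ℕP.m≤m+n 20 20) 40≤J)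

      -- The Euler derivations use up n = 20 k of the order K. That 41 (K - 20 k) still exceeds 20 K
      -- means 820 k < 21 K, which holds since K = J k with J at least 40.
      enough : n ℕ.* J < 41 ℕ.* ℓ
      enough = ℕP.+-cancelʳ-< (41 ℕ.* n) _ _ (begin-strict
        N ℕ.+ 41 ℕ.* n                          ≡⟨ cong₂ ℕ._+_ N≡20K (sym (ℕP.*-assoc 41 20 k)) ⟩
        20 ℕ.* K ℕ.+ 820 ℕ.* k                  <⟨ ℕP.+-monoʳ-< (20 ℕ.* K) (ℕP.*-monoˡ-< k {{>-nonZero 1≤k}} (ℕP.≤-trans (ℕP.m≤m+n 821 19) (ℕP.*-monoʳ-≤ 21 40≤J))) ⟩
        20 ℕ.* K ℕ.+ 21 ℕ.* J ℕ.* k             ≡⟨ cong (20 ℕ.* K ℕ.+_) (ℕP.*-assoc 21 J k) ⟩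
        20 ℕ.* K ℕ.+ 21 ℕ.* K                   ≡⟨ sym (ℕP.*-distribʳ-+ K 20 21) ⟩
        41 ℕ.* K                                ≡⟨ cong (41 ℕ.*_) (sym (ℕP.m∸n+n≡m n≤K)) ⟩
        41 ℕ.* (ℓ ℕ.+ n)                        ≡⟨ ℕP.*-distribˡ-+ 41 ℓ n ⟩
        41 ℕ.* ℓ ℕ.+ 41 ℕ.* n                   ∎)
        where open ℕP.≤-Reasoning

      -- Coincidence would make the positive rational γ₂/γ₁ a root of unity, hence 1.
      powers-apart : ∀ σ′ τ → σ′ ≢ τ → z σ′ * y τ - z τ * y σ′ ≢ 0ℤ
      powers-apart σ′ τ σ≢τ e = case (ℕP.<-cmp σ′ τ)
        where
        eq : γ₁ ℕ.^ σ′ ℕ.* γ₂ ℕ.^ τ ≡ γ₁ ℕ.^ τ ℕ.* γ₂ ℕ.^ σ′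
        eq = +-injective (trans (cast σ′ τ) (trans (i-j≡0⇒i≡j (z σ′ * y τ) (z τ * y σ′) e) (sym (cast τ σ′))))
          where
          cast : ∀ a b → + (γ₁ ℕ.^ a ℕ.* γ₂ ℕ.^ b) ≡ z a * y b
          cast a b = trans (pos-* (γ₁ ℕ.^ a) (γ₂ ℕ.^ b)) (cong₂ _*_ (pos-^ γ₁ a) (pos-^ γ₂ b))
        roots : ∀ d → 1 ≤ d → γ₂ ℕ.^ d ≢ γ₁ ℕ.^ d
        roots d 1≤d e′ with ℕP.<-cmp γ₁ γ₂
        ... | tri< lt _ _ = ℕP.<⇒≢ (ℕP.^-monoˡ-< d {{>-nonZero 1≤d}} lt) (sym e′)
        ... | tri≈ _ eq′ _ = γ₁≢γ₂ eq′
        ... | tri> _ _ gt = ℕP.<⇒≢ (ℕP.^-monoˡ-< d {{>-nonZero 1≤d}} gt) e′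
        reduce : ∀ a d → γ₁ ℕ.^ a ℕ.* γ₂ ℕ.^ (a ℕ.+ d) ≡ γ₁ ℕ.^ (a ℕ.+ d) ℕ.* γ₂ ℕ.^ a → γ₂ ℕ.^ d ≡ γ₁ ℕ.^ d
        reduce a d e′ = ℕP.*-cancelˡ-≡ _ _ (γ₁ ℕ.^ a ℕ.* γ₂ ℕ.^ a) {{>-nonZero (ℕP.*-mono-≤ (1≤^ a 1≤γ₁) (1≤^ a 1≤γ₂))}}
          (trans (ℕP.*-assoc (γ₁ ℕ.^ a) (γ₂ ℕ.^ a) (γ₂ ℕ.^ d)) (trans (cong (γ₁ ℕ.^ a ℕ.*_) (sym (ℕP.^-distribˡ-+-* γ₂ a d))) (trans e′
            (trans (cong (ℕ._* γ₂ ℕ.^ a) (ℕP.^-distribˡ-+-* γ₁ a d)) (swap (γ₁ ℕ.^ a) (γ₁ ℕ.^ d) (γ₂ ℕ.^ a))))))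
          where
          swap : ∀ a b c → a ℕ.* b ℕ.* c ≡ a ℕ.* c ℕ.* b
          swap a b c = trans (ℕP.*-assoc a b c) (trans (cong (a ℕ.*_) (ℕP.*-comm b c)) (sym (ℕP.*-assoc a c b)))
        gap : ∀ a b → a < b → γ₁ ℕ.^ a ℕ.* γ₂ ℕ.^ b ≡ γ₁ ℕ.^ b ℕ.* γ₂ ℕ.^ a → ⊥
        gap a b a<b e′ = roots (b ∸ a) (ℕP.m<n⇒0<n∸m a<b) (reduce a (b ∸ a)
          (subst (λ b → γ₁ ℕ.^ a ℕ.* γ₂ ℕ.^ b ≡ γ₁ ℕ.^ b ℕ.* γ₂ ℕ.^ a) (sym (ℕP.m+[n∸m]≡n (ℕP.<⇒≤ a<b))) e′))
        case : _ → ⊥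
        case (tri< lt _ _) = gap σ′ τ lt eq
        case (tri≈ _ eq′ _) = σ≢τ eq′
        case (tri> _ _ gt) = gap τ σ′ gt (sym eq)

      exponents-distinct : ∀ i i′ j j′ → j < J → j′ < J → i ≢ i′ → j ℕ.+ r ℕ.* i ≢ j′ ℕ.+ r ℕ.* i′
      exponents-distinct i i′ j j′ j<J j′<J i≢i′ e = i≢i′ (trans (sym ([i*n+j]/n i r j {{r≢0}} (ℕP.<-≤-trans j<J J≤r)))
        (trans (cong (λ m → DM._/_ m r {{r≢0}}) (trans (flip j i) (trans e (sym (flip j′ i′))))) ([i*n+j]/n i′ r j′ {{r≢0}} (ℕP.<-≤-trans j′<J J≤r))))
        where
        r≢0 : NonZero r
        r≢0 = >-nonZero (ℕP.<-≤-trans (ℕP.<-≤-trans (s≤s z≤n) 40≤J) J≤r)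
        flip : ∀ j i → i ℕ.* r ℕ.+ j ≡ j ℕ.+ r ℕ.* i
        flip j i = trans (ℕP.+-comm (i ℕ.* r) j) (cong (j ℕ.+_) (ℕP.*-comm i r))

      p≡0 : ∀ i j → i < n → j < J → p (i ℕ.* J ℕ.+ j) ≡ 0ℤ
      p≡0 = zero-estimate n J 41 ℓ x G (r ℕ.*_) y z enough
        (λ τ → ^-≢0 τ (+suc≢0 1≤γ₂)) (λ τ → ^-≢0 τ (+suc≢0 1≤γ₁))
        (λ τ i → *-≢0 (^-≢0 i (^-≢0 τ (+suc≢0 1≤ρ₁))) (^-≢0 (n ∸ i) (^-≢0 τ (+suc≢0 1≤ρ₂))))
        (λ s t _ _ → powers-apart s t)
        (λ i i′ j j′ _ _ j<J j′<J → exponents-distinct i i′ j j′ j<J j′<J)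
        (λ τ τ< φ hφ → rows τ τ< φ (subst (λ d → Deg d φ) (ℕP.m+[n∸m]≡n n≤K) hφ))

      contra : ⊥
      contra = let (e , e<N , pe≢0) = p≢0 in
        pe≢0 (trans (cong p (trans (DM.m≡m%n+[m/n]*n e J) (ℕP.+-comm (e DM.% J) _)))
          (p≡0 (e DM./ J) (e DM.% J) (DM.m<n*o⇒m/o<n e<N) (DM.m%n<n e J)))

    absurd : ⊥
    absurd = let (p , p≤h , p≢0 , solves) = siegel M N B h (λ l e → + bin (u e) l) bin-B count
             in Auxiliary.contra p p≤h p≢0 solves

-- Power products, orders modulo s and rounding of exponents

module Products where

  open PolynomialFunctions
  open SiegelsLemma using (^-distribʳ-*; funToFin-cong)
  open HermiteInterpolation using (^-*-distrib)
  open NaturalBounds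
  open AuxiliaryPolynomial
  open import Data.Nat using (ℕ; zero; suc; z≤n; s≤s; _+_; _*_; _^_; _∸_; _≤_; _<_; NonZero; >-nonZero; _!)
  open import Data.Nat.Properties
  open import Data.Nat.DivMod
  import Data.Nat.Divisibility as ℕD
  open import Data.Nat.Coprimality as Cop using (Coprime; coprime-divisor)
  open import Data.Nat.Tactic.RingSolver using (solve-∀)
  open import Data.Fin as Fin using (Fin; toℕ; fromℕ<)
  import Data.Fin.Properties as FinP
  open import Data.Integer as ℤ using (ℤ; +_; ∣_∣)
  import Data.Integer.Properties as ℤP
  open import Data.Integer.Divisibility.Signed as ℤD using (divides)
  open import Data.Integer.Tactic.RingSolver using () renaming (solve-∀ to solveℤ-∀)

  ∏ : ∀ {k} → (Fin k → ℕ) → ℕ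
  ∏ {zero}  f = 1
  ∏ {suc k} f = f Fin.zero * ∏ (λ i → f (Fin.suc i))

  ∏-cong : ∀ {k} {f g : Fin k → ℕ} → (∀ i → f i ≡ g i) → ∏ f ≡ ∏ g
  ∏-cong {zero}  h = refl
  ∏-cong {suc k} h = cong₂ _*_ (h Fin.zero) (∏-cong λ i → h (Fin.suc i))

  ∏-* : ∀ {k} (f g : Fin k → ℕ) → ∏ (λ i → f i * g i) ≡ ∏ f * ∏ g
  ∏-* {zero}  f g = refl
  ∏-* {suc k} f g = trans (cong (f Fin.zero * g Fin.zero *_) (∏-* (λ i → f (Fin.suc i)) (λ i → g (Fin.suc i))))
    ([m*n]*[o*p]≡[m*o]*[n*p] (f Fin.zero) (g Fin.zero) _ _)

  ∏-^ : ∀ {k} n (f : Fin k → ℕ) → ∏ (λ i → f i ^ n) ≡ ∏ f ^ n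
  ∏-^ {zero}  n f = sym (^-zeroˡ n)
  ∏-^ {suc k} n f = trans (cong (f Fin.zero ^ n *_) (∏-^ n (λ i → f (Fin.suc i)))) (sym (^-distribʳ-* n (f Fin.zero) _))

  ∏-mono : ∀ {k} {f g : Fin k → ℕ} → (∀ i → f i ≤ g i) → ∏ f ≤ ∏ g
  ∏-mono {zero}  h = ≤-refl
  ∏-mono {suc k} h = *-mono-≤ (h Fin.zero) (∏-mono λ i → h (Fin.suc i))

  1≤∏ : ∀ {k} {f : Fin k → ℕ} → (∀ i → 1 ≤ f i) → 1 ≤ ∏ f
  1≤∏ {zero}  h = ≤-refl
  1≤∏ {suc k} h = *-mono-≤ (h Fin.zero) (1≤∏ λ i → h (Fin.suc i))

  coprime-∏ : ∀ {k s} {f : Fin k → ℕ} → (∀ i → Coprime s (f i)) → Coprime s (∏ f)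
  coprime-∏ {zero}  h = Cop.sym (Cop.1-coprimeTo _)
  coprime-∏ {suc k} h = coprime-*ʳ (h Fin.zero) (coprime-∏ λ i → h (Fin.suc i))

  ∏^ : ∀ {k} → (Fin k → ℕ) → (Fin k → ℕ) → ℕ
  ∏^ p a = ∏ (λ i → p i ^ a i)

  ∏^-+ : ∀ {k} (p a b : Fin k → ℕ) → ∏^ p (λ i → a i + b i) ≡ ∏^ p a * ∏^ p b
  ∏^-+ p a b = trans (∏-cong λ i → ^-distribˡ-+-* (p i) (a i) (b i)) (∏-* (λ i → p i ^ a i) (λ i → p i ^ b i))

  ∏^-* : ∀ {k} n (p a : Fin k → ℕ) → ∏^ p (λ i → a i * n) ≡ ∏^ p a ^ n
  ∏^-* n p a = trans (∏-cong λ i → sym (^-*-assoc (p i) (a i) n)) (∏-^ n (λ i → p i ^ a i))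

  ∏^-bound : ∀ {k} (p a : Fin k → ℕ) X → (∀ i → 1 ≤ p i) → (∀ i → a i ≤ X) → ∏^ p a ≤ ∏ p ^ X
  ∏^-bound p a X 1≤p a≤X = ≤-trans (∏-mono λ i → ^-monoʳ-≤ (p i) {{>-nonZero (1≤p i)}} (a≤X i)) (≤-reflexive (∏-^ X p))

  ∏-≈1 : ∀ d {k} (f : Fin k → ℕ) → (∀ i → Mod._≈_ d (+ f i) (+ 1)) → Mod._≈_ d (+ ∏ f) (+ 1)
  ∏-≈1 d {zero}  f h = Mod.≈-refl d (+ 1)
  ∏-≈1 d {suc k} f h = subst (λ x → Mod._≈_ d x (+ 1)) (sym (ℤP.pos-* (f Fin.zero) _))
    (Mod.*-≈ d {+ f Fin.zero} {+ 1} {+ ∏ (λ i → f (Fin.suc i))} {+ 1} (h Fin.zero) (∏-≈1 d (λ i → f (Fin.suc i)) λ i → h (Fin.suc i)))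

  small-difference : ∀ m a b → a < m → b < m → + m ℤD.∣ + a ℤ.- + b → a ≡ b
  small-difference m a b a<m b<m d = ℤP.+-injective (ℤP.i-j≡0⇒i≡j (+ a) (+ b) (ℤP.∣i∣≡0⇒i≡0 (zero-of (ℤD.∣⇒∣ᵤ d)
    (≤-<-trans (≤-reflexive (cong ∣_∣ (ℤP.m-n≡m⊖n a b))) (≤-<-trans (ℤP.∣m⊝n∣≤m⊔n a b) (⊔-pres-<m a<m b<m))))))
    where
    zero-of : ∀ {a b} → a ℕD.∣ b → b < a → b ≡ 0
    zero-of {a} {zero}  a∣b b<a = refl
    zero-of {a} {suc b} a∣b b<a = contradiction (ℕD.∣⇒≤ a∣b) (<⇒≱ b<a)

  geometric : ∀ (a : ℤ) n → (a ℤ.- + 1) ℤ.* ∑ n (a ℤ.^_) ≡ a ℤ.^ n ℤ.- + 1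
  geometric a zero    = ℤP.*-zeroʳ (a ℤ.- + 1)
  geometric a (suc n) = trans (ℤP.*-distribˡ-+ (a ℤ.- + 1) (∑ n (a ℤ.^_)) (a ℤ.^ n))
    (trans (cong (ℤ._+ (a ℤ.- + 1) ℤ.* a ℤ.^ n) (geometric a n)) (lemma a (a ℤ.^ n)))
    where
    lemma : ∀ a b → (b ℤ.- + 1) ℤ.+ (a ℤ.- + 1) ℤ.* b ≡ a ℤ.* b ℤ.- + 1
    lemma = solveℤ-∀

  module Order (s : ℕ) (2≤s : 2 ≤ s) where

    instance
      s≢0 : NonZero s
      s≢0 = >-nonZero (≤-trans (s≤s z≤n) 2≤s)

    -- Two of the s + 1 powers p^0, ..., p^s have the same residue, and the smaller one, being prime
    -- to s, cancels.
    order : ∀ p → Coprime s p → ∃ λ o → 1 ≤ o × o ≤ s × + s ℤD.∣ (+ p) ℤ.^ o ℤ.- + 1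
    order p cop with FinP.pigeonhole (n<1+n s) (λ i → fromℕ< (m%n<n (p ^ toℕ i) s))
    ... | i , j , i<j , eq = o , m<n⇒0<n∸m i<j , ≤-trans (m∸n≤m (toℕ j) (toℕ i)) (≤-pred (FinP.toℕ<n j)) , s∣
      where
      o = toℕ j ∸ toℕ i
      same : p ^ toℕ i % s ≡ p ^ toℕ j % s
      same = trans (sym (FinP.toℕ-fromℕ< _)) (trans (cong toℕ eq) (FinP.toℕ-fromℕ< _))
      expand : ∀ m → + (m % s) ≡ + m ℤ.- + (m / s) ℤ.* + s
      expand m = trans (lemma (+ (m % s)) (+ (m / s) ℤ.* + s))
        (cong (ℤ._- + (m / s) ℤ.* + s) (trans (cong (ℤ._+_ (+ (m % s))) (sym (ℤP.pos-* (m / s) s)))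
          (trans (sym (ℤP.pos-+ (m % s) (m / s * s))) (cong +_ (sym (m≡m%n+[m/n]*n m s))))))
        where
        lemma : ∀ a b → a ≡ (a ℤ.+ b) ℤ.- b
        lemma = solveℤ-∀
      difference : + s ℤD.∣ + (p ^ toℕ j) ℤ.- + (p ^ toℕ i)
      difference = divides (+ (p ^ toℕ j / s) ℤ.- + (p ^ toℕ i / s)) (lemma (+ (p ^ toℕ j)) (+ (p ^ toℕ i)) (+ (p ^ toℕ j / s)) (+ (p ^ toℕ i / s)) (+ s)
        (trans (sym (expand (p ^ toℕ j))) (trans (cong +_ (sym same)) (expand (p ^ toℕ i)))))
        where
        lemma′ : ∀ a b qa qb s → a ℤ.- b ≡ ((a ℤ.- qa ℤ.* s) ℤ.- (b ℤ.- qb ℤ.* s)) ℤ.+ (qa ℤ.- qb) ℤ.* s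
        lemma′ = solveℤ-∀
        lemma : ∀ a b qa qb s → a ℤ.- qa ℤ.* s ≡ b ℤ.- qb ℤ.* s → a ℤ.- b ≡ (qa ℤ.- qb) ℤ.* s
        lemma a b qa qb s e = trans (lemma′ a b qa qb s) (trans (cong (ℤ._+ (qa ℤ.- qb) ℤ.* s) (ℤP.i≡j⇒i-j≡0 e)) (ℤP.+-identityˡ _))
      factor : + (p ^ toℕ j) ℤ.- + (p ^ toℕ i) ≡ + (p ^ toℕ i) ℤ.* ((+ p) ℤ.^ o ℤ.- + 1)
      factor = trans (cong (ℤ._- + (p ^ toℕ i)) (trans (cong (λ e → + (p ^ e)) (sym (m+[n∸m]≡n (<⇒≤ i<j))))
          (trans (cong +_ (^-distribˡ-+-* p (toℕ i) o)) (trans (ℤP.pos-* (p ^ toℕ i) (p ^ o)) (cong (+ (p ^ toℕ i) ℤ.*_) (pos-^ p o))))))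
        (lemma (+ (p ^ toℕ i)) ((+ p) ℤ.^ o))
        where
        lemma : ∀ a b → a ℤ.* b ℤ.- a ≡ a ℤ.* (b ℤ.- + 1)
        lemma = solveℤ-∀
      s∣ : + s ℤD.∣ (+ p) ℤ.^ o ℤ.- + 1
      s∣ = ℤD.∣ᵤ⇒∣ (coprime-divisor (coprime-^ʳ (toℕ i) cop)
        (subst (s ℕD.∣_) (ℤP.abs-* (+ (p ^ toℕ i)) ((+ p) ℤ.^ o ℤ.- + 1)) (ℤD.∣⇒∣ᵤ (subst (+ s ℤD.∣_) factor difference))))

    -- In a^s - 1 = (a - 1)(1 + a + ... + a^(s-1)) the second factor is congruent to s, hence to 0,
    -- modulo s.
    lift : ∀ (a d : ℤ) → + s ℤD.∣ d → d ℤD.∣ a ℤ.- + 1 → d ℤ.* + s ℤD.∣ a ℤ.^ s ℤ.- + 1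
    lift a d s∣d d∣ = subst (d ℤ.* + s ℤD.∣_) (geometric a s)
      (ℤD.∣-trans (ℤD.*-monoʳ-∣ d s∣sum) (ℤD.*-monoˡ-∣ (∑ s (a ℤ.^_)) d∣))
      where
      open Mod (+ s)
      ∑-one : ∀ n → ∑ n (λ _ → + 1) ≡ + n
      ∑-one zero    = refl
      ∑-one (suc n) = trans (cong (ℤ._+ + 1) (∑-one n)) (ℤP.+-comm (+ n) (+ 1))
      one^ : ∀ n → (+ 1) ℤ.^ n ≡ + 1
      one^ = ℤP.^-zeroˡ
      s∣sum : + s ℤD.∣ ∑ s (a ℤ.^_)
      s∣sum = ℤD.∣m+n∣n⇒∣m {m = ∑ s (a ℤ.^_)} {n = ℤ.- + s} (subst (λ x → ∑ s (a ℤ.^_) ≈ x) (∑-one s)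
          (∑-≈ s λ i _ → subst (λ x → (a ℤ.^ i) ≈ x) (one^ i) (^-≈ {a} {+ 1} i (ℤD.∣-trans s∣d d∣))))
        (ℤD.∣m⇒∣-m ℤD.∣-refl)

    -- Orders modulo s are at most s and divide `s !`, so one exponent serves every base. Each
    -- further s-th power gains a factor s; `go` reaches s^(w+1), one power more than is stated.
    exponent : ∀ w p → Coprime s p → + (s ^ w) ℤD.∣ (+ p) ℤ.^ (s ! * s ^ w) ℤ.- + 1
    exponent w p cop = ℤD.∣-trans (ℤD.∣ᵤ⇒∣ (ℕD.n∣m*n s)) (go w)
      where
      base : + s ℤD.∣ (+ p) ℤ.^ (s !) ℤ.- + 1
      base = from (order p cop)
        where
        multiple : ∀ o q → + s ℤD.∣ (+ p) ℤ.^ o ℤ.- + 1 → + s ℤD.∣ (+ p) ℤ.^ (q * o) ℤ.- + 1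
        multiple o q d = subst₂ (λ x y → + s ℤD.∣ x ℤ.- y)
          (trans (ℤP.^-*-assoc (+ p) o q) (cong ((+ p) ℤ.^_) (*-comm o q))) (ℤP.^-zeroˡ q)
          (Mod.^-≈ (+ s) {(+ p) ℤ.^ o} {+ 1} q d)
        from : (∃ λ o → 1 ≤ o × o ≤ s × + s ℤD.∣ (+ p) ℤ.^ o ℤ.- + 1) → + s ℤD.∣ (+ p) ℤ.^ (s !) ℤ.- + 1
        from (suc o , _ , o≤s , d) =
          let o∣s! = ℕD.∣-trans (ℕD.m∣m*n {suc o} (o !)) (ℕD.m≤n⇒m!∣n! o≤s) in
          subst (λ n → + s ℤD.∣ (+ p) ℤ.^ n ℤ.- + 1) (sym (ℕD._∣_.equality o∣s!)) (multiple (suc o) (ℕD._∣_.quotient o∣s!) d)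
      go : ∀ w → + (s ^ suc w) ℤD.∣ (+ p) ℤ.^ (s ! * s ^ w) ℤ.- + 1
      go zero    = subst₂ (λ m n → + m ℤD.∣ (+ p) ℤ.^ n ℤ.- + 1) (sym (*-identityʳ s)) (sym (*-identityʳ (s !))) base
      go (suc w) = subst₂ (λ m n → m ℤD.∣ n ℤ.- + 1)
        (trans (sym (ℤP.pos-* (s ^ suc w) s)) (cong +_ (*-comm (s ^ suc w) s)))
        (trans (ℤP.^-*-assoc (+ p) (s ! * s ^ w) s) (cong ((+ p) ℤ.^_) (trans (*-assoc (s !) (s ^ w) s) (cong (s ! *_) (*-comm (s ^ w) s)))))
        (lift ((+ p) ℤ.^ (s ! * s ^ w)) (+ (s ^ suc w)) (ℤD.∣ᵤ⇒∣ (ℕD.m∣m*n (s ^ w))) (go w))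

  -- The expansion x = r quot + over - under with an error of at most r / Q. The sign is split
  -- because these numbers become exponents of natural numbers.
  record Rounding (r Q x : ℕ) : Set where
    field
      quot over under : ℕ
      equation : x + under ≡ r * quot + over
      over≤    : Q * over ≤ r
      under≤   : Q * under ≤ r
      quot≤    : r * quot ≤ x + r

  -- By hypothesis j x differs from A j r by t₂ - t₁, which is at most N₂ in size. Dividing by j
  -- leaves an error of at most N₂ / j = r / Q.
  rounding-step : ∀ r Q x j A t₁ t₂ N₂ → 1 ≤ j → 1 ≤ Q → j * r ≡ Q * N₂ → t₁ ≤ t₂ + N₂ → t₂ ≤ t₁ + N₂ →
    t₁ + j * x ≡ t₂ + A * (j * r) → Rounding r Q x
  rounding-step r Q x j A t₁ t₂ N₂ 1≤j 1≤Q jr≡ t₁≤ t₂≤ eq = case (≤-total t₁ t₂)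
    where
    open ≤-Reasoning
    instance
      j≢0 : NonZero j
      j≢0 = >-nonZero 1≤j
    swap : ∀ a b c → a * (b * c) ≡ b * (c * a)
    swap = solve-∀
    small : ∀ {α δ} → j * α ≡ δ → δ ≤ N₂ → Q * α ≤ r
    small {α} {δ} jα δ≤ = *-cancelˡ-≤ j (begin
      j * (Q * α)   ≡⟨ lemma j Q α ⟩
      Q * (j * α)   ≡⟨ cong (Q *_) jα ⟩
      Q * δ         ≤⟨ *-monoʳ-≤ Q δ≤ ⟩
      Q * N₂        ≡⟨ sym jr≡ ⟩
      j * r         ∎)
      where
      lemma : ∀ a b c → a * (b * c) ≡ b * (a * c)
      lemma = solve-∀
    case : _ → Rounding r Q x
    case (inj₁ t₁≤t₂) = record
      { quot = A ; over = α ; under = 0 ; equation = trans (+-identityʳ x) (sym x≡)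
      ; over≤ = small jα (≤-trans (∸-monoˡ-≤ t₁ t₂≤) (≤-reflexive (m+n∸m≡n t₁ N₂)))
      ; under≤ = ≤-trans (≤-reflexive (*-zeroʳ Q)) z≤n
      ; quot≤ = ≤-trans (m≤m+n (r * A) α) (≤-trans (≤-reflexive x≡) (m≤m+n x r)) }
      where
      δ = t₂ ∸ t₁
      α = x ∸ r * A
      jx : j * x ≡ δ + j * (r * A)
      jx = +-cancelˡ-≡ t₁ _ _ (trans eq (trans (cong₂ _+_ (sym (m+[n∸m]≡n t₁≤t₂)) (swap A j r)) (+-assoc t₁ δ _)))
      x≡ : r * A + α ≡ x
      x≡ = m+[n∸m]≡n (*-cancelˡ-≤ j (≤-trans (m≤n+m _ δ) (≤-reflexive (sym jx))))
      jα : j * α ≡ δ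
      jα = +-cancelʳ-≡ (j * (r * A)) _ _ (trans (+-comm (j * α) _) (trans (sym (*-distribˡ-+ j (r * A) α)) (trans (cong (j *_) x≡) jx)))
    case (inj₂ t₂≤t₁) = record
      { quot = A ; over = 0 ; under = α ; equation = trans x≡ (sym (+-identityʳ (r * A)))
      ; over≤ = ≤-trans (≤-reflexive (*-zeroʳ Q)) z≤n
      ; under≤ = Qα≤r
      ; quot≤ = ≤-trans (≤-reflexive (sym x≡)) (+-monoʳ-≤ x (≤-trans (≤-trans (≤-reflexive (sym (*-identityˡ α))) (*-monoˡ-≤ α 1≤Q)) Qα≤r)) }
      where
      δ = t₁ ∸ t₂
      α = r * A ∸ x
      jx : δ + j * x ≡ j * (r * A)
      jx = +-cancelˡ-≡ t₂ _ _ (trans (sym (+-assoc t₂ δ _)) (trans (cong (_+ j * x) (m+[n∸m]≡n t₂≤t₁)) (trans eq (cong (_+_ t₂) (swap A j r)))))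
      x≡ : x + α ≡ r * A
      x≡ = m+[n∸m]≡n (*-cancelˡ-≤ j (≤-trans (m≤n+m _ δ) (≤-reflexive jx)))
      jα : j * α ≡ δ
      jα = +-cancelʳ-≡ (j * x) _ _ (trans (+-comm (j * α) _) (trans (sym (*-distribˡ-+ j x α)) (trans (cong (j *_) x≡) (sym jx))))
      Qα≤r : Q * α ≤ r
      Qα≤r = small jα (≤-trans (∸-monoˡ-≤ t₂ t₁≤) (≤-reflexive (m+n∸m≡n t₂ N₂)))

  -- Two multiples of x with nearly the same residue modulo j r differ by a multiple of j
  -- that is close to a multiple of j r.
  rounding : ∀ r Q x j j₁ N₂ .{{_ : NonZero N₂}} .{{_ : NonZero (j * r)}} → 1 ≤ j → 1 ≤ Q → j * r ≡ Q * N₂ →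
    (j₁ * x % (j * r)) / N₂ ≡ ((j₁ + j) * x % (j * r)) / N₂ → Rounding r Q x
  rounding r Q x j j₁ N₂ 1≤j 1≤Q jr≡ same =
    rounding-step r Q x j (q₂ ∸ q₁) t₁ t₂ N₂ 1≤j 1≤Q jr≡ (near t₁ t₂ same) (near t₂ t₁ (sym same)) eq
    where
    t₁ = j₁ * x % (j * r)
    t₂ = (j₁ + j) * x % (j * r)
    q₁ = j₁ * x / (j * r)
    q₂ = (j₁ + j) * x / (j * r)
    near : ∀ a b → a / N₂ ≡ b / N₂ → a ≤ b + N₂
    near a b e = begin
      a                        ≡⟨ m≡m%n+[m/n]*n a N₂ ⟩
      a % N₂ + a / N₂ * N₂     ≤⟨ +-monoˡ-≤ _ (m%n≤n a N₂) ⟩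
      N₂ + a / N₂ * N₂         ≡⟨ cong (λ z → N₂ + z * N₂) e ⟩
      N₂ + b / N₂ * N₂         ≤⟨ +-monoʳ-≤ N₂ (m/n*n≤m b N₂) ⟩
      N₂ + b                   ≡⟨ +-comm N₂ b ⟩
      b + N₂                   ∎
      where open ≤-Reasoning
    q₁≤q₂ : q₁ ≤ q₂
    q₁≤q₂ = /-monoˡ-≤ (j * r) (*-monoˡ-≤ x (m≤m+n j₁ j))
    eq : t₁ + j * x ≡ t₂ + (q₂ ∸ q₁) * (j * r)
    eq = +-cancelʳ-≡ (q₁ * (j * r)) _ _ (begin
      t₁ + j * x + q₁ * (j * r)                       ≡⟨ lemma₁ t₁ (j * x) (q₁ * (j * r)) ⟩
      t₁ + q₁ * (j * r) + j * x                       ≡⟨ cong (_+ j * x) (sym (m≡m%n+[m/n]*n (j₁ * x) (j * r))) ⟩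
      j₁ * x + j * x                                  ≡⟨ sym (*-distribʳ-+ x j₁ j) ⟩
      (j₁ + j) * x                                    ≡⟨ m≡m%n+[m/n]*n ((j₁ + j) * x) (j * r) ⟩
      t₂ + q₂ * (j * r)                               ≡⟨ cong (λ q → t₂ + q * (j * r)) (sym (m∸n+n≡m q₁≤q₂)) ⟩
      t₂ + (q₂ ∸ q₁ + q₁) * (j * r)                   ≡⟨ cong (_+_ t₂) (*-distribʳ-+ (j * r) (q₂ ∸ q₁) q₁) ⟩
      t₂ + ((q₂ ∸ q₁) * (j * r) + q₁ * (j * r))       ≡⟨ sym (+-assoc t₂ _ _) ⟩
      t₂ + (q₂ ∸ q₁) * (j * r) + q₁ * (j * r)         ∎)
      where
      open ≡-Reasoning
      lemma₁ : ∀ a b c → a + b + c ≡ a + c + b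
      lemma₁ = solve-∀

-- The gap between power products modulo s^c

module SAdicGaps where

  open SiegelsLemma using (^-distribʳ-*; funToFin-cong)
  open NaturalBounds
  open AuxiliaryPolynomial
  open Products
  open import Data.Nat using (ℕ; zero; suc; z≤n; s≤s; _+_; _*_; _^_; _∸_; _≤_; _<_; NonZero; >-nonZero; _!)
  open import Data.Nat.Properties
  open import Data.Nat.DivMod hiding (result)
  import Data.Nat.Divisibility as ℕD
  open import Data.Nat.Coprimality using (Coprime; coprime-divisor)
  open import Data.Nat.Tactic.RingSolver using (solve-∀)
  open import Data.Fin as Fin using (Fin; toℕ; fromℕ<; funToFin; finToFun; combine)
  import Data.Fin.Properties as FinP
  open import Data.Integer as ℤ using (ℤ; +_; ∣_∣)
  import Data.Integer.Properties as ℤP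
  import Data.Integer.Divisibility.Signed as ℤD
  open import Data.Integer.Tactic.RingSolver using () renaming (solve-∀ to solveℤ-∀)

  ^-injectiveˡ : ∀ g → 1 ≤ g → ∀ {x y} → x ^ g ≡ y ^ g → x ≡ y
  ^-injectiveˡ g 1≤g {x} {y} e with <-cmp x y
  ... | tri< lt _ _ = contradiction e (<⇒≢ (^-monoˡ-< g {{>-nonZero 1≤g}} lt))
  ... | tri≈ _ eq _ = eq
  ... | tri> _ _ gt = contradiction (sym e) (<⇒≢ (^-monoˡ-< g {{>-nonZero 1≤g}} gt))

  -- The modulus N₁ is divisible by every possible distance d of two colliding multiples, so that
  -- r = N₁ / d is an integer and the exponents themselves, not multiples of them, get rounded.
  dirichlet : ∀ k Q Z (a b : Fin k → ℕ) → 1 ≤ Q → 1 ≤ Z →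
    ∃ λ J → 40 ≤ J × J ≤ 40 * Q * (((Q * Q) ^ k) !) ×
      (∀ i → Rounding (Z * J) Q (a i)) × (∀ i → Rounding (Z * J) Q (b i))
  dirichlet k Q Z a b 1≤Q 1≤Z = result (FinP.pigeonhole (n<1+n ((Q * Q) ^ k)) boxes)
    where
    P F N₁ N₂ : ℕ
    P = (Q * Q) ^ k
    F = P !
    N₂ = 40 * Z * F
    N₁ = Q * N₂
    1≤F : 1 ≤ F
    1≤F = 1≤n! P
    1≤N₂ : 1 ≤ N₂
    1≤N₂ = *-mono-≤ (*-mono-≤ (s≤s (z≤n {39})) 1≤Z) 1≤F
    instance
      N₂≢0 : NonZero N₂
      N₂≢0 = >-nonZero 1≤N₂
      N₁≢0 : NonZero N₁
      N₁≢0 = >-nonZero (*-mono-≤ 1≤Q 1≤N₂)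
    -- The residues modulo `N₁` are divided into Q intervals of length `N₂`.
    box : ℕ → Fin Q
    box t = fromℕ< {t % N₁ / N₂} (m<n*o⇒m/o<n (m%n<n t N₁))
    -- One pair of intervals for each index, so P = (Q Q)^k possibilities for the P + 1 multiples 0,
    -- ..., P.
    boxes : Fin (suc P) → Fin P
    boxes j = funToFin {k} {Q * Q} λ i → combine (box (toℕ j * a i)) (box (toℕ j * b i))
    Result = ∃ λ J → 40 ≤ J × J ≤ 40 * Q * F ×
      (∀ i → Rounding (Z * J) Q (a i)) × (∀ i → Rounding (Z * J) Q (b i))
    result : (∃ λ i → ∃ λ j → i Fin.< j × boxes i ≡ boxes j) → Result
    result (i , j , i<j , eq) = J , 40≤J , J≤ ,
      (λ l → make (a l) (proj₁ (split l))) , (λ l → make (b l) (proj₂ (split l)))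
      where
      d F′ J : ℕ
      d = toℕ j ∸ toℕ i
      1≤d : 1 ≤ d
      1≤d = m<n⇒0<n∸m i<j
      d≤P : d ≤ P
      d≤P = ≤-trans (m∸n≤m (toℕ j) (toℕ i)) (≤-pred (FinP.toℕ<n j))
      d∣F : d ℕD.∣ F
      d∣F = divides-factorial d P 1≤d d≤P
        where
        divides-factorial : ∀ d n → 1 ≤ d → d ≤ n → d ℕD.∣ n !
        divides-factorial (suc d) n _ d≤n = ℕD.∣-trans (ℕD.m∣m*n {suc d} (d !)) (ℕD.m≤n⇒m!∣n! d≤n)
      F′ = ℕD._∣_.quotient d∣F
      F≡ : F ≡ F′ * d
      F≡ = ℕD._∣_.equality d∣F
      -- The 40 is the lower bound that is demanded of J; with F′ = P! / d the product d Z J is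
      -- exactly `N₁`.
      J = 40 * Q * F′
      1≤F′ : 1 ≤ F′
      1≤F′ = positive F′ (≤-trans 1≤F (≤-reflexive F≡))
        where
        positive : ∀ m → 1 ≤ m * d → 1 ≤ m
        positive (suc m) _ = s≤s z≤n
      40≤J : 40 ≤ J
      40≤J = ≤-trans (≤-reflexive (sym (trans (*-identityʳ (40 * 1)) (*-identityʳ 40)))) (*-mono-≤ (*-monoʳ-≤ 40 1≤Q) 1≤F′)
      J≤ : J ≤ 40 * Q * F
      J≤ = *-monoʳ-≤ (40 * Q) (≤-trans (≤-trans (≤-reflexive (sym (*-identityʳ F′))) (*-monoʳ-≤ F′ 1≤d)) (≤-reflexive (sym F≡)))
      split : ∀ l → box (toℕ i * a l) ≡ box (toℕ j * a l) × box (toℕ i * b l) ≡ box (toℕ j * b l)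
      split l = FinP.combine-injective _ _ _ _ (trans (sym (FinP.finToFun-funToFin {k} {Q * Q} _ l))
        (trans (cong (λ z → finToFun {Q * Q} {k} z l) eq) (FinP.finToFun-funToFin {k} {Q * Q} _ l)))
      dr≡ : d * (Z * J) ≡ N₁
      dr≡ = trans (lemma d Z Q F′) (cong (λ f → Q * (40 * Z * f)) (sym F≡))
        where
        lemma : ∀ d Z Q F → d * (Z * (40 * Q * F)) ≡ Q * (40 * Z * (F * d))
        lemma = solve-∀
      make : ∀ x → box (toℕ i * x) ≡ box (toℕ j * x) → Rounding (Z * J) Q x
      make x e = rounding (Z * J) Q x d (toℕ i) N₂ {{N₂≢0}} {{dr≢0}} 1≤d 1≤Q dr≡
        (trans (cong (_/ N₂) (%-congʳ {m = d * (Z * J)} {n = N₁} {{dr≢0}} {{N₁≢0}} dr≡))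
          (trans same (cong (_/ N₂) (trans (cong (λ t → t * x % N₁) (sym (m+[n∸m]≡n (<⇒≤ i<j))))
            (sym (%-congʳ {m = d * (Z * J)} {n = N₁} {{dr≢0}} {{N₁≢0}} dr≡))))))
        where
        dr≢0 : NonZero (d * (Z * J))
        dr≢0 = subst NonZero (sym dr≡) N₁≢0
        same : toℕ i * x % N₁ / N₂ ≡ toℕ j * x % N₁ / N₂
        same = trans (sym (FinP.toℕ-fromℕ< _)) (trans (cong toℕ e) (FinP.toℕ-fromℕ< _))

  -- E, Z and Q are chosen so that the size conditions of Core hold for all large c.  The base g of the
  -- exponents costs a factor s^w in Z, which the third power of σ = s^w absorbs.
  module Uniform (s k : ℕ) (p : Fin k → ℕ) (D w g κ : ℕ) (2≤s : 2 ≤ s) (cop : ∀ i → Coprime s (p i))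
    (1≤w : 1 ≤ w) (1≤g : 1 ≤ g) (1≤κ : 1 ≤ κ) (Π≤ : ∏ p ≤ 2 ^ κ)
    (p^g≈1 : ∀ i → + (s ^ w) ℤD.∣ (+ p i) ℤ.^ g ℤ.- + 1)
    (σ-large : 16 * (40 * (g * (41 * κ * (8 * w * D + 1))) * (160 * (g * (41 * κ * (8 * w * D + 1)))) * (2 * 2)) ≤ (s ^ w) ^ 3)
    where

    E Z Q Jmax c₀ : ℕ
    E = 8 * w * D + 1
    Z = g * (41 * κ * E)
    Q = 40 * (Z * (κ * (g * 41)))
    Jmax = 40 * Q * (((Q * Q) ^ k) !)
    -- Large enough for k′ to be at least Z, which makes r at most K.
    c₀ = 4 * w * Jmax * Z

    1≤E : 1 ≤ E
    1≤E = m≤n+m 1 (8 * w * D)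

    1≤Z : 1 ≤ Z
    1≤Z = *-mono-≤ 1≤g (*-mono-≤ (*-mono-≤ (s≤s (z≤n {40})) 1≤κ) 1≤E)

    1≤Q : 1 ≤ Q
    1≤Q = *-mono-≤ (s≤s (z≤n {39})) (*-mono-≤ 1≤Z (*-mono-≤ 1≤κ (*-mono-≤ 1≤g (s≤s (z≤n {40})))))

    1≤p : ∀ i → 1 ≤ p i
    1≤p i = positive (p i) (cop i)
      where
      positive : ∀ m → Coprime s m → 1 ≤ m
      positive (suc m) _ = s≤s z≤n
      positive zero    c = contradiction (c (ℕD.∣-refl , s ℕD.∣0)) λ { refl → contradiction 2≤s λ { (s≤s ()) } }

    s≢0 : NonZero s
    s≢0 = >-nonZero (≤-trans (s≤s z≤n) 2≤s)

    1≤pow : ∀ {m} n → 1 ≤ m → 1 ≤ m ^ n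
    1≤pow {m} n h = m^n>0 m {{>-nonZero h}} n

    ^g-≈1 : ∀ (A : Fin k → ℕ) → Mod._≈_ (+ (s ^ w)) (+ ∏^ p (λ i → g * A i)) (+ 1)
    ^g-≈1 A = ∏-≈1 (+ (s ^ w)) _ λ i → subst₂ (Mod._≈_ (+ (s ^ w)))
      (trans (ℤP.^-*-assoc (+ p i) g (A i)) (sym (pos-^ (p i) (g * A i)))) (ℤP.^-zeroˡ (A i))
      (Mod.^-≈ (+ (s ^ w)) {(+ p i) ℤ.^ g} {+ 1} (A i) (p^g≈1 i))

    module Instance (c : ℕ) (c₀≤c : c₀ ≤ c) (a b : Fin k → ℕ) (a≤ : ∀ i → a i ≤ D * c) (b≤ : ∀ i → b i ≤ D * c)
      (divisible : + (s ^ c) ℤD.∣ + ∏^ p a ℤ.- + ∏^ p b)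
      (J : ℕ) (40≤J : 40 ≤ J) (J≤ : J ≤ Jmax)
      (ra : ∀ i → Rounding (Z * J) Q (a i)) (rb : ∀ i → Rounding (Z * J) Q (b i))
      where

      open Rounding

      r k′ K : ℕ
      r = Z * J

      1≤J : 1 ≤ J
      1≤J = ≤-trans (s≤s z≤n) 40≤J

      1≤r : 1 ≤ r
      1≤r = *-mono-≤ 1≤Z 1≤J

      instance
        4wJ≢0 : NonZero (4 * w * J)
        4wJ≢0 = >-nonZero (*-mono-≤ (*-mono-≤ (s≤s (z≤n {3})) 1≤w) 1≤J)
        r≢0 : NonZero r
        r≢0 = >-nonZero 1≤r
        Q≢0 : NonZero Q
        Q≢0 = >-nonZero 1≤Q
        E≢0 : NonZero E
        E≢0 = >-nonZero 1≤E

      -- As large as 4 w K ≤ c permits. This covers the precision 3 w K of σ^(3 K), and maximality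
      -- gives c ≤ 8 w K, so that exponents up to D c are O(K).
      k′ = c / (4 * w * J)
      K = J * k′

      Z≤k′ : Z ≤ k′
      Z≤k′ = ≤-trans (≤-reflexive (sym (m*n/n≡m Z (4 * w * J)))) (/-monoˡ-≤ (4 * w * J)
        (≤-trans (≤-reflexive (*-comm Z (4 * w * J))) (≤-trans (*-monoˡ-≤ Z (*-monoʳ-≤ (4 * w) J≤)) c₀≤c)))

      1≤k′ : 1 ≤ k′
      1≤k′ = ≤-trans 1≤Z Z≤k′

      r≤K : r ≤ K
      r≤K = ≤-trans (≤-reflexive (*-comm Z J)) (*-monoʳ-≤ J Z≤k′)

      4wK≤c : 4 * w * K ≤ c
      4wK≤c = ≤-trans (≤-reflexive (lemma w J k′)) (m/n*n≤m c (4 * w * J))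
        where
        lemma : ∀ w J k → 4 * w * (J * k) ≡ k * (4 * w * J)
        lemma = solve-∀

      c≤8wK : c ≤ 8 * w * K
      c≤8wK = begin
        c                                              ≡⟨ m≡m%n+[m/n]*n c (4 * w * J) ⟩
        c % (4 * w * J) + k′ * (4 * w * J)             ≤⟨ +-monoˡ-≤ _ (m%n≤n c (4 * w * J)) ⟩
        4 * w * J + k′ * (4 * w * J)                   ≤⟨ +-monoˡ-≤ _ (≤-trans (≤-reflexive (sym (*-identityˡ (4 * w * J)))) (*-monoˡ-≤ (4 * w * J) 1≤k′)) ⟩
        k′ * (4 * w * J) + k′ * (4 * w * J)            ≡⟨ lemma w J k′ ⟩
        8 * w * K                                      ∎
        where
        open ≤-Reasoning
        lemma : ∀ w J k → k * (4 * w * J) + k * (4 * w * J) ≡ 8 * w * (J * k)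
        lemma = solve-∀

      γ₁ γ₂ ρ₁ ρ₂ ω X 𝔸 R Γ : ℕ
      γ₁ = ∏^ p (λ i → g * quot (ra i))
      γ₂ = ∏^ p (λ i → g * quot (rb i))
      ρ₁ = ∏^ p (λ i → g * (over (ra i) + under (rb i)))
      ρ₂ = ∏^ p (λ i → g * (under (ra i) + over (rb i)))
      -- The negative rounding errors of both products: multiplying both sides by them keeps all
      -- exponents natural.
      ω = ∏^ p (λ i → g * (under (ra i) + under (rb i)))
      X = (r + r) / Q
      𝔸 = (D * c + r) / r
      R = ∏ p ^ (g * X)
      Γ = ∏ p ^ (g * 𝔸)

      1≤∏^ : ∀ (e : Fin k → ℕ) → 1 ≤ ∏^ p e
      1≤∏^ e = 1≤∏ λ i → 1≤pow (e i) (1≤p i)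

      divide : ∀ {x y m} .{{_ : NonZero m}} → m * x ≤ y → x ≤ y / m
      divide {x} {y} {m} h = ≤-trans (≤-reflexive (sym (m*n/n≡m x m))) (/-monoˡ-≤ m (≤-trans (≤-reflexive (*-comm x m)) h))

      exponent-ρ : ∀ x y → Q * x ≤ r → Q * y ≤ r → x + y ≤ X
      exponent-ρ x y hx hy = divide (≤-trans (≤-reflexive (*-distribˡ-+ Q x y)) (+-mono-≤ hx hy))

      ρ₁≤R : ρ₁ ≤ R
      ρ₁≤R = ∏^-bound p _ (g * X) 1≤p λ i → *-monoʳ-≤ g (exponent-ρ (over (ra i)) (under (rb i)) (over≤ (ra i)) (under≤ (rb i)))

      ρ₂≤R : ρ₂ ≤ R
      ρ₂≤R = ∏^-bound p _ (g * X) 1≤p λ i → *-monoʳ-≤ g (exponent-ρ (under (ra i)) (over (rb i)) (under≤ (ra i)) (over≤ (rb i)))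

      γ₁≤Γ : γ₁ ≤ Γ
      γ₁≤Γ = ∏^-bound p _ (g * 𝔸) 1≤p λ i → *-monoʳ-≤ g (divide (≤-trans (quot≤ (ra i)) (+-monoˡ-≤ r (a≤ i))))

      γ₂≤Γ : γ₂ ≤ Γ
      γ₂≤Γ = ∏^-bound p _ (g * 𝔸) 1≤p λ i → *-monoʳ-≤ g (divide (≤-trans (quot≤ (rb i)) (+-monoˡ-≤ r (b≤ i))))

      power-small : ∀ e m → κ * (e * m) ≤ K → (∏ p ^ e) ^ m ≤ 2 ^ K
      power-small e m h = begin
        (∏ p ^ e) ^ m         ≡⟨ ^-*-assoc (∏ p) e m ⟩
        ∏ p ^ (e * m)         ≤⟨ ^-monoˡ-≤ (e * m) Π≤ ⟩
        (2 ^ κ) ^ (e * m)     ≡⟨ ^-*-assoc 2 κ (e * m) ⟩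
        2 ^ (κ * (e * m))     ≤⟨ ^-monoʳ-≤ 2 h ⟩
        2 ^ K                 ∎
        where open ≤-Reasoning

      -- The exponents in ρ₁ and ρ₂ are at most g (2 r / Q). Of the factors of Q, the part 2 Z turns
      -- 2 r into J, and 20 κ g 41 pays for g, for the power 41 * 20 k′ and for the size 2^κ of the
      -- product of the bases.
      R-small : R ^ (41 * (20 * k′)) ≤ 2 ^ K
      R-small = power-small (g * X) (41 * (20 * k′)) (≤-trans (≤-reflexive (lemma₁ κ g X k′)) (*-monoˡ-≤ k′ X≤))
        where
        open ≤-Reasoning
        lemma₁ : ∀ κ g X k → κ * (g * X * (41 * (20 * k))) ≡ 20 * (κ * (g * 41)) * X * k
        lemma₁ = solve-∀
        lemma₂ : ∀ Z y X → 2 * Z * (20 * y * X) ≡ X * (40 * (Z * y))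
        lemma₂ = solve-∀
        lemma₃ : ∀ Z J → Z * J + Z * J ≡ 2 * Z * J
        lemma₃ = solve-∀
        X≤ : 20 * (κ * (g * 41)) * X ≤ J
        X≤ = *-cancelˡ-≤ (2 * Z) {{>-nonZero (*-mono-≤ (s≤s (z≤n {1})) 1≤Z)}} (begin
          2 * Z * (20 * (κ * (g * 41)) * X)   ≡⟨ lemma₂ Z (κ * (g * 41)) X ⟩
          X * Q                               ≤⟨ m/n*n≤m (r + r) Q ⟩
          r + r                               ≡⟨ lemma₃ Z J ⟩
          2 * Z * J                           ∎)

      -- The exponents in γ₁ and γ₂ are at most g (D c + r) / r. As r = Z J, the J cancels the one
      -- in 41 J and the part 41 κ g of Z pays for the other factors. What is left is (D c + r) / E,
      -- at most K by the choice of E.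
      Γ-small : Γ ^ (41 * J) ≤ 2 ^ K
      Γ-small = power-small (g * 𝔸) (41 * J) (*-cancelˡ-≤ E (begin
        E * (κ * (g * 𝔸 * (41 * J)))       ≡⟨ lemma₁ E κ g 𝔸 J ⟩
        𝔸 * (g * (41 * κ * E) * J)         ≤⟨ m/n*n≤m (D * c + r) r ⟩
        D * c + r                          ≤⟨ +-mono-≤ (*-monoʳ-≤ D c≤8wK) r≤K ⟩
        D * (8 * w * K) + K                ≡⟨ lemma₂ D w K ⟩
        E * K                              ∎))
        where
        open ≤-Reasoning
        lemma₁ : ∀ E κ g A J → E * (κ * (g * A * (41 * J))) ≡ A * (g * (41 * κ * E) * J)
        lemma₁ = solve-∀
        lemma₂ : ∀ D w K → D * (8 * w * K) + K ≡ (8 * w * D + 1) * K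
        lemma₂ = solve-∀

      factored : ∀ (q o x y z : Fin k → ℕ) → (∀ i → x i + y i ≡ r * q i + o i) →
        ∏^ p (λ i → g * q i) ^ r * ∏^ p (λ i → g * (o i + z i)) ≡ ∏^ p x ^ g * ∏^ p (λ i → g * (y i + z i))
      factored q o x y z e = begin
        ∏^ p (λ i → g * q i) ^ r * ∏^ p (λ i → g * (o i + z i))
          ≡⟨ cong (_* ∏^ p (λ i → g * (o i + z i))) (sym (∏^-* r p (λ i → g * q i))) ⟩
        ∏^ p (λ i → g * q i * r) * ∏^ p (λ i → g * (o i + z i))
          ≡⟨ sym (∏^-+ p (λ i → g * q i * r) (λ i → g * (o i + z i))) ⟩
        ∏^ p (λ i → g * q i * r + g * (o i + z i))
          ≡⟨ ∏-cong (λ i → cong (p i ^_) (exponents i)) ⟩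
        ∏^ p (λ i → x i * g + g * (y i + z i))
          ≡⟨ ∏^-+ p (λ i → x i * g) (λ i → g * (y i + z i)) ⟩
        ∏^ p (λ i → x i * g) * ∏^ p (λ i → g * (y i + z i))
          ≡⟨ cong (_* ∏^ p (λ i → g * (y i + z i))) (∏^-* g p x) ⟩
        ∏^ p x ^ g * ∏^ p (λ i → g * (y i + z i)) ∎
        where
        open ≡-Reasoning
        lemma₁ : ∀ g q r o z → g * q * r + g * (o + z) ≡ g * (r * q + o) + g * z
        lemma₁ = solve-∀
        lemma₂ : ∀ g x y z → g * (x + y) + g * z ≡ x * g + g * (y + z)
        lemma₂ = solve-∀
        exponents : ∀ i → g * q i * r + g * (o i + z i) ≡ x i * g + g * (y i + z i)
        exponents i = trans (lemma₁ g (q i) r (o i) (z i)) (trans (cong (λ t → g * t + g * z i) (sym (e i))) (lemma₂ g (x i) (y i) (z i)))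

      left : γ₁ ^ r * ρ₁ ≡ ∏^ p a ^ g * ω
      left = factored _ _ a _ (λ i → under (rb i)) (λ i → equation (ra i))

      right : γ₂ ^ r * ρ₂ ≡ ∏^ p b ^ g * ω
      right = trans (cong (γ₂ ^ r *_) (∏-cong λ i → cong (λ e → p i ^ (g * e)) (+-comm (under (ra i)) (over (rb i)))))
        (trans (factored _ _ b _ (λ i → under (ra i)) (λ i → equation (rb i)))
          (cong (∏^ p b ^ g *_) (∏-cong λ i → cong (λ e → p i ^ (g * e)) (+-comm (under (rb i)) (under (ra i))))))

      congruent : + (s ^ c) ℤD.∣ + (γ₁ ^ r * ρ₁) ℤ.- + (γ₂ ^ r * ρ₂)
      congruent = subst₂ (λ x y → + (s ^ c) ℤD.∣ x ℤ.- y) (cast (∏^ p a) (sym left)) (cast (∏^ p b) (sym right))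
        (Mod.*-≈ (+ (s ^ c)) {(+ ∏^ p a) ℤ.^ g} {(+ ∏^ p b) ℤ.^ g} (Mod.^-≈ (+ (s ^ c)) {+ ∏^ p a} {+ ∏^ p b} g divisible) (Mod.≈-refl (+ (s ^ c)) (+ ω)))
        where
        cast : ∀ x {y} → x ^ g * ω ≡ y → (+ x) ℤ.^ g ℤ.* + ω ≡ + y
        cast x e = trans (cong (ℤ._* + ω) (sym (pos-^ x g))) (trans (sym (ℤP.pos-* (x ^ g) ω)) (cong +_ e))

      -- Equal γ are prime to s and cancel, leaving a congruence of ρ₁ and ρ₂ modulo s^c. Both are
      -- below s^c, so they are equal, and g-th powers of natural numbers determine their roots.
      γ-equal⇒equal : γ₁ ≡ γ₂ → ∏^ p a ≡ ∏^ p b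
      γ-equal⇒equal e = ^-injectiveˡ g 1≤g (*-cancelʳ-≡ _ _ ω {{>-nonZero (1≤∏^ (λ i → g * (under (ra i) + under (rb i))))}} (trans (sym left) (trans (cong₂ _*_ (cong (_^ r) e) ρ-equal) right)))
        where
        K<c : K < c
        K<c = <-≤-trans (≤-<-trans (≤-reflexive (sym (*-identityˡ K))) (*-monoˡ-< K {{>-nonZero (*-mono-≤ 1≤J 1≤k′)}} (≤-trans (m≤m+n 2 2) (*-monoʳ-≤ 4 1≤w)))) 4wK≤c
        R<s^c : R < s ^ c
        R<s^c = begin-strict
          R                        ≡⟨ sym (^-identityʳ R) ⟩
          R ^ 1                    ≤⟨ ^-monoʳ-≤ R {{>-nonZero (1≤pow (g * X) (1≤∏ 1≤p))}} (*-mono-≤ (s≤s (z≤n {40})) (*-mono-≤ (s≤s (z≤n {19})) 1≤k′)) ⟩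
          R ^ (41 * (20 * k′))     ≤⟨ R-small ⟩
          2 ^ K                    <⟨ ^-monoʳ-< 2 (s≤s (s≤s z≤n)) K<c ⟩
          2 ^ c                    ≤⟨ ^-monoˡ-≤ c 2≤s ⟩
          s ^ c                    ∎
          where open ≤-Reasoning
        cancelled : + (s ^ c) ℤD.∣ + ρ₁ ℤ.- + ρ₂
        cancelled = ℤD.∣ᵤ⇒∣ (coprime-divisor (coprime-^ˡ c (coprime-^ʳ r (coprime-∏ λ i → coprime-^ʳ (g * quot (ra i)) (cop i))))
          (subst (s ^ c ℕD.∣_) (ℤP.abs-* (+ (γ₁ ^ r)) (+ ρ₁ ℤ.- + ρ₂)) (ℤD.∣⇒∣ᵤ (subst (+ (s ^ c) ℤD.∣_) factor congruent))))
          where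
          factor : + (γ₁ ^ r * ρ₁) ℤ.- + (γ₂ ^ r * ρ₂) ≡ + (γ₁ ^ r) ℤ.* (+ ρ₁ ℤ.- + ρ₂)
          factor = trans (cong (λ γ → + (γ₁ ^ r * ρ₁) ℤ.- + (γ ^ r * ρ₂)) (sym e))
            (trans (cong₂ ℤ._-_ (ℤP.pos-* (γ₁ ^ r) ρ₁) (ℤP.pos-* (γ₁ ^ r) ρ₂)) (lemma (+ (γ₁ ^ r)) (+ ρ₁) (+ ρ₂)))
            where
            lemma : ∀ x y z → x ℤ.* y ℤ.- x ℤ.* z ≡ x ℤ.* (y ℤ.- z)
            lemma = solveℤ-∀
        ρ-equal : ρ₁ ≡ ρ₂
        ρ-equal = small-difference (s ^ c) ρ₁ ρ₂ (≤-<-trans ρ₁≤R R<s^c) (≤-<-trans ρ₂≤R R<s^c) cancelled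

      γ-equal : ¬ (γ₁ ≢ γ₂)
      γ-equal γ₁≢γ₂ = Core.absurd (s ^ w) Z J k′ ρ₁ ρ₂ γ₁ γ₂ R Γ 1≤Z 40≤J 1≤k′
        (1≤∏^ (λ i → g * (over (ra i) + under (rb i)))) (1≤∏^ (λ i → g * (under (ra i) + over (rb i))))
        (1≤∏^ (λ i → g * quot (ra i))) (1≤∏^ (λ i → g * quot (rb i))) ρ₁≤R ρ₂≤R γ₁≤Γ γ₂≤Γ R-small Γ-small σ-large
        (coprime-^ˡ w (coprime-∏ λ i → coprime-^ʳ (g * quot (ra i)) (cop i)))
        close relation γ₁≢γ₂
        where
        -- Multiplying the exponents by g has made both γ congruent to 1 modulo σ.
        close : + (s ^ w) ℤD.∣ + γ₂ ℤ.- + γ₁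
        close = subst (+ (s ^ w) ℤD.∣_) (lemma (+ γ₂) (+ γ₁)) (ℤD.∣m∣n⇒∣m-n (^g-≈1 (λ i → quot (rb i))) (^g-≈1 (λ i → quot (ra i))))
          where
          lemma : ∀ x y → (x ℤ.- + 1) ℤ.- (y ℤ.- + 1) ≡ x ℤ.- y
          lemma = solveℤ-∀
        cast : ∀ γ ρ → + (γ ^ r * ρ) ≡ (+ γ) ℤ.^ r ℤ.* + ρ
        cast γ ρ = trans (ℤP.pos-* (γ ^ r) ρ) (cong (ℤ._* + ρ) (pos-^ γ r))
        precision : s ^ (w * (3 * K)) ℕD.∣ s ^ c
        precision = subst (s ^ (w * (3 * K)) ℕD.∣_) (trans (sym (^-distribˡ-+-* s (w * (3 * K)) (c ∸ w * (3 * K)))) (cong (s ^_) (m+[n∸m]≡n w3K≤c)))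
          (ℕD.m∣m*n (s ^ (c ∸ w * (3 * K))))
          where
          lemma : ∀ w K → w * (3 * K) + w * K ≡ 4 * w * K
          lemma = solve-∀
          w3K≤c : w * (3 * K) ≤ c
          w3K≤c = ≤-trans (≤-trans (m≤m+n (w * (3 * K)) (w * K)) (≤-reflexive (lemma w K))) 4wK≤c
        relation : (+ (s ^ w)) ℤ.^ (3 * K) ℤD.∣ (+ γ₁) ℤ.^ r ℤ.* + ρ₁ ℤ.- (+ γ₂) ℤ.^ r ℤ.* + ρ₂
        relation = subst₂ ℤD._∣_ (trans (cong +_ (sym (^-*-assoc s w (3 * K)))) (pos-^ (s ^ w) (3 * K)))
          (cong₂ ℤ._-_ (cast γ₁ ρ₁) (cast γ₂ ρ₂)) (ℤD.∣-trans (ℤD.∣ᵤ⇒∣ precision) congruent)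

      equal : ∏^ p a ≡ ∏^ p b
      equal = γ-equal⇒equal (decidable-stable (γ₁ ≟ γ₂) γ-equal)

    uniform : ∀ c → c₀ ≤ c → (a b : Fin k → ℕ) → (∀ i → a i ≤ D * c) → (∀ i → b i ≤ D * c) →
      + (s ^ c) ℤD.∣ + ∏^ p a ℤ.- + ∏^ p b → ∏^ p a ≡ ∏^ p b
    uniform c c₀≤c a b a≤ b≤ divisible =
      let (J , 40≤J , J≤ , ra , rb) = dirichlet k Q Z a b 1≤Q 1≤Z
      in Instance.equal c c₀≤c a b a≤ b≤ divisible J 40≤J J≤ ra rb

  -- The number Z = u t x E contains t = s^w and enters twice. Of t^3 one factor t remains, and it
  -- has to beat only a constant times E^2, which is quadratic in w.
  cube-bound : ∀ c₁ c₂ c₃ c₄ u t x E → c₁ * (c₂ * c₃ * c₄) * (u * x * (u * x)) * (E * E) ≤ t →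
    c₁ * (c₂ * (u * t * (x * E)) * (c₃ * (u * t * (x * E))) * c₄) ≤ t ^ 3
  cube-bound c₁ c₂ c₃ c₄ u t x E h = begin
    c₁ * (c₂ * (u * t * (x * E)) * (c₃ * (u * t * (x * E))) * c₄)       ≡⟨ lemma c₁ c₂ c₃ c₄ u t x E ⟩
    t * (t * (c₁ * (c₂ * c₃ * c₄) * (u * x * (u * x)) * (E * E)))       ≤⟨ *-monoʳ-≤ t (*-monoʳ-≤ t h) ⟩
    t * (t * t)                                                         ≡⟨ cong (λ z → t * (t * z)) (sym (*-identityʳ t)) ⟩
    t ^ 3                                                               ∎
    where
    open ≤-Reasoning
    lemma : ∀ c₁ c₂ c₃ c₄ u t x E → c₁ * (c₂ * (u * t * (x * E)) * (c₃ * (u * t * (x * E))) * c₄)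
      ≡ t * (t * (c₁ * (c₂ * c₃ * c₄) * (u * x * (u * x)) * (E * E)))
    lemma = solve-∀

  quadratic-vs-exponential : ∀ s C D → 2 ≤ s → ∃ λ w → 1 ≤ w × C * ((8 * w * D + 1) * (8 * w * D + 1)) ≤ s ^ w
  quadratic-vs-exponential s C D 2≤s = w , s≤s z≤n , (begin
      C * ((8 * w * D + 1) * (8 * w * D + 1))   ≤⟨ *-monoʳ-≤ C (*-mono-≤ E≤ E≤) ⟩
      C * (f * (4 * v) * (f * (4 * v)))         ≡⟨ lemma₁ C f v ⟩
      16 * (C * (f * f)) * (v * v)              ≤⟨ *-mono-≤ 16≤ (*-mono-≤ (<⇒≤ (n<2^n v)) (<⇒≤ (n<2^n v))) ⟩
      2 ^ (2 * v) * (2 ^ v * 2 ^ v)             ≡⟨ trans (cong (2 ^ (2 * v) *_) (sym (^-distribˡ-+-* 2 v v))) (sym (^-distribˡ-+-* 2 (2 * v) (v + v))) ⟩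
      2 ^ (2 * v + (v + v))                     ≡⟨ cong (2 ^_) (lemma₂ v) ⟩
      2 ^ w                                     ≤⟨ ^-monoˡ-≤ w 2≤s ⟩
      s ^ w                                     ∎)
    where
    open ≤-Reasoning
    f v w : ℕ
    f = 8 * D + 1
    v = suc (8 * (C * (f * f)))
    w = 4 * v
    E≤ : 8 * w * D + 1 ≤ f * w
    E≤ = ≤-trans (+-monoʳ-≤ (8 * w * D) (s≤s z≤n)) (≤-reflexive (lemma w D))
      where
      lemma : ∀ w D → 8 * w * D + w ≡ (8 * D + 1) * w
      lemma = solve-∀
    lemma₁ : ∀ A f v → A * (f * (4 * v) * (f * (4 * v))) ≡ 16 * (A * (f * f)) * (v * v)
    lemma₁ = solve-∀
    lemma₂ : ∀ v → 2 * v + (v + v) ≡ 4 * v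
    lemma₂ = solve-∀
    lemma₃ : ∀ x → 2 * (8 * x) ≡ 16 * x
    lemma₃ = solve-∀
    16≤ : 16 * (C * (f * f)) ≤ 2 ^ (2 * v)
    16≤ = ≤-trans (≤-reflexive (sym (lemma₃ (C * (f * f))))) (≤-trans (*-monoʳ-≤ 2 (n≤1+n (8 * (C * (f * f))))) (<⇒≤ (n<2^n (2 * v))))

  SAdicGap : ∀ s k → (Fin k → ℕ) → ℕ → Set
  SAdicGap s k p D = ∃ λ c₀ → ∀ c → c₀ ≤ c → (a b : Fin k → ℕ) → (∀ i → a i ≤ D * c) → (∀ i → b i ≤ D * c) →
    + (s ^ c) ℤD.∣ + ∏^ p a ℤ.- + ∏^ p b → ∏^ p a ≡ ∏^ p b

  s-adic-gap-from : ∀ s k (p : Fin k → ℕ) D w κ → 2 ≤ s → (∀ i → Coprime s (p i)) → 1 ≤ w → 1 ≤ κ → ∏ p ≤ 2 ^ κ →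
    16 * (40 * 160 * (2 * 2)) * (s ! * (41 * κ) * (s ! * (41 * κ))) * ((8 * w * D + 1) * (8 * w * D + 1)) ≤ s ^ w →
    SAdicGap s k p D
  s-adic-gap-from s k p D w κ 2≤s cop 1≤w 1≤κ Π≤ growth =
    _ , Uniform.uniform s k p D w (s ! * s ^ w) κ 2≤s cop 1≤w
      (*-mono-≤ (1≤n! s) (m^n>0 s {{>-nonZero (≤-trans (s≤s z≤n) 2≤s)}} w)) 1≤κ Π≤
      (λ i → Order.exponent s 2≤s w (p i) (cop i))
      (cube-bound 16 40 160 (2 * 2) (s !) (s ^ w) (41 * κ) (8 * w * D + 1) growth)

  -- An effective lower bound for s-adic linear forms in logarithms that is linear in the exponents.
  s-adic-gap : ∀ s k (p : Fin k → ℕ) D → 2 ≤ s → (∀ i → Coprime s (p i)) → SAdicGap s k p D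
  s-adic-gap s k p D 2≤s cop =
    let (w , 1≤w , growth) = quadratic-vs-exponential s (16 * (40 * 160 * (2 * 2)) * (s ! * (41 * suc (∏ p)) * (s ! * (41 * suc (∏ p))))) D 2≤s
    in s-adic-gap-from s k p D w (suc (∏ p)) 2≤s cop 1≤w (s≤s z≤n)
         (≤-trans (<⇒≤ (n<2^n (∏ p))) (^-monoʳ-≤ 2 (n≤1+n (∏ p)))) growth

-- Operators on the Hamming graph and perfect codes

module HammingOperators where

  open PolynomialFunctions
  open HermiteInterpolation using (*-cancel-0; *-≢0)
  open AuxiliaryPolynomial using (pos-^)
  open import Data.Nat as ℕ using (ℕ; zero; suc; z≤n; s≤s; _<_; _≤_; _∸_)
  import Data.Nat.Properties as ℕP
  open import Data.Nat.Combinatorics using (_C_; nC1≡n; nCk+nC[k+1]≡[n+1]C[k+1])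
  open import Data.Bool using (Bool; true; false; if_then_else_)
  open import Data.Fin as Fin using (Fin)
  import Data.Fin.Properties as FinP
  open import Data.Vec.Properties using (≡-dec)
  open import Data.Integer as ℤ using (ℤ; +_; _+_; _*_; _-_; -_; _^_; 0ℤ; 1ℤ; -1ℤ; ∣_∣)
  open import Data.Integer.Properties
  open import Data.Integer.Divisibility.Signed
  open import Data.Integer.Tactic.RingSolver using (solve-∀)
  open import Data.List.Relation.Unary.Any using (here; there)
  open import Data.List.Relation.Unary.All as All using (All; []; _∷_)
  open import Data.List.Relation.Unary.AllPairs using ([]; _∷_)
  open import Data.List.Relation.Unary.Unique.Propositional using (Unique)
  open import Data.Nat.Tactic.RingSolver using () renaming (solve-∀ to solveℕ-∀)

  sumF : ∀ {m} → (Fin m → ℤ) → ℤ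
  sumF {zero}  f = 0ℤ
  sumF {suc m} f = f Fin.zero + sumF (λ i → f (Fin.suc i))

  sumF-cong : ∀ {m} {f g : Fin m → ℤ} → (∀ i → f i ≡ g i) → sumF f ≡ sumF g
  sumF-cong {zero}  h = refl
  sumF-cong {suc m} h = cong₂ _+_ (h Fin.zero) (sumF-cong λ i → h (Fin.suc i))

  interchange : ∀ a b c d → (a + b) + (c + d) ≡ (a + c) + (b + d)
  interchange = solve-∀

  sumF-+ : ∀ {m} (f g : Fin m → ℤ) → sumF (λ i → f i + g i) ≡ sumF f + sumF g
  sumF-+ {zero}  f g = refl
  sumF-+ {suc m} f g = trans (cong (_+_ (f Fin.zero + g Fin.zero)) (sumF-+ (λ i → f (Fin.suc i)) (λ i → g (Fin.suc i))))
    (interchange (f Fin.zero) (g Fin.zero) _ _)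

  sumF-* : ∀ {m} c (f : Fin m → ℤ) → sumF (λ i → c * f i) ≡ c * sumF f
  sumF-* {zero}  c f = sym (*-zeroʳ c)
  sumF-* {suc m} c f = trans (cong (_+_ (c * f Fin.zero)) (sumF-* c (λ i → f (Fin.suc i)))) (sym (*-distribˡ-+ c (f Fin.zero) _))

  sumF-const : ∀ m c → sumF {m} (λ _ → c) ≡ + m * c
  sumF-const zero    c = refl
  sumF-const (suc m) c = trans (cong (_+_ c) (sumF-const m c)) (sym (suc-* (+ m) c))

  sumF-if : ∀ {m} (c : Fin m) (h : Bool → ℤ) → sumF (λ b → h (does (c FinP.≟ b))) ≡ h true + (+ m - 1ℤ) * h false
  sumF-if {suc m} Fin.zero h = cong (_+_ (h true)) (trans (sumF-const m (h false)) (cong (_* h false) (lemma (+ m))))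
    where
    lemma : ∀ x → x ≡ 1ℤ + x - 1ℤ
    lemma = solve-∀
  sumF-if {suc m} (Fin.suc c) h = trans (cong (_+_ (h false)) (sumF-if c h)) (lemma (h true) (h false) (+ m))
    where
    lemma : ∀ t f x → f + (t + (x - 1ℤ) * f) ≡ t + (1ℤ + x - 1ℤ) * f
    lemma = solve-∀

  sumF-≥0 : ∀ {m} (f : Fin m → ℤ) → (∀ i → 0ℤ ℤ.≤ f i) → 0ℤ ℤ.≤ sumF f
  sumF-≥0 {zero}  f h = ≤-refl
  sumF-≥0 {suc m} f h = +-mono-≤ (h Fin.zero) (sumF-≥0 (λ i → f (Fin.suc i)) λ i → h (Fin.suc i))

  +-zero-split : ∀ {a b} → 0ℤ ℤ.≤ a → 0ℤ ℤ.≤ b → a + b ≡ 0ℤ → a ≡ 0ℤ × b ≡ 0ℤ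
  +-zero-split {+ zero}  {+ zero}  _ _ e = refl , refl

  sumF-≡0 : ∀ {m} (f : Fin m → ℤ) → (∀ i → 0ℤ ℤ.≤ f i) → sumF f ≡ 0ℤ → ∀ i → f i ≡ 0ℤ
  sumF-≡0 {suc m} f h e Fin.zero    = proj₁ (+-zero-split (h Fin.zero) (sumF-≥0 _ λ i → h (Fin.suc i)) e)
  sumF-≡0 {suc m} f h e (Fin.suc i) = sumF-≡0 (λ i → f (Fin.suc i)) (λ i → h (Fin.suc i))
    (proj₂ (+-zero-split (h Fin.zero) (sumF-≥0 _ λ i → h (Fin.suc i)) e)) i

  ∑L : ∀ {A : Set} → List A → (A → ℤ) → ℤ
  ∑L []       f = 0ℤ
  ∑L (x ∷ xs) f = f x + ∑L xs f

  ∑L-cong : ∀ {A : Set} (xs : List A) {f g : A → ℤ} → (∀ x → x ∈ xs → f x ≡ g x) → ∑L xs f ≡ ∑L xs g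
  ∑L-cong []       h = refl
  ∑L-cong (x ∷ xs) h = cong₂ _+_ (h x (here refl)) (∑L-cong xs λ y y∈ → h y (there y∈))

  ∑L-+ : ∀ {A : Set} (xs : List A) (f g : A → ℤ) → ∑L xs (λ x → f x + g x) ≡ ∑L xs f + ∑L xs g
  ∑L-+ []       f g = refl
  ∑L-+ (x ∷ xs) f g = trans (cong (_+_ (f x + g x)) (∑L-+ xs f g)) (interchange (f x) (g x) _ _)

  ∑L-* : ∀ {A : Set} c (xs : List A) (f : A → ℤ) → ∑L xs (λ x → c * f x) ≡ c * ∑L xs f
  ∑L-* c []       f = sym (*-zeroʳ c)
  ∑L-* c (x ∷ xs) f = trans (cong (_+_ (c * f x)) (∑L-* c xs f)) (sym (*-distribˡ-+ c (f x) _))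

  ∑L-const : ∀ {A : Set} (xs : List A) c → ∑L xs (λ _ → c) ≡ + length xs * c
  ∑L-const []       c = refl
  ∑L-const (x ∷ xs) c = trans (cong (_+_ c) (∑L-const xs c)) (sym (suc-* (+ length xs) c))

  ∑L-zero : ∀ {A : Set} (xs : List A) {f : A → ℤ} → (∀ x → x ∈ xs → f x ≡ 0ℤ) → ∑L xs f ≡ 0ℤ
  ∑L-zero xs h = trans (∑L-cong xs h) (trans (∑L-const xs 0ℤ) (*-zeroʳ (+ length xs)))

  module Operators (q : ℕ) where

    Fun : ℕ → Set
    Fun n = Word q n → ℤ

    marginal : ∀ {n} → Fun (suc n) → Fun n
    marginal f y = sumF (λ b → f (b ∷ y))

    -- q times the component of `f` that sums to zero along the first coordinate; the factor q keeps
    -- it integral.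
    residual : ∀ {n} → Fin q → Fun (suc n) → Fun n
    residual a f y = + q * f (a ∷ y) - marginal f y

    -- The adjacency operator of the Hamming graph plus n: each coordinate contributes its whole
    -- line, the word itself included. The shift makes all eigenvalues multiples of q.
    S : ∀ {n} → Fun n → Fun n
    S {zero}  f []      = 0ℤ
    S {suc n} f (a ∷ y) = marginal f y + S (λ y → f (a ∷ y)) y

    -- q^n times the projection onto the eigenspace of S with eigenvalue q (n - x).
    proj : ∀ {n} → ℕ → Fun n → Fun n
    proj {zero}  zero    f []      = f []
    proj {zero}  (suc x) f []      = 0ℤ
    proj {suc n} zero    f (a ∷ y) = proj 0 (marginal f) y
    proj {suc n} (suc x) f (a ∷ y) = proj (suc x) (marginal f) y + proj x (residual a f) y

    eigenvalue : ℕ → ℕ → ℤ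
    eigenvalue n x = + q * (+ n - + x)

    marginal-cong : ∀ {n} {f g : Fun (suc n)} → (∀ y → f y ≡ g y) → ∀ y → marginal f y ≡ marginal g y
    marginal-cong h y = sumF-cong λ b → h (b ∷ y)

    residual-cong : ∀ {n} a {f g : Fun (suc n)} → (∀ y → f y ≡ g y) → ∀ y → residual a f y ≡ residual a g y
    residual-cong a h y = cong₂ (λ u v → + q * u - v) (h (a ∷ y)) (marginal-cong h y)

    S-cong : ∀ {n} {f g : Fun n} → (∀ y → f y ≡ g y) → ∀ y → S f y ≡ S g y
    S-cong {zero}  h []      = refl
    S-cong {suc n} h (a ∷ y) = cong₂ _+_ (marginal-cong h y) (S-cong (λ y → h (a ∷ y)) y)

    S-+ : ∀ {n} (f g : Fun n) y → S (λ y → f y + g y) y ≡ S f y + S g y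
    S-+ {zero}  f g []      = refl
    S-+ {suc n} f g (a ∷ y) = trans (cong₂ _+_ (sumF-+ (λ b → f (b ∷ y)) (λ b → g (b ∷ y))) (S-+ (λ y → f (a ∷ y)) (λ y → g (a ∷ y)) y))
      (interchange (marginal f y) (marginal g y) _ _)

    S-* : ∀ {n} c (f : Fun n) y → S (λ y → c * f y) y ≡ c * S f y
    S-* {zero}  c f []      = sym (*-zeroʳ c)
    S-* {suc n} c f (a ∷ y) = trans (cong₂ _+_ (sumF-* c (λ b → f (b ∷ y))) (S-* c (λ y → f (a ∷ y)) y))
      (sym (*-distribˡ-+ c (marginal f y) _))

    S-0 : ∀ {n} (y : Word q n) → S (λ _ → 0ℤ) y ≡ 0ℤ
    S-0 y = S-* 0ℤ (λ _ → 0ℤ) y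

    S-sumF : ∀ {n m} (f : Fin m → Fun n) y → S (λ y → sumF (λ b → f b y)) y ≡ sumF (λ b → S (f b) y)
    S-sumF {m = zero}  f y = S-0 y
    S-sumF {m = suc m} f y = trans (S-+ (f Fin.zero) _ y) (cong (_+_ (S (f Fin.zero) y)) (S-sumF (λ b → f (Fin.suc b)) y))

    S-∑L : ∀ {n} {A : Set} (xs : List A) (f : A → Fun n) y → S (λ y → ∑L xs (λ c → f c y)) y ≡ ∑L xs (λ c → S (f c) y)
    S-∑L []       f y = S-0 y
    S-∑L (x ∷ xs) f y = trans (S-+ (f x) _ y) (cong (_+_ (S (f x) y)) (S-∑L xs f y))

    proj-cong : ∀ {n} x {f g : Fun n} → (∀ y → f y ≡ g y) → ∀ y → proj x f y ≡ proj x g y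
    proj-cong {zero}  zero    h []      = h []
    proj-cong {zero}  (suc x) h []      = refl
    proj-cong {suc n} zero    h (a ∷ y) = proj-cong 0 (marginal-cong h) y
    proj-cong {suc n} (suc x) h (a ∷ y) = cong₂ _+_ (proj-cong (suc x) (marginal-cong h) y) (proj-cong x (residual-cong a h) y)

    residual-+ : ∀ {n} a (f g : Fun (suc n)) y → residual a (λ y → f y + g y) y ≡ residual a f y + residual a g y
    residual-+ a f g y = trans (cong (_-_ (+ q * (f (a ∷ y) + g (a ∷ y)))) (sumF-+ (λ b → f (b ∷ y)) (λ b → g (b ∷ y))))
      (lemma (+ q) (f (a ∷ y)) (g (a ∷ y)) (marginal f y) (marginal g y))
      where
      lemma : ∀ q a b c d → q * (a + b) - (c + d) ≡ (q * a - c) + (q * b - d)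
      lemma = solve-∀

    residual-* : ∀ {n} a c (f : Fun (suc n)) y → residual a (λ y → c * f y) y ≡ c * residual a f y
    residual-* a c f y = trans (cong (_-_ (+ q * (c * f (a ∷ y)))) (sumF-* c (λ b → f (b ∷ y))))
      (lemma (+ q) c (f (a ∷ y)) (marginal f y))
      where
      lemma : ∀ q c a b → q * (c * a) - c * b ≡ c * (q * a - b)
      lemma = solve-∀

    proj-+ : ∀ {n} x (f g : Fun n) y → proj x (λ y → f y + g y) y ≡ proj x f y + proj x g y
    proj-+ {zero}  zero    f g []      = refl
    proj-+ {zero}  (suc x) f g []      = refl
    proj-+ {suc n} zero    f g (a ∷ y) = trans (proj-cong 0 (λ y → sumF-+ (λ b → f (b ∷ y)) (λ b → g (b ∷ y))) y) (proj-+ 0 (marginal f) (marginal g) y)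
    proj-+ {suc n} (suc x) f g (a ∷ y) = trans (cong₂ _+_
        (trans (proj-cong (suc x) (λ y → sumF-+ (λ b → f (b ∷ y)) (λ b → g (b ∷ y))) y) (proj-+ (suc x) (marginal f) (marginal g) y))
        (trans (proj-cong x (residual-+ a f g) y) (proj-+ x (residual a f) (residual a g) y)))
      (interchange (proj (suc x) (marginal f) y) (proj (suc x) (marginal g) y) _ _)

    proj-* : ∀ {n} x c (f : Fun n) y → proj x (λ y → c * f y) y ≡ c * proj x f y
    proj-* {zero}  zero    c f []      = refl
    proj-* {zero}  (suc x) c f []      = sym (*-zeroʳ c)
    proj-* {suc n} zero    c f (a ∷ y) = trans (proj-cong 0 (λ y → sumF-* c (λ b → f (b ∷ y))) y) (proj-* 0 c (marginal f) y)
    proj-* {suc n} (suc x) c f (a ∷ y) = trans (cong₂ _+_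
        (trans (proj-cong (suc x) (λ y → sumF-* c (λ b → f (b ∷ y))) y) (proj-* (suc x) c (marginal f) y))
        (trans (proj-cong x (residual-* a c f) y) (proj-* x c (residual a f) y)))
      (sym (*-distribˡ-+ c (proj (suc x) (marginal f) y) _))

    proj-∑L : ∀ {n} {A : Set} x (cs : List A) (f : A → Fun n) y → proj x (λ y → ∑L cs (λ c → f c y)) y ≡ ∑L cs (λ c → proj x (f c) y)
    proj-∑L x []       f y = proj-* x 0ℤ (λ _ → 0ℤ) y
    proj-∑L x (c ∷ cs) f y = trans (proj-+ x (f c) _ y) (cong (_+_ (proj x (f c) y)) (proj-∑L x cs f y))

    marginal-S : ∀ {n} (f : Fun (suc n)) y → marginal (S f) y ≡ + q * marginal f y + S (marginal f) y
    marginal-S f y = trans (sumF-+ (λ _ → marginal f y) (λ b → S (λ y → f (b ∷ y)) y))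
      (cong₂ _+_ (sumF-const q (marginal f y)) (sym (S-sumF (λ b y → f (b ∷ y)) y)))

    residual-S : ∀ {n} a (f : Fun (suc n)) y → residual a (S f) y ≡ S (residual a f) y
    residual-S a f y = begin
      + q * (marginal f y + S fₐ y) - marginal (S f) y                         ≡⟨ cong (_-_ (+ q * (marginal f y + S fₐ y))) (marginal-S f y) ⟩
      + q * (marginal f y + S fₐ y) - (+ q * marginal f y + S (marginal f) y)  ≡⟨ lemma (+ q) (marginal f y) (S fₐ y) (S (marginal f) y) ⟩
      + q * S fₐ y + -1ℤ * S (marginal f) y                                    ≡⟨ sym (cong₂ _+_ (S-* (+ q) fₐ y) (S-* -1ℤ (marginal f) y)) ⟩
      S (λ y → + q * fₐ y) y + S (λ y → -1ℤ * marginal f y) y                  ≡⟨ sym (S-+ _ _ y) ⟩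
      S (λ y → + q * fₐ y + -1ℤ * marginal f y) y                              ≡⟨ S-cong (λ y → cong (_+_ (+ q * fₐ y)) (-1*i≡-i (marginal f y))) y ⟩
      S (residual a f) y                                                       ∎
      where
      open ≡-Reasoning
      fₐ = λ y → f (a ∷ y)
      lemma : ∀ q m s t → q * (m + s) - (q * m + t) ≡ q * s + -1ℤ * t
      lemma = solve-∀

    -- Summation along the first coordinate acts as q on the part from `marginal` and as 0 on the
    -- part from `residual`; taking the residual also raises the index by one.
    proj-S : ∀ {n} x (f : Fun n) y → proj x (S f) y ≡ eigenvalue n x * proj x f y
    proj-S-marginal : ∀ {n} x (f : Fun (suc n)) y → proj x (marginal (S f)) y ≡ (+ q + eigenvalue n x) * proj x (marginal f) y

    proj-S {zero}  zero    f []      = sym (cong (_* f []) (*-zeroʳ (+ q)))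
    proj-S {zero}  (suc x) f []      = sym (*-zeroʳ (eigenvalue 0 (suc x)))
    proj-S {suc n} zero    f (a ∷ y) = trans (proj-S-marginal 0 f y) (cong (_* proj 0 (marginal f) y) (lemma (+ q) (+ n)))
      where
      lemma : ∀ q n → q + q * (n - 0ℤ) ≡ q * (1ℤ + n - 0ℤ)
      lemma = solve-∀
    proj-S {suc n} (suc x) f (a ∷ y) = trans (cong₂ _+_ (proj-S-marginal (suc x) f y)
        (trans (proj-cong x (residual-S a f) y) (proj-S x (residual a f) y)))
      (lemma (+ q) (+ n) (+ x) (proj (suc x) (marginal f) y) (proj x (residual a f) y))
      where
      lemma : ∀ q n x a b → (q + q * (n - (1ℤ + x))) * a + q * (n - x) * b ≡ q * (1ℤ + n - (1ℤ + x)) * (a + b)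
      lemma = solve-∀

    proj-S-marginal {n} x f y = begin
      proj x (marginal (S f)) y                                      ≡⟨ proj-cong x (marginal-S f) y ⟩
      proj x (λ y → + q * marginal f y + S (marginal f) y) y         ≡⟨ proj-+ x _ _ y ⟩
      proj x (λ y → + q * marginal f y) y + proj x (S (marginal f)) y
        ≡⟨ cong₂ _+_ (proj-* x (+ q) (marginal f) y) (proj-S x (marginal f) y) ⟩
      + q * proj x (marginal f) y + eigenvalue n x * proj x (marginal f) y
        ≡⟨ sym (*-distribʳ-+ (proj x (marginal f) y) (+ q) (eigenvalue n x)) ⟩
      (+ q + eigenvalue n x) * proj x (marginal f) y                 ∎
      where open ≡-Reasoning

    proj-const : ∀ {n} x c (y : Word q n) → proj (suc x) (λ _ → c) y ≡ 0ℤ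
    proj-const {zero}  x c []      = refl
    proj-const {suc n} x c (a ∷ y) = cong₂ _+_
      (trans (proj-cong (suc x) (λ _ → sumF-const q c) y) (proj-const x (+ q * c) y))
      (trans (proj-cong x (λ y → trans (cong (_-_ (+ q * c)) (sumF-const q c)) (+-inverseʳ (+ q * c))) y)
        (proj-* x 0ℤ (λ _ → 0ℤ) y))

    proj-sum : ∀ {n} N (f : Fun n) y → n < N → ∑ N (λ x → proj x f y) ≡ (+ q) ^ n * f y
    proj-sum {zero}  (suc N) f []      _ = trans (∑-suc N _) (trans (cong (_+_ (f [])) (∑-zero N λ _ _ → refl)) (lemma (f [])))
      where
      lemma : ∀ a → a + 0ℤ ≡ 1ℤ * a
      lemma = solve-∀
    proj-sum {suc n} (suc N) f (a ∷ y) (s≤s n<N) = begin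
      ∑ (suc N) (λ x → proj x f (a ∷ y))
        ≡⟨ ∑-suc N _ ⟩
      proj 0 (marginal f) y + ∑ N (λ x → proj (suc x) (marginal f) y + proj x (residual a f) y)
        ≡⟨ cong (_+_ (proj 0 (marginal f) y)) (∑-+ N _ _) ⟩
      proj 0 (marginal f) y + (∑ N (λ x → proj (suc x) (marginal f) y) + ∑ N (λ x → proj x (residual a f) y))
        ≡⟨ sym (+-assoc (proj 0 (marginal f) y) _ _) ⟩
      proj 0 (marginal f) y + ∑ N (λ x → proj (suc x) (marginal f) y) + ∑ N (λ x → proj x (residual a f) y)
        ≡⟨ cong₂ _+_ (trans (sym (∑-suc N _)) (proj-sum (suc N) (marginal f) y (ℕP.m<n⇒m<1+n n<N))) (proj-sum N (residual a f) y n<N) ⟩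
      (+ q) ^ n * marginal f y + (+ q) ^ n * (+ q * f (a ∷ y) - marginal f y)
        ≡⟨ lemma ((+ q) ^ n) (marginal f y) (+ q) (f (a ∷ y)) ⟩
      (+ q) ^ suc n * f (a ∷ y) ∎
      where
      open ≡-Reasoning
      lemma : ∀ p m q a → p * m + p * (q * a - m) ≡ q * p * a
      lemma = solve-∀

    -- proj 0 f is the constant function Σ f.
    proj₀-one : ∀ {n} (y : Word q n) → proj 0 (λ _ → 1ℤ) y ≡ (+ q) ^ n
    proj₀-one {zero}  []      = refl
    proj₀-one {suc n} (a ∷ y) = trans (proj-cong 0 (λ _ → sumF-const q 1ℤ) y)
      (trans (proj-* 0 (+ q) (λ _ → 1ℤ) y) (cong (+ q *_) (proj₀-one y)))

    proj₀-≡0 : ∀ {n} (f : Fun n) → (∀ y → 0ℤ ℤ.≤ f y) → ∀ y₀ → proj 0 f y₀ ≡ 0ℤ → ∀ y → f y ≡ 0ℤ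
    proj₀-≡0 {zero}  f h []       e []      = e
    proj₀-≡0 {suc n} f h (_ ∷ y₀) e (a ∷ y) = sumF-≡0 (λ b → f (b ∷ y)) (λ b → h (b ∷ y))
      (proj₀-≡0 (marginal f) (λ y → sumF-≥0 _ λ b → h (b ∷ y)) y₀ e y) a

    -- In an agreeing coordinate the line has one word at distance j and q - 1 at j + 1; in each of
    -- the j others it has one at j - 1 and q - 1 at j. At j = 0 the value at `pred 0` is multiplied
    -- by 0.
    step : ℕ → (ℕ → ℤ) → ℕ → ℤ
    step n φ j = (+ n - + j) * (φ j + (+ q - 1ℤ) * φ (suc j)) + + j * (φ (ℕ.pred j) + (+ q - 1ℤ) * φ j)

    marginal-dist : ∀ {n} (φ : ℕ → ℤ) a (c y : Word q n) →
      marginal (λ y → φ (dist (a ∷ c) y)) y ≡ φ (dist c y) + (+ q - 1ℤ) * φ (suc (dist c y))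
    marginal-dist φ a c y = sumF-if a (λ t → φ ((if t then 0 else 1) ℕ.+ dist c y))

    S-dist : ∀ {n} (φ : ℕ → ℤ) (c y : Word q n) → S (λ y → φ (dist c y)) y ≡ step n φ (dist c y)
    S-dist {zero}  φ []      []      = sym (lemma (φ 0 + (+ q - 1ℤ) * φ 1) (φ 0 + (+ q - 1ℤ) * φ 0))
      where
      lemma : ∀ a b → (0ℤ - 0ℤ) * a + 0ℤ * b ≡ 0ℤ
      lemma = solve-∀
    S-dist {suc n} φ (a ∷ c) (b ∷ y) with does (a FinP.≟ b)
    ... | true  = trans (cong₂ _+_ (marginal-dist φ a c y) (S-dist φ c y))
        (lemma (φ j + (+ q - 1ℤ) * φ (suc j)) (φ (ℕ.pred j) + (+ q - 1ℤ) * φ j) (+ n) (+ j))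
      where
      j = dist c y
      lemma : ∀ a b n j → a + ((n - j) * a + j * b) ≡ (1ℤ + n - j) * a + j * b
      lemma = solve-∀
    ... | false = trans (cong₂ _+_ (marginal-dist φ a c y) (S-dist (λ i → φ (suc i)) c y)) (same (dist c y))
      where
      lemma : ∀ p₀ p₁ p₂ q n j → (p₀ + q * p₁) + ((n - (1ℤ + j)) * (p₁ + q * p₂) + (1ℤ + j) * (p₀ + q * p₁))
        ≡ (1ℤ + n - (1ℤ + (1ℤ + j))) * (p₁ + q * p₂) + (1ℤ + (1ℤ + j)) * (p₀ + q * p₁)
      lemma = solve-∀
      lemma₀ : ∀ p₀ p₁ p₂ q n → (p₀ + q * p₁) + ((n - 0ℤ) * (p₁ + q * p₂) + 0ℤ * (p₁ + q * p₁))
        ≡ (1ℤ + n - 1ℤ) * (p₁ + q * p₂) + 1ℤ * (p₀ + q * p₁)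
      lemma₀ = solve-∀
      same : ∀ j → (φ j + (+ q - 1ℤ) * φ (suc j)) + step n (λ i → φ (suc i)) j ≡ step (suc n) φ (suc j)
      same zero    = lemma₀ (φ 0) (φ 1) (φ 2) (+ q - 1ℤ) (+ n)
      same (suc j) = lemma (φ (suc j)) (φ (suc (suc j))) (φ (suc (suc (suc j)))) (+ q - 1ℤ) (+ n) (+ j)

    atZero upToTwo : ℕ → ℤ
    atZero zero    = 1ℤ
    atZero (suc _) = 0ℤ
    upToTwo zero                = 1ℤ
    upToTwo (suc zero)          = 1ℤ
    upToTwo (suc (suc zero))    = 1ℤ
    upToTwo (suc (suc (suc _))) = 0ℤ

    -- z² - trace z + det is the Lloyd polynomial in the variable z = q (n - x), up to a factor 2.
    trace det : ℕ → ℤ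
    trace n = + 2 * + n + + q - + 4
    det n = (+ n - 1ℤ) * (+ n - + 2)

    step-0 : ∀ n → step n atZero 0 ≡ + n
    step-0 n = lemma (+ n) (+ q)
      where
      lemma : ∀ n q → (n - 0ℤ) * (1ℤ + (q - 1ℤ) * 0ℤ) + 0ℤ * (1ℤ + (q - 1ℤ) * 1ℤ) ≡ n
      lemma = solve-∀

    step-1 : ∀ n → step n atZero 1 ≡ 1ℤ
    step-1 n = lemma (+ n) (+ q)
      where
      lemma : ∀ n q → (n - 1ℤ) * (0ℤ + (q - 1ℤ) * 0ℤ) + 1ℤ * (1ℤ + (q - 1ℤ) * 0ℤ) ≡ 1ℤ
      lemma = solve-∀

    step-far : ∀ n j → step n atZero (suc (suc j)) ≡ 0ℤ
    step-far n j = lemma (+ n) (+ q) (+ suc (suc j))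
      where
      lemma : ∀ n q a → (n - a) * (0ℤ + (q - 1ℤ) * 0ℤ) + a * (0ℤ + (q - 1ℤ) * 0ℤ) ≡ 0ℤ
      lemma = solve-∀

    -- On functions of the distance, twice the indicator of the ball of radius 2 arises from that of
    -- its centre by a quadratic polynomial in `S`; this is where `trace` and `det` come from.
    ball-identity : ∀ n j →
      step n (step n atZero) j + (- trace n * step n atZero j + det n * atZero j) ≡ + 2 * upToTwo j
    ball-identity n = cases
      where
      s = step n atZero
      cases : ∀ j → (+ n - + j) * (s j + (+ q - 1ℤ) * s (suc j)) + + j * (s (ℕ.pred j) + (+ q - 1ℤ) * s j)
        + (- trace n * s j + det n * atZero j) ≡ + 2 * upToTwo j
      cases zero = trans (cong₂ (λ a b → (+ n - 0ℤ) * (a + (+ q - 1ℤ) * b) + 0ℤ * (a + (+ q - 1ℤ) * a) + (- trace n * a + det n * 1ℤ))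
        (step-0 n) (step-1 n)) (lemma (+ n) (+ q))
        where
        lemma : ∀ n q → (n - 0ℤ) * (n + (q - 1ℤ) * 1ℤ) + 0ℤ * (n + (q - 1ℤ) * n)
          + (- (+ 2 * n + q - + 4) * n + (n - 1ℤ) * (n - + 2) * 1ℤ) ≡ + 2 * 1ℤ
        lemma = solve-∀
      cases (suc zero) = trans (cong₂ (λ f b → (+ n - 1ℤ) * (b + (+ q - 1ℤ) * proj₁ f) + 1ℤ * (proj₂ f + (+ q - 1ℤ) * b) + (- trace n * b + det n * 0ℤ))
        (cong₂ _,_ (step-far n 0) (step-0 n)) (step-1 n)) (lemma (+ n) (+ q))
        where
        lemma : ∀ n q → (n - 1ℤ) * (1ℤ + (q - 1ℤ) * 0ℤ) + 1ℤ * (n + (q - 1ℤ) * 1ℤ)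
          + (- (+ 2 * n + q - + 4) * 1ℤ + (n - 1ℤ) * (n - + 2) * 0ℤ) ≡ + 2 * 1ℤ
        lemma = solve-∀
      cases (suc (suc j)) = trans (cong₂ (λ a b → (+ n - + suc (suc j)) * (a + (+ q - 1ℤ) * b) + + suc (suc j) * (s (suc j) + (+ q - 1ℤ) * a)
          + (- trace n * a + det n * 0ℤ)) (step-far n j) (step-far n (suc j))) (last j)
        where
        lemma : ∀ n q k a t δ → (n - k) * (0ℤ + (q - 1ℤ) * 0ℤ) + k * (a + (q - 1ℤ) * 0ℤ) + (- t * 0ℤ + δ * 0ℤ) ≡ k * a
        lemma = solve-∀
        last : ∀ j → (+ n - + suc (suc j)) * (0ℤ + (+ q - 1ℤ) * 0ℤ) + + suc (suc j) * (s (suc j) + (+ q - 1ℤ) * 0ℤ)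
          + (- trace n * 0ℤ + det n * 0ℤ) ≡ + 2 * upToTwo (suc (suc j))
        last zero    = trans (lemma (+ n) (+ q) (+ 2) (s 1) (trace n) (det n)) (cong (+ 2 *_) (step-1 n))
        last (suc j) = trans (lemma (+ n) (+ q) (+ suc (suc (suc j))) (s (suc (suc j))) (trace n) (det n))
            (trans (cong (+ suc (suc (suc j)) *_) (step-far n j)) (*-zeroʳ (+ suc (suc (suc j)))))

    proj₀-atZero : ∀ {n} (c y : Word q n) → proj 0 (λ y → atZero (dist c y)) y ≡ 1ℤ
    proj₀-atZero []      []      = refl
    proj₀-atZero (a ∷ c) (b ∷ y) = trans (proj-cong 0 (λ y → trans (marginal-dist atZero a c y) (lemma (atZero (dist c y)) (+ q))) y)
      (proj₀-atZero c y)
      where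
      lemma : ∀ x q → x + (q - 1ℤ) * 0ℤ ≡ x
      lemma = solve-∀

    triangle : ∀ {n} (c d y : Word q n) → dist c d ≤ dist c y ℕ.+ dist d y
    triangle []      []      []      = z≤n
    triangle (a ∷ c) (b ∷ d) (e ∷ y) = ℕP.≤-trans (ℕP.+-mono-≤ heads (triangle c d y))
        (ℕP.≤-reflexive (regroup (if does (a FinP.≟ e) then 0 else 1) (if does (b FinP.≟ e) then 0 else 1) (dist c y) (dist d y)))
      where
      regroup : ∀ p q r s → p ℕ.+ q ℕ.+ (r ℕ.+ s) ≡ (p ℕ.+ r) ℕ.+ (q ℕ.+ s)
      regroup p q r s = trans (ℕP.+-assoc p q _) (trans (cong (p ℕ.+_) (trans (sym (ℕP.+-assoc q r s))
        (trans (cong (ℕ._+ s) (ℕP.+-comm q r)) (ℕP.+-assoc r q s)))) (sym (ℕP.+-assoc p r _)))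
      heads : (if does (a FinP.≟ b) then 0 else 1) ≤ (if does (a FinP.≟ e) then 0 else 1) ℕ.+ (if does (b FinP.≟ e) then 0 else 1)
      heads with a FinP.≟ b | a FinP.≟ e | b FinP.≟ e
      ... | yes _  | _        | _        = z≤n
      ... | no  _  | no _     | _        = s≤s z≤n
      ... | no  _  | yes _    | no _     = s≤s z≤n
      ... | no a≢b | yes refl | yes refl = contradiction refl a≢b

  2*nC2 : ∀ n → 2 ℕ.* (n C 2) ℕ.+ n ≡ n ℕ.* n
  2*nC2 zero    = refl
  2*nC2 (suc n) = begin
    2 ℕ.* (suc n C 2) ℕ.+ suc n             ≡⟨ cong (λ c → 2 ℕ.* c ℕ.+ suc n) (sym (nCk+nC[k+1]≡[n+1]C[k+1] n 1)) ⟩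
    2 ℕ.* ((n C 1) ℕ.+ (n C 2)) ℕ.+ suc n   ≡⟨ cong (λ c → 2 ℕ.* (c ℕ.+ (n C 2)) ℕ.+ suc n) (nC1≡n n) ⟩
    2 ℕ.* (n ℕ.+ (n C 2)) ℕ.+ suc n         ≡⟨ lemma₁ n (n C 2) ⟩
    (2 ℕ.* (n C 2) ℕ.+ n) ℕ.+ (2 ℕ.* n ℕ.+ 1)  ≡⟨ cong (ℕ._+ (2 ℕ.* n ℕ.+ 1)) (2*nC2 n) ⟩
    n ℕ.* n ℕ.+ (2 ℕ.* n ℕ.+ 1)             ≡⟨ lemma₂ n ⟩
    suc n ℕ.* suc n                         ∎
    where
    open ≡-Reasoning
    lemma₁ : ∀ n c → 2 ℕ.* (n ℕ.+ c) ℕ.+ suc n ≡ (2 ℕ.* c ℕ.+ n) ℕ.+ (2 ℕ.* n ℕ.+ 1)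
    lemma₁ = solveℕ-∀
    lemma₂ : ∀ n → n ℕ.* n ℕ.+ (2 ℕ.* n ℕ.+ 1) ≡ suc n ℕ.* suc n
    lemma₂ = solveℕ-∀

  module Perfect (q n : ℕ) (code : List (Word q n)) (perfect : IsPerfectCode q 2 n code) (2≤q : 2 ≤ q) where

    open Operators q

    separated : ∀ {c d} → c ∈ code → d ∈ code → c ≢ d → 5 ≤ dist c d
    separated = proj₂ (proj₁ perfect)

    f cover : Fun n
    f y = ∑L code (λ c → atZero (dist c y))
    cover y = ∑L code (λ c → upToTwo (dist c y))

    Sf : ∀ y → S f y ≡ ∑L code (λ c → step n atZero (dist c y))
    Sf y = trans (S-∑L code (λ c y → atZero (dist c y)) y) (∑L-cong code λ c _ → S-dist atZero c y)

    SSf : ∀ y → S (S f) y ≡ ∑L code (λ c → step n (step n atZero) (dist c y))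
    SSf y = trans (S-cong Sf y) (trans (S-∑L code (λ c y → step n atZero (dist c y)) y) (∑L-cong code λ c _ → S-dist (step n atZero) c y))

    Ψ : Fun n → Fun n
    Ψ g y = S (S g) y + (- trace n * S g y + det n * g y)

    Ψf : ∀ y → Ψ f y ≡ + 2 * cover y
    Ψf y = begin
      S (S f) y + (- trace n * S f y + det n * f y)
        ≡⟨ cong₂ (λ a b → a + (- trace n * b + det n * f y)) (SSf y) (Sf y) ⟩
      ∑L code s₂ + (- trace n * ∑L code s₁ + det n * ∑L code s₀)
        ≡⟨ cong (_+_ (∑L code s₂)) (trans (sym (cong₂ _+_ (∑L-* (- trace n) code s₁) (∑L-* (det n) code s₀))) (sym (∑L-+ code _ _))) ⟩
      ∑L code s₂ + ∑L code (λ c → - trace n * s₁ c + det n * s₀ c)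
        ≡⟨ sym (∑L-+ code _ _) ⟩
      ∑L code (λ c → s₂ c + (- trace n * s₁ c + det n * s₀ c))
        ≡⟨ ∑L-cong code (λ c _ → ball-identity n (dist c y)) ⟩
      ∑L code (λ c → + 2 * upToTwo (dist c y))
        ≡⟨ ∑L-* (+ 2) code _ ⟩
      + 2 * cover y ∎
      where
      open ≡-Reasoning
      s₀ s₁ s₂ : Word q n → ℤ
      s₀ c = atZero (dist c y)
      s₁ c = step n atZero (dist c y)
      s₂ c = step n (step n atZero) (dist c y)

    proj-Ψ : ∀ x y → proj x (Ψ f) y ≡ (eigenvalue n x * eigenvalue n x + (- trace n * eigenvalue n x + det n)) * proj x f y
    proj-Ψ x y = begin
      proj x (Ψ f) y
        ≡⟨ proj-+ x (S (S f)) _ y ⟩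
      proj x (S (S f)) y + proj x (λ y → - trace n * S f y + det n * f y) y
        ≡⟨ cong₂ _+_ (trans (proj-S x (S f) y) (cong (θ *_) (proj-S x f y)))
             (trans (proj-+ x _ _ y) (cong₂ _+_ (trans (proj-* x (- trace n) (S f) y) (cong (- trace n *_) (proj-S x f y))) (proj-* x (det n) f y))) ⟩
      θ * (θ * proj x f y) + (- trace n * (θ * proj x f y) + det n * proj x f y)
        ≡⟨ lemma θ (trace n) (det n) (proj x f y) ⟩
      (θ * θ + (- trace n * θ + det n)) * proj x f y ∎
      where
      open ≡-Reasoning
      θ = eigenvalue n x
      lemma : ∀ θ t d e → θ * (θ * e) + (- t * (θ * e) + d * e) ≡ (θ * θ + (- t * θ + d)) * e
      lemma = solve-∀

    B : ℕ
    B = ballSize q n 2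

    -- Index 0 belongs to the constant functions, on which averaging over balls is multiplication by
    -- their size; the factor 2 is that of `ball-identity`.
    Ψ₀ : eigenvalue n 0 * eigenvalue n 0 + (- trace n * eigenvalue n 0 + det n) ≡ + 2 * + B
    Ψ₀ = sym (begin
      + 2 * + B
        ≡⟨ cong (+ 2 *_) B-cast ⟩
      + 2 * (1ℤ + + n * (+ q - 1ℤ) + + (n C 2) * ((+ q - 1ℤ) * (+ q - 1ℤ)))
        ≡⟨ lemma₁ (+ n) (+ q - 1ℤ) (+ (n C 2)) ⟩
      + 2 + + 2 * (+ n * (+ q - 1ℤ)) + (+ 2 * + (n C 2) + + n - + n) * ((+ q - 1ℤ) * (+ q - 1ℤ))
        ≡⟨ cong (λ c → + 2 + + 2 * (+ n * (+ q - 1ℤ)) + (c - + n) * ((+ q - 1ℤ) * (+ q - 1ℤ))) C2-cast ⟩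
      + 2 + + 2 * (+ n * (+ q - 1ℤ)) + (+ n * + n - + n) * ((+ q - 1ℤ) * (+ q - 1ℤ))
        ≡⟨ lemma₂ (+ n) (+ q) ⟩
      eigenvalue n 0 * eigenvalue n 0 + (- trace n * eigenvalue n 0 + det n) ∎)
      where
      open ≡-Reasoning
      lemma₁ : ∀ n r c → + 2 * (1ℤ + n * r + c * (r * r)) ≡ + 2 + + 2 * (n * r) + (+ 2 * c + n - n) * (r * r)
      lemma₁ = solve-∀
      lemma₂ : ∀ n q → + 2 + + 2 * (n * (q - 1ℤ)) + (n * n - n) * ((q - 1ℤ) * (q - 1ℤ))
        ≡ q * (n - 0ℤ) * (q * (n - 0ℤ)) + (- (+ 2 * n + q - + 4) * (q * (n - 0ℤ)) + (n - 1ℤ) * (n - + 2))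
      lemma₂ = solve-∀
      C2-cast : + 2 * + (n C 2) + + n ≡ + n * + n
      C2-cast = trans (cong (_+ + n) (sym (pos-* 2 (n C 2)))) (trans (sym (pos-+ (2 ℕ.* (n C 2)) n)) (trans (cong +_ (2*nC2 n)) (pos-* n n)))
      q-1 : + (q ∸ 1) ≡ + q - 1ℤ
      q-1 = sym (trans (m-n≡m⊖n q 1) (⊖-≥ (ℕP.≤-trans (s≤s z≤n) 2≤q)))
      B-cast : + B ≡ 1ℤ + + n * (+ q - 1ℤ) + + (n C 2) * ((+ q - 1ℤ) * (+ q - 1ℤ))
      B-cast = trans (pos-+ ((n C 0) ℕ.* 1 ℕ.+ (n C 1) ℕ.* ((q ∸ 1) ℕ.* 1)) ((n C 2) ℕ.* ((q ∸ 1) ℕ.* ((q ∸ 1) ℕ.* 1))))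
        (cong₂ _+_ (trans (pos-+ ((n C 0) ℕ.* 1) ((n C 1) ℕ.* ((q ∸ 1) ℕ.* 1))) (cong (_+_ 1ℤ)
            (trans (cong₂ (λ a b → + (a ℕ.* b)) (nC1≡n n) (ℕP.*-identityʳ (q ∸ 1))) (trans (pos-* n (q ∸ 1)) (cong (+ n *_) q-1)))))
          (trans (pos-* (n C 2) ((q ∸ 1) ℕ.* ((q ∸ 1) ℕ.* 1))) (cong (+ (n C 2) *_)
            (trans (cong (λ b → + ((q ∸ 1) ℕ.* b)) (ℕP.*-identityʳ (q ∸ 1))) (trans (pos-* (q ∸ 1) (q ∸ 1)) (cong₂ _*_ q-1 q-1))))))

    size-B : + length code * + B ≡ (+ q) ^ n
    size-B = trans (sym (pos-* (length code) B)) (trans (cong +_ (proj₂ perfect)) (pos-^ q n))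

    upToTwo-cases : ∀ j → (upToTwo j ≡ 0ℤ) ⊎ (upToTwo j ≡ 1ℤ × j ≤ 2)
    upToTwo-cases zero                = inj₂ (refl , z≤n)
    upToTwo-cases (suc zero)          = inj₂ (refl , s≤s z≤n)
    upToTwo-cases (suc (suc zero))    = inj₂ (refl , s≤s (s≤s z≤n))
    upToTwo-cases (suc (suc (suc _))) = inj₁ refl

    cover-cases : ∀ y (cs : List (Word q n)) → Unique cs → (∀ {c d} → c ∈ cs → d ∈ cs → c ≢ d → 5 ≤ dist c d) →
      (∑L cs (λ c → upToTwo (dist c y)) ≡ 0ℤ) ⊎ (∑L cs (λ c → upToTwo (dist c y)) ≡ 1ℤ)
    cover-cases y []       _ _ = inj₁ refl
    cover-cases y (c ∷ cs) (fresh ∷ uniq) sep with upToTwo-cases (dist c y)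
    ... | inj₂ (u≡1 , c≤2) = inj₂ (cong₂ _+_ u≡1 (∑L-zero cs others))
      where
      others : ∀ d → d ∈ cs → upToTwo (dist d y) ≡ 0ℤ
      others d d∈ with upToTwo-cases (dist d y)
      ... | inj₁ u≡0 = u≡0
      ... | inj₂ (_ , d≤2) = contradiction (ℕP.≤-trans (sep (here refl) (there d∈) (All.lookup fresh d∈))
        (ℕP.≤-trans (triangle c d y) (ℕP.+-mono-≤ c≤2 d≤2))) λ { (s≤s (s≤s (s≤s (s≤s ())))) }
    ... | inj₁ u≡0 with cover-cases y cs uniq (λ c∈ d∈ → sep (there c∈) (there d∈))
    ...   | inj₁ rest = inj₁ (cong₂ _+_ u≡0 rest)
    ...   | inj₂ rest = inj₂ (cong₂ _+_ u≡0 rest)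

    -- Disjointness of the balls makes `1 - cover` nonnegative, and the sphere-packing equality
    -- makes its sum 0.
    cover≡1 : ∀ y → cover y ≡ 1ℤ
    cover≡1 y = sym (i-j≡0⇒i≡j 1ℤ (cover y) (proj₀-≡0 g nonneg y total y))
      where
      g : Fun n
      g y = 1ℤ - cover y
      nonneg : ∀ y → 0ℤ ℤ.≤ g y
      nonneg y with cover-cases y code (proj₁ (proj₁ perfect)) separated
      ... | inj₁ e = subst (λ z → 0ℤ ℤ.≤ 1ℤ - z) (sym e) (ℤ.+≤+ z≤n)
      ... | inj₂ e = subst (λ z → 0ℤ ℤ.≤ 1ℤ - z) (sym e) (ℤ.+≤+ z≤n)
      open ≡-Reasoning
      f-total : proj 0 f y ≡ + length code
      f-total = trans (proj-∑L 0 code (λ c y → atZero (dist c y)) y) (trans (∑L-cong code λ c _ → proj₀-atZero c y)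
        (trans (∑L-const code 1ℤ) (*-identityʳ _)))
      cover-total : + 2 * proj 0 cover y ≡ + 2 * (+ q) ^ n
      cover-total = begin
        + 2 * proj 0 cover y                 ≡⟨ sym (proj-* 0 (+ 2) cover y) ⟩
        proj 0 (λ y → + 2 * cover y) y       ≡⟨ proj-cong 0 (λ y → sym (Ψf y)) y ⟩
        proj 0 (Ψ f) y                       ≡⟨ proj-Ψ 0 y ⟩
        (eigenvalue n 0 * eigenvalue n 0 + (- trace n * eigenvalue n 0 + det n)) * proj 0 f y ≡⟨ cong₂ _*_ Ψ₀ f-total ⟩
        + 2 * + B * + length code            ≡⟨ trans (*-assoc (+ 2) (+ B) _) (cong (+ 2 *_) (trans (*-comm (+ B) _) size-B)) ⟩
        + 2 * (+ q) ^ n                      ∎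
      total : proj 0 g y ≡ 0ℤ
      total = begin
        proj 0 g y                                                 ≡⟨ proj-cong 0 (λ y → cong (_+_ 1ℤ) (sym (-1*i≡-i (cover y)))) y ⟩
        proj 0 (λ y → 1ℤ + -1ℤ * cover y) y                        ≡⟨ proj-+ 0 (λ _ → 1ℤ) (λ y → -1ℤ * cover y) y ⟩
        proj 0 (λ _ → 1ℤ) y + proj 0 (λ y → -1ℤ * cover y) y       ≡⟨ cong₂ _+_ (proj₀-one y) (proj-* 0 -1ℤ cover y) ⟩
        (+ q) ^ n + -1ℤ * proj 0 cover y                           ≡⟨ cong (λ z → (+ q) ^ n + -1ℤ * z) (*-cancelˡ-≡ (+ 2) _ _ cover-total) ⟩
        (+ q) ^ n + -1ℤ * (+ q) ^ n                                ≡⟨ lemma ((+ q) ^ n) ⟩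
        0ℤ                                                         ∎
        where
        lemma : ∀ a → a + -1ℤ * a ≡ 0ℤ
        lemma = solve-∀

    Ψf≡2 : ∀ y → Ψ f y ≡ + 2
    Ψf≡2 y = trans (Ψf y) (cong (+ 2 *_) (cover≡1 y))

    -- `Ψ f` is constant, and a constant has no component at a positive index.
    lloyd : ∀ x y → (eigenvalue n (suc x) * eigenvalue n (suc x) + (- trace n * eigenvalue n (suc x) + det n)) * proj (suc x) f y ≡ 0ℤ
    lloyd x y = trans (sym (proj-Ψ (suc x) y)) (trans (proj-cong (suc x) Ψf≡2 y) (proj-const x (+ 2) y))

    module AtDistanceTwo (c₀ y : Word q n) (c₀∈ : c₀ ∈ code) (d₀ : dist c₀ y ≡ 2) where

      -- A codeword other than `c₀` within distance 1 of `y` would be within 3 of `c₀`.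
      far : ∀ c → c ∈ code → ∃ λ j → dist c y ≡ suc (suc j)
      far c c∈ = from (≡-dec FinP._≟_ c c₀)
        where
        close : ∀ {j} → j ≤ 1 → dist c y ≡ j → c ≢ c₀ → ⊥
        close j≤1 e ne = contradiction (ℕP.≤-trans (separated c∈ c₀∈ ne) (ℕP.≤-trans (triangle c c₀ y)
          (ℕP.+-mono-≤ (ℕP.≤-trans (ℕP.≤-reflexive e) j≤1) (ℕP.≤-reflexive d₀)))) λ { (s≤s (s≤s (s≤s ()))) }
        from : Dec (c ≡ c₀) → ∃ λ j → dist c y ≡ suc (suc j)
        from (yes refl) = 0 , d₀
        from (no  ne) with dist c y in e
        ... | zero        = ⊥-elim (close z≤n e ne)
        ... | suc zero    = ⊥-elim (close (s≤s z≤n) e ne)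
        ... | suc (suc j) = j , refl

      f≡0 : f y ≡ 0ℤ
      f≡0 = ∑L-zero code λ c c∈ → cong atZero (proj₂ (far c c∈))

      Sf≡0 : S f y ≡ 0ℤ
      Sf≡0 = trans (Sf y) (∑L-zero code λ c c∈ → trans (cong (step n atZero) (proj₂ (far c c∈))) (step-far n (proj₁ (far c c∈))))

      SSf≡2 : S (S f) y ≡ + 2
      SSf≡2 = trans (lemma (S (S f) y) (trace n) (det n)) (trans (sym (cong₂ (λ a b → S (S f) y + (- trace n * a + det n * b)) Sf≡0 f≡0)) (Ψf≡2 y))
        where
        lemma : ∀ a t d → a ≡ a + (- t * 0ℤ + d * 0ℤ)
        lemma = solve-∀

      e θ : ℕ → ℤ
      e x = proj x f y
      θ x = eigenvalue n x

      -- At `y` both `f` and `S f` vanish while `S (S f)` is 2, so every monic quadratic in `S`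
      -- gives 2, whatever its other coefficients; summing the components multiplies this by q^n.
      moments-e : ∀ α β → ∑ (suc n) (λ x → (θ x * θ x + (α * θ x + β)) * e x) ≡ + 2 * (+ q) ^ n
      moments-e α β = begin
        ∑ (suc n) (λ x → (θ x * θ x + (α * θ x + β)) * e x)
          ≡⟨ ∑-cong (suc n) (λ x _ → trans (lemma (θ x) α β (e x)) (cong₂ (λ a b → a + (α * b + β * e x))
               (trans (cong (θ x *_) (sym (proj-S x f y))) (sym (proj-S x (S f) y))) (sym (proj-S x f y)))) ⟩
        ∑ (suc n) (λ x → proj x (S (S f)) y + (α * proj x (S f) y + β * proj x f y))
          ≡⟨ trans (∑-+ (suc n) _ _) (cong (_+_ (∑ (suc n) (λ x → proj x (S (S f)) y))) (trans (∑-+ (suc n) _ _)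
               (sym (cong₂ _+_ (*-∑ α (suc n) _) (*-∑ β (suc n) _))))) ⟩
        ∑ (suc n) (λ x → proj x (S (S f)) y) + (α * ∑ (suc n) (λ x → proj x (S f) y) + β * ∑ (suc n) (λ x → proj x f y))
          ≡⟨ cong₂ _+_ (summed (S (S f)) SSf≡2) (cong₂ (λ a b → α * a + β * b) (summed (S f) Sf≡0) (summed f f≡0)) ⟩
        (+ q) ^ n * + 2 + (α * ((+ q) ^ n * 0ℤ) + β * ((+ q) ^ n * 0ℤ))
          ≡⟨ lemma₂ ((+ q) ^ n) α β ⟩
        + 2 * (+ q) ^ n ∎
        where
        open ≡-Reasoning
        lemma : ∀ t α β e → (t * t + (α * t + β)) * e ≡ t * (t * e) + (α * (t * e) + β * e)
        lemma = solve-∀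
        lemma₂ : ∀ p α β → p * + 2 + (α * (p * 0ℤ) + β * (p * 0ℤ)) ≡ + 2 * p
        lemma₂ = solve-∀
        summed : ∀ (g : Fun n) {v} → g y ≡ v → ∑ (suc n) (λ x → proj x g y) ≡ (+ q) ^ n * v
        summed g ev = trans (proj-sum (suc n) g y ℕP.≤-refl) (cong ((+ q) ^ n *_) ev)

      2q^n≢0 : + 2 * (+ q) ^ n ≢ 0ℤ
      2q^n≢0 = *-≢0 {+ 2} {(+ q) ^ n} (λ ()) λ e → contradiction (+-injective (i^n≡0⇒i≡0 (+ q) n e)) λ { refl → contradiction 2≤q λ () }

      factor : ∀ τ x → (θ x * θ x + (- (τ + θ 0) * θ x + τ * θ 0)) * e x ≡ (θ x - τ) * (θ x - θ 0) * e x
      factor τ x = lemma (θ x) τ (θ 0) (e x)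
        where
        lemma : ∀ t a b e → (t * t + (- (a + b) * t + a * b)) * e ≡ (t - a) * (t - b) * e
        lemma = solve-∀

      expansion : ∀ τ → ∑ (suc n) (λ x → (θ x - τ) * (θ x - θ 0) * e x) ≡ + 2 * (+ q) ^ n
      expansion τ = trans (∑-cong (suc n) λ x _ → sym (factor τ x)) (moments-e (- (τ + θ 0)) (τ * θ 0))

      Root : ℤ → Set
      Root t = t * t + (- trace n * t + det n) ≡ 0ℤ

      lloyd-root : ∀ x → Root (θ (suc x)) ⊎ e (suc x) ≡ 0ℤ
      lloyd-root x = i*j≡0⇒i≡0∨j≡0 (θ (suc x) * θ (suc x) + (- trace n * θ (suc x) + det n)) (lloyd x y)

      term : ℤ → ℕ → ℤ
      term τ x = (θ x - τ) * (θ x - θ 0) * e x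

      term-0 : ∀ τ → term τ 0 ≡ 0ℤ
      term-0 τ = lemma (θ 0) τ (e 0)
        where
        lemma : ∀ t a e → (t - a) * (t - t) * e ≡ 0ℤ
        lemma = solve-∀

      term-θ : ∀ τ x → θ x ≡ τ → term τ x ≡ 0ℤ
      term-θ τ x eq = trans (cong (λ t → (t - τ) * (θ x - θ 0) * e x) eq) (lemma τ (θ x - θ 0) (e x))
        where
        lemma : ∀ t a e → (t - t) * a * e ≡ 0ℤ
        lemma = solve-∀

      term-e : ∀ τ x → e x ≡ 0ℤ → term τ x ≡ 0ℤ
      term-e τ x e≡0 = trans (cong ((θ x - τ) * (θ x - θ 0) *_) e≡0) (*-zeroʳ ((θ x - τ) * (θ x - θ 0)))

      -- The quadratic with zeros τ and `θ 0` has a nonzero total, so it has a nonzero term; there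
      -- the index is positive, the eigenvalue is not τ, and the component is nonzero, which makes
      -- the eigenvalue a root.
      new-root : ∀ τ → ∃ λ x → x < n × Root (θ (suc x)) × θ (suc x) ≢ τ
      new-root τ = found (∑≢0 (suc n) (term τ) (λ z → 2q^n≢0 (trans (sym (expansion τ)) z)))
        where
        root : ∀ x → term τ (suc x) ≢ 0ℤ → Root (θ (suc x)) ⊎ e (suc x) ≡ 0ℤ → Root (θ (suc x))
        root x ne (inj₁ r)   = r
        root x ne (inj₂ e≡0) = ⊥-elim (ne (term-e τ (suc x) e≡0))
        found : (∃ λ x → x < suc n × term τ x ≢ 0ℤ) → ∃ λ x → x < n × Root (θ (suc x)) × θ (suc x) ≢ τ
        found (zero  , _       , ne) = ⊥-elim (ne (term-0 τ))
        found (suc x , s≤s x<n , ne) = x , x<n , root x ne (lloyd-root x) , λ eq → ne (term-θ τ (suc x) eq)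

      vieta : ∀ {s t} → Root s → Root t → s ≢ t → s + t ≡ trace n
      vieta {s} {t} rs rt s≢t = i-j≡0⇒i≡j _ _ (*-cancel-0 (λ z → s≢t (i-j≡0⇒i≡j s t z))
        (trans (lemma s t (trace n) (det n)) (cong₂ _-_ rs rt)))
        where
        lemma : ∀ s t τ δ → (s - t) * (s + t - τ) ≡ (s * s + (- τ * s + δ)) - (t * t + (- τ * t + δ))
        lemma = solve-∀

      -- Take the quadratic with zeros s and `θ 0`. The only eigenvalue left is t, where the
      -- quadratic has the factor t - s, and the components are integers.
      divides-difference : ∀ {s t} → Root s → Root t → s ≢ t → (t - s) ∣ + 2 * (+ q) ^ n
      divides-difference {s} {t} rs rt s≢t = subst ((t - s) ∣_) (expansion s) (∣∑ (suc n) each)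
        where
        ∣∑ : ∀ N {g : ℕ → ℤ} → (∀ x → (t - s) ∣ g x) → (t - s) ∣ ∑ N g
        ∣∑ zero    h = divides 0ℤ refl
        ∣∑ (suc N) h = ∣m∣n⇒∣m+n (∣∑ N h) (h N)
        zero-term : ∀ {z} → z ≡ 0ℤ → (t - s) ∣ z
        zero-term refl = divides 0ℤ refl
        cancel : ∀ {a b c} → a + c ≡ b + c → a ≡ b
        cancel {a} {b} {c} z = trans (sym (lemma a c)) (trans (cong (_- c) z) (lemma b c))
          where
          lemma : ∀ a c → (a + c) - c ≡ a
          lemma = solve-∀
        at-root : ∀ x → Root (θ (suc x)) → Dec (θ (suc x) ≡ s) → (t - s) ∣ term s (suc x)
        at-root x r (yes eq) = zero-term (term-θ s (suc x) eq)
        at-root x r (no  ne) = ∣m⇒∣m*n (e (suc x)) (∣m⇒∣m*n (θ (suc x) - θ 0) (subst (λ u → (t - s) ∣ u - s) same ∣-refl))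
          where
          same : t ≡ θ (suc x)
          same = sym (cancel (trans (vieta r rs ne) (sym (vieta rt rs λ z → s≢t (sym z)))))
        positive : ∀ x → Root (θ (suc x)) ⊎ e (suc x) ≡ 0ℤ → (t - s) ∣ term s (suc x)
        positive x (inj₁ r)   = at-root x r (θ (suc x) ≟ s)
        positive x (inj₂ e≡0) = zero-term (term-e s (suc x) e≡0)
        each : ∀ x → (t - s) ∣ term s x
        each zero    = zero-term (term-0 s)
        each (suc x) = positive x (lloyd-root x)

-- The two Lloyd zeros and their divisibility

module LloydsTheorem where

  open HermiteInterpolation using (*-cancel-0)
  open AuxiliaryPolynomial using (pos-^)
  open HammingOperators
  open import Data.Nat as ℕ using (ℕ; zero; suc; z≤n; s≤s; _<_; _≤_; _∸_; >-nonZero)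
  import Data.Nat.Properties as ℕP
  import Data.Nat.Divisibility as ℕD
  open import Data.Fin as Fin using (Fin)
  import Data.Fin.Properties as FinP
  open import Data.Bool using (if_then_else_)
  open import Data.Integer using (ℤ; +_; _+_; _*_; _-_; -_; _^_; 0ℤ; 1ℤ; ∣_∣)
  open import Data.Integer.Properties
  open import Data.Integer.Divisibility.Signed
  open import Data.Integer.Tactic.RingSolver using (solve-∀)
  open import Data.List.Relation.Unary.Any using (here)
  open import Data.Nat.Tactic.RingSolver using () renaming (solve-∀ to solveℕ-∀)

  -- The two zeros x and x + d of the Lloyd polynomial of a perfect 2-code of length n over q letters.
  record LloydZeros (q n : ℕ) : Set where
    field
      x d     : ℕ
      1≤x     : 1 ≤ x
      1≤d     : 1 ≤ d
      x∣      : x ℕD.∣ 2 ℕ.* q ℕ.^ n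
      x+d∣    : x ℕ.+ d ℕD.∣ 2 ℕ.* q ℕ.^ n
      d∣      : d ℕD.∣ 2 ℕ.* q ℕ.^ n
      upper   : 4 ℕ.* (x ℕ.+ d) ℕ.+ q ≡ q ℕ.* (d ℕ.* d) ℕ.+ 2 ℕ.* d ℕ.+ 6
      lower   : 4 ℕ.* x ℕ.+ q ℕ.+ 2 ℕ.* d ≡ q ℕ.* (d ℕ.* d) ℕ.+ 6
      lengthₙ : q ℕ.* q ℕ.* (d ℕ.* d) ℕ.+ 8 ℕ.* q ℕ.+ 4 ℕ.* n ≡ 4 ℕ.* (q ℕ.* n) ℕ.+ q ℕ.* q ℕ.+ 8

  dist-refl : ∀ {q n} (c : Word q n) → dist c c ≡ 0
  dist-refl []      = refl
  dist-refl (a ∷ c) = cong₂ (λ b m → (if b then 0 else 1) ℕ.+ m) (dec-true (a FinP.≟ a) refl) (dist-refl c)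

  other : ∀ {q} → 2 ≤ q → (a : Fin q) → ∃ λ b → a ≢ b
  other (s≤s (s≤s _)) Fin.zero    = Fin.suc Fin.zero , λ ()
  other (s≤s (s≤s _)) (Fin.suc a) = Fin.zero , λ ()

  at-distance-two : ∀ {q n} → 2 ≤ q → (c : Word q (suc (suc n))) → ∃ λ y → dist c y ≡ 2
  at-distance-two 2≤q (a ∷ b ∷ c) =
    let (a′ , a≢) = other 2≤q a ; (b′ , b≢) = other 2≤q b in
    a′ ∷ b′ ∷ c , cong₂ (λ s t → (if s then 0 else 1) ℕ.+ t) (dec-false (a FinP.≟ a′) a≢)
      (cong₂ (λ s t → (if s then 0 else 1) ℕ.+ t) (dec-false (b FinP.≟ b′) b≢) (dist-refl c))

  module Zeros (q n : ℕ) (code : List (Word q n)) (perfect : IsPerfectCode q 2 n code) (2≤q : 2 ≤ q)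
    (c₀ y : Word q n) (c₀∈ : c₀ ∈ code) (d₀ : dist c₀ y ≡ 2) where

    open Operators q
    open Perfect q n code perfect 2≤q
    open AtDistanceTwo c₀ y c₀∈ d₀

    q≢0 : + q ≢ 0ℤ
    q≢0 e = contradiction (+-injective e) λ { refl → contradiction 2≤q λ () }

    module Pair (b d : ℕ) (1≤b : 1 ≤ b) (1≤d : 1 ≤ d)
      (rb : Root (θ b)) (ra : Root (θ (b ℕ.+ d))) (θb≢θa : θ b ≢ θ (b ℕ.+ d)) where

      a : ℕ
      a = b ℕ.+ d

      a-cast : + a ≡ + b + + d
      a-cast = pos-+ b d

      -- `H₁` compares the sum of the roots with the trace, `E₃` the square q² d² of their
      -- difference with the discriminant. In E₃ + 2 H₁ the terms with n cancel, and `star` is this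
      -- divided by q.
      H₁ H₂ E₃ star : ℤ
      H₁ = θ a + θ b - trace n
      H₂ = θ a * θ a + (- trace n * θ a + det n)
      E₃ = + q * + q * (+ d * + d) + + 8 * + q + + 4 * + n - (+ 4 * (+ q * + n) + + q * + q + + 8)
      star = + q * (+ d * + d) - + 2 * (+ a + + b) - + q + + 6

      H₁≡0 : H₁ ≡ 0ℤ
      H₁≡0 = i≡j⇒i-j≡0 (vieta ra rb (λ e → θb≢θa (sym e)))

      E₃≡0 : E₃ ≡ 0ℤ
      E₃≡0 = trans (subst (λ A → E₃ ≡ (+ q * (+ n - A) + θ b - trace n) * (+ 2 * trace n + (+ q * (+ n - A) + θ b - trace n) - + 4 * (+ q * (+ n - A)))
          + + 4 * (+ q * (+ n - A) * (+ q * (+ n - A)) + (- trace n * (+ q * (+ n - A)) + det n))) (sym a-cast) (lemma (+ q) (+ n) (+ b) (+ d)))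
        (cong₂ (λ h k → h * (+ 2 * trace n + h - + 4 * θ a) + + 4 * k) H₁≡0 ra)
        where
        lemma : ∀ q n b d → q * q * (d * d) + + 8 * q + + 4 * n - (+ 4 * (q * n) + q * q + + 8)
          ≡ (q * (n - (b + d)) + q * (n - b) - (+ 2 * n + q - + 4)) * (+ 2 * (+ 2 * n + q - + 4) + (q * (n - (b + d)) + q * (n - b) - (+ 2 * n + q - + 4)) - + 4 * (q * (n - (b + d))))
          + + 4 * (q * (n - (b + d)) * (q * (n - (b + d))) + (- (+ 2 * n + q - + 4) * (q * (n - (b + d))) + (n - 1ℤ) * (n - + 2)))
        lemma = solve-∀

      star≡0 : star ≡ 0ℤ
      star≡0 = *-cancel-0 q≢0 (trans (lemma (+ q) (+ n) (+ a) (+ b) (+ d)) (cong₂ (λ x y → x + + 2 * y) E₃≡0 H₁≡0))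
        where
        lemma : ∀ q n a b d → q * (q * (d * d) - + 2 * (a + b) - q + + 6)
          ≡ (q * q * (d * d) + + 8 * q + + 4 * n - (+ 4 * (q * n) + q * q + + 8)) + + 2 * (q * (n - a) + q * (n - b) - (+ 2 * n + q - + 4))
        lemma = solve-∀

      upper : 4 ℕ.* a ℕ.+ q ≡ q ℕ.* (d ℕ.* d) ℕ.+ 2 ℕ.* d ℕ.+ 6
      upper = +-injective (sym (i-j≡0⇒i≡j _ _ (trans (cong₂ _-_ right left)
          (trans (cong (λ A → + q * (+ d * + d) + + 2 * + d + + 6 - (+ 4 * A + + q)) a-cast) (trans (lemma (+ q) (+ b) (+ d))
            (trans (cong (λ A → + q * (+ d * + d) - + 2 * (A + + b) - + q + + 6) (sym a-cast)) star≡0))))))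
        where
        left : + (4 ℕ.* a ℕ.+ q) ≡ + 4 * + a + + q
        left = trans (pos-+ (4 ℕ.* a) q) (cong (_+ + q) (pos-* 4 a))
        right : + (q ℕ.* (d ℕ.* d) ℕ.+ 2 ℕ.* d ℕ.+ 6) ≡ + q * (+ d * + d) + + 2 * + d + + 6
        right = trans (pos-+ (q ℕ.* (d ℕ.* d) ℕ.+ 2 ℕ.* d) 6) (cong (_+ + 6) (trans (pos-+ (q ℕ.* (d ℕ.* d)) (2 ℕ.* d))
          (cong₂ _+_ (trans (pos-* q (d ℕ.* d)) (cong (+ q *_) (pos-* d d))) (pos-* 2 d))))
        lemma : ∀ q b d → q * (d * d) + + 2 * d + + 6 - (+ 4 * (b + d) + q) ≡ q * (d * d) - + 2 * (b + d + b) - q + + 6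
        lemma = solve-∀

      lower : 4 ℕ.* b ℕ.+ q ℕ.+ 2 ℕ.* d ≡ q ℕ.* (d ℕ.* d) ℕ.+ 6
      lower = ℕP.+-cancelʳ-≡ (2 ℕ.* d) _ _ (trans (lemma₁ b q d) (trans upper (lemma₂ (q ℕ.* (d ℕ.* d)) d)))
        where
        lemma₁ : ∀ b q d → 4 ℕ.* b ℕ.+ q ℕ.+ 2 ℕ.* d ℕ.+ 2 ℕ.* d ≡ 4 ℕ.* (b ℕ.+ d) ℕ.+ q
        lemma₁ = solveℕ-∀
        lemma₂ : ∀ x d → x ℕ.+ 2 ℕ.* d ℕ.+ 6 ≡ x ℕ.+ 6 ℕ.+ 2 ℕ.* d
        lemma₂ = solveℕ-∀

      lengthₙ : q ℕ.* q ℕ.* (d ℕ.* d) ℕ.+ 8 ℕ.* q ℕ.+ 4 ℕ.* n ≡ 4 ℕ.* (q ℕ.* n) ℕ.+ q ℕ.* q ℕ.+ 8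
      lengthₙ = +-injective (i-j≡0⇒i≡j _ _ (trans (cong₂ _-_ left right) E₃≡0))
        where
        left : + (q ℕ.* q ℕ.* (d ℕ.* d) ℕ.+ 8 ℕ.* q ℕ.+ 4 ℕ.* n) ≡ + q * + q * (+ d * + d) + + 8 * + q + + 4 * + n
        left = trans (pos-+ (q ℕ.* q ℕ.* (d ℕ.* d) ℕ.+ 8 ℕ.* q) (4 ℕ.* n)) (cong₂ _+_ (trans (pos-+ (q ℕ.* q ℕ.* (d ℕ.* d)) (8 ℕ.* q))
          (cong₂ _+_ (trans (pos-* (q ℕ.* q) (d ℕ.* d)) (cong₂ _*_ (pos-* q q) (pos-* d d))) (pos-* 8 q))) (pos-* 4 n))
        right : + (4 ℕ.* (q ℕ.* n) ℕ.+ q ℕ.* q ℕ.+ 8) ≡ + 4 * (+ q * + n) + + q * + q + + 8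
        right = trans (pos-+ (4 ℕ.* (q ℕ.* n) ℕ.+ q ℕ.* q) 8) (cong (_+ + 8) (trans (pos-+ (4 ℕ.* (q ℕ.* n)) (q ℕ.* q))
          (cong₂ _+_ (trans (pos-* 4 (q ℕ.* n)) (cong (+ 4 *_) (pos-* q n))) (pos-* q q))))

      2q^n : + 2 * (+ q) ^ n ≡ + (2 ℕ.* q ℕ.^ n)
      2q^n = trans (cong (+ 2 *_) (sym (pos-^ q n))) (sym (pos-* 2 (q ℕ.^ n)))

      -- At `θ 0` the quadratic is (θ 0 - θ a)(θ 0 - θ b) = q² a b, and it is also twice the size of
      -- a ball; multiplied by the size of the code this is 2 q^n.
      product : + q * + q * (+ a * + b) * + length code ≡ + (2 ℕ.* q ℕ.^ n)
      product = begin
        + q * + q * (+ a * + b) * + length code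
          ≡⟨ cong (_* + length code) (lemma (+ q) (+ n) (+ a) (+ b) (trace n) (det n)) ⟩
        (Ψ₀-value - H₁ * θ 0 + θ a * H₁ - H₂) * + length code
          ≡⟨ cong₂ (λ h k → (Ψ₀-value - h * θ 0 + θ a * h - k) * + length code) H₁≡0 ra ⟩
        (Ψ₀-value - 0ℤ * θ 0 + θ a * 0ℤ - 0ℤ) * + length code
          ≡⟨ cong (_* + length code) (trans (tidy Ψ₀-value (θ 0) (θ a)) Ψ₀) ⟩
        + 2 * + B * + length code
          ≡⟨ trans (*-assoc (+ 2) (+ B) _) (cong (+ 2 *_) (trans (*-comm (+ B) _) size-B)) ⟩
        + 2 * (+ q) ^ n
          ≡⟨ 2q^n ⟩
        + (2 ℕ.* q ℕ.^ n) ∎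
        where
        open ≡-Reasoning
        Ψ₀-value : ℤ
        Ψ₀-value = θ 0 * θ 0 + (- trace n * θ 0 + det n)
        tidy : ∀ p s t → p - 0ℤ * s + t * 0ℤ - 0ℤ ≡ p
        tidy = solve-∀
        lemma : ∀ q n a b t δ → q * q * (a * b) ≡
          (q * (n - 0ℤ) * (q * (n - 0ℤ)) + (- t * (q * (n - 0ℤ)) + δ))
          - (q * (n - a) + q * (n - b) - t) * (q * (n - 0ℤ)) + q * (n - a) * (q * (n - a) + q * (n - b) - t)
          - (q * (n - a) * (q * (n - a)) + (- t * (q * (n - a)) + δ))
        lemma = solve-∀

      a∣ : a ℕD.∣ 2 ℕ.* q ℕ.^ n
      a∣ = ∣⇒∣ᵤ {+ a} {+ (2 ℕ.* q ℕ.^ n)} (divides (+ q * + q * + b * + length code) (trans (sym product) (lemma (+ q) (+ a) (+ b) (+ length code))))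
        where
        lemma : ∀ q a b l → q * q * (a * b) * l ≡ q * q * b * l * a
        lemma = solve-∀

      b∣ : b ℕD.∣ 2 ℕ.* q ℕ.^ n
      b∣ = ∣⇒∣ᵤ {+ b} {+ (2 ℕ.* q ℕ.^ n)} (divides (+ q * + q * + a * + length code) (trans (sym product) (lemma (+ q) (+ a) (+ b) (+ length code))))
        where
        lemma : ∀ q a b l → q * q * (a * b) * l ≡ q * q * a * l * b
        lemma = solve-∀

      d∣ : d ℕD.∣ 2 ℕ.* q ℕ.^ n
      d∣ = ∣⇒∣ᵤ {+ d} {+ (2 ℕ.* q ℕ.^ n)} (∣-trans (divides (+ q) gap) (subst ((θ b - θ a) ∣_) 2q^n (divides-difference ra rb (λ e → θb≢θa (sym e)))))
        where
        lemma : ∀ q n b d → q * (n - b) - q * (n - (b + d)) ≡ q * d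
        lemma = solve-∀
        gap : θ b - θ a ≡ + q * + d
        gap = trans (cong (λ A → θ b - + q * (+ n - A)) a-cast) (lemma (+ q) (+ n) (+ b) (+ d))

      zeros : LloydZeros q n
      zeros = record { x = b ; d = d ; 1≤x = 1≤b ; 1≤d = 1≤d ; x∣ = b∣ ; x+d∣ = a∣ ; d∣ = d∣
                     ; upper = upper ; lower = lower ; lengthₙ = lengthₙ }

    ordered : ∀ a b → 1 ≤ b → b < a → Root (θ b) → Root (θ a) → θ b ≢ θ a → LloydZeros q n
    ordered a b 1≤b b<a rb ra ne = Pair.zeros b (a ∸ b) 1≤b (ℕP.m<n⇒0<n∸m b<a) rb
      (subst (λ a → Root (θ a)) (sym (ℕP.m+[n∸m]≡n (ℕP.<⇒≤ b<a))) ra)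
      (subst (λ a → θ b ≢ θ a) (sym (ℕP.m+[n∸m]≡n (ℕP.<⇒≤ b<a))) ne)

    compare : ∀ x₁ x₂ → Root (θ (suc x₁)) → Root (θ (suc x₂)) → θ (suc x₂) ≢ θ (suc x₁) →
      Tri (x₁ < x₂) (x₁ ≡ x₂) (x₂ < x₁) → LloydZeros q n
    compare x₁ x₂ r₁ r₂ ne (tri< lt _ _) = ordered (suc x₂) (suc x₁) (s≤s z≤n) (s≤s lt) r₁ r₂ (λ e → ne (sym e))
    compare x₁ x₂ r₁ r₂ ne (tri≈ _ e _)  = ⊥-elim (ne (cong (λ x → θ (suc x)) (sym e)))
    compare x₁ x₂ r₁ r₂ ne (tri> _ _ gt) = ordered (suc x₁) (suc x₂) (s≤s z≤n) (s≤s gt) r₂ r₁ ne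

    zeros : LloydZeros q n
    -- The first call may avoid any value, here 0; the second avoids the root just found.
    zeros = first (new-root 0ℤ)
      where
      second : ∀ x₁ → Root (θ (suc x₁)) → (∃ λ x → x < n × Root (θ (suc x)) × θ (suc x) ≢ θ (suc x₁)) → LloydZeros q n
      second x₁ r₁ (x₂ , _ , r₂ , ne) = compare x₁ x₂ r₁ r₂ ne (ℕP.<-cmp x₁ x₂)
      first : (∃ λ x → x < n × Root (θ (suc x)) × θ (suc x) ≢ 0ℤ) → LloydZeros q n
      first (x₁ , _ , r₁ , _) = second x₁ r₁ (new-root (θ (suc x₁)))

  -- A word at distance two from the code requires a codeword, which the empty list would not have
  -- but the count enforces, and two coordinates to change.
  lloyd-zeros : ∀ q n (code : List (Word q (2 ℕ.+ n))) → 2 ≤ q → IsPerfectCode q 2 (2 ℕ.+ n) code → LloydZeros q (2 ℕ.+ n)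
  lloyd-zeros q n [] 2≤q (_ , count) =
    ⊥-elim (ℕP.<⇒≢ (ℕP.m^n>0 q {{>-nonZero (ℕP.≤-trans (s≤s z≤n) 2≤q)}} (2 ℕ.+ n)) count)
  lloyd-zeros q n code@(c ∷ _) 2≤q perfect =
    let (y , d₀) = at-distance-two 2≤q c in Zeros.zeros q (2 ℕ.+ n) code perfect 2≤q c y (here refl) d₀

-- From the gap to a bound on the length

module LengthBound where

  open NaturalBounds
  open Products
  open SAdicGaps
  open LloydsTheorem
  open import Data.Nat using (ℕ; zero; suc; z≤n; s≤s; _+_; _*_; _^_; _∸_; _≤_; _<_; NonZero; >-nonZero)
  open import Data.Nat.Properties
  open import Data.Nat.Divisibility
  open import Data.Nat.Coprimality as Cop using (Coprime)
  open import Data.Nat.Primality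
  open import Data.Nat.Primality.Factorisation using (PrimeFactorisation; factorise)
  open import Data.Nat.Tactic.RingSolver using (solve-∀)
  open import Data.Fin as Fin using (Fin; toℕ; fromℕ<)
  import Data.Fin.Properties as FinP
  open import Data.Integer as ℤ using (+_; ∣_∣)
  import Data.Integer.Properties as ℤP
  import Data.Integer.Divisibility.Signed as ℤD
  open import Data.Nat.ListAction using (product)
  open import Data.Nat.ListAction.Properties using (∈⇒∣product)
  open import Data.List.Relation.Unary.All as All using (All; []; _∷_)

  -- A factor is removed by replacing it with 1, so that the index set, and with it every family of
  -- exponents, stays the same.
  without : ∀ {k} → Fin k → (Fin k → ℕ) → Fin k → ℕ
  without i f j with i FinP.≟ j
  ... | yes _ = 1
  ... | no  _ = f j

  ∏-without : ∀ {k} (i : Fin k) (f : Fin k → ℕ) → ∏ f ≡ f i * ∏ (without i f)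
  ∏-without Fin.zero    f = cong (f Fin.zero *_) (sym (*-identityˡ _))
  ∏-without (Fin.suc i) f = begin
    f Fin.zero * ∏ (λ j → f (Fin.suc j))                                     ≡⟨ cong (f Fin.zero *_) (∏-without i (λ j → f (Fin.suc j))) ⟩
    f Fin.zero * (f (Fin.suc i) * ∏ (without i (λ j → f (Fin.suc j))))       ≡⟨ lemma (f Fin.zero) (f (Fin.suc i)) _ ⟩
    f (Fin.suc i) * (f Fin.zero * ∏ (without i (λ j → f (Fin.suc j))))       ≡⟨ cong (λ p → f (Fin.suc i) * (f Fin.zero * p)) (∏-cong shifted) ⟩
    f (Fin.suc i) * (f Fin.zero * ∏ (λ j → without (Fin.suc i) f (Fin.suc j))) ∎
    where
    open ≡-Reasoning
    lemma : ∀ a b c → a * (b * c) ≡ b * (a * c)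
    lemma = solve-∀
    shifted : ∀ j → without i (λ j → f (Fin.suc j)) j ≡ without (Fin.suc i) f (Fin.suc j)
    shifted j with i FinP.≟ j
    ... | yes _ = refl
    ... | no  _ = refl

  ∏^-without : ∀ {k} (i : Fin k) (p a : Fin k → ℕ) → ∏^ p a ≡ p i ^ a i * ∏^ (without i p) a
  ∏^-without i p a = trans (∏-without i (λ j → p j ^ a j)) (cong (p i ^ a i *_) (∏-cong same))
    where
    same : ∀ j → without i (λ j → p j ^ a j) j ≡ without i p j ^ a j
    same j with i FinP.≟ j
    ... | yes _ = sym (^-zeroˡ (a j))
    ... | no  _ = refl

  ∏-ones : ∀ {k} (f : Fin k → ℕ) → (∀ i → f i ≡ 1) → ∏ f ≡ 1
  ∏-ones {zero}  f h = refl
  ∏-ones {suc k} f h = cong₂ _*_ (h Fin.zero) (∏-ones _ λ i → h (Fin.suc i))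

  ≤∏ : ∀ {k} (f : Fin k → ℕ) → (∀ i → 1 ≤ f i) → ∀ i → f i ≤ ∏ f
  ≤∏ f 1≤f i = ≤-trans (≤-trans (≤-reflexive (sym (*-identityʳ (f i)))) (*-monoʳ-≤ (f i) (1≤∏ 1≤without))) (≤-reflexive (sym (∏-without i f)))
    where
    1≤without : ∀ j → 1 ≤ without i f j
    1≤without j with i FinP.≟ j
    ... | yes _ = ≤-refl
    ... | no  _ = 1≤f j

  argmax : ∀ {k} (f : Fin (suc k) → ℕ) → ∃ λ i → ∀ j → f j ≤ f i
  argmax {zero}  f = Fin.zero , λ { Fin.zero → ≤-refl }
  argmax {suc k} f with argmax (λ j → f (Fin.suc j))
  ... | i , max with ≤-total (f Fin.zero) (f (Fin.suc i))
  ...   | inj₁ le = Fin.suc i , λ { Fin.zero → le ; (Fin.suc j) → max j }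
  ...   | inj₂ ge = Fin.zero , λ { Fin.zero → ≤-refl ; (Fin.suc j) → ≤-trans (max j) ge }

  2≤prime : ∀ {p} → Prime p → 2 ≤ p
  2≤prime {suc (suc p)} _ = s≤s (s≤s z≤n)
  2≤prime {zero}        h = contradiction h ¬prime[0]
  2≤prime {suc zero}    h = contradiction h ¬prime[1]

  distinct-primes-coprime : ∀ {p q} → Prime p → Prime q → p ≢ q → Coprime p q
  distinct-primes-coprime {p} {q} hp hq p≢q {d} (d∣p , d∣q) with prime⇒irreducible hp d∣p
  ... | inj₁ d≡1 = d≡1
  ... | inj₂ refl with prime⇒irreducible hq d∣q
  ...   | inj₁ d≡1 = d≡1
  ...   | inj₂ d≡q = contradiction d≡q p≢q

  prime∣^ : ∀ {p} b n → Prime p → p ∣ b ^ n → p ∣ b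
  prime∣^ b zero    hp p∣1 = contradiction (subst Prime (∣1⇒≡1 p∣1) hp) ¬prime[1]
  prime∣^ b (suc n) hp p∣ with euclidsLemma b (b ^ n) hp p∣
  ... | inj₁ p∣b = p∣b
  ... | inj₂ p∣bⁿ = prime∣^ b n hp p∣bⁿ

  ^-∣-^ : ∀ s {m n} → m ≤ n → s ^ m ∣ s ^ n
  ^-∣-^ s {m} {n} m≤n = subst (s ^ m ∣_) (trans (sym (^-distribˡ-+-* s m (n ∸ m))) (cong (s ^_) (m+[n∸m]≡n m≤n))) (m∣m*n (s ^ (n ∸ m)))

  2^-cancel-≤ : ∀ {m n} → 2 ^ m ≤ 2 ^ n → m ≤ n
  2^-cancel-≤ {m} {n} h with m ≤? n
  ... | yes m≤n = m≤n
  ... | no  m≰n = contradiction h (<⇒≱ (^-monoʳ-< 2 (s≤s (s≤s z≤n)) (≰⇒> m≰n)))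

  -- The candidate primes are indexed by the numbers up to 2 q; the other indices carry the base 1.
  module Smooth (q : ℕ) where

    k : ℕ
    k = suc (2 * q)

    base : Fin k → ℕ
    base i with prime? (toℕ i)
    ... | yes _ = toℕ i
    ... | no  _ = 1

    base-prime : ∀ i → Prime (toℕ i) → base i ≡ toℕ i
    base-prime i h with prime? (toℕ i)
    ... | yes _ = refl
    ... | no ¬h = contradiction h ¬h

    1≤base : ∀ i → 1 ≤ base i
    1≤base i with prime? (toℕ i)
    ... | yes h = ≤-trans (s≤s z≤n) (2≤prime h)
    ... | no  _ = ≤-refl

    IsSmooth : ℕ → Set
    IsSmooth z = ∀ {p} → Prime p → p ∣ z → p ≤ 2 * q

    -- At an index that is not prime the base is 1, and only `proper` determines the exponent.
    -- Without it exponents would be unbounded and the largest one need not belong to a prime.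
    record Exponents (z : ℕ) : Set where
      field
        exponents : Fin k → ℕ
        factored  : z ≡ ∏^ base exponents
        proper    : ∀ i → ¬ Prime (toℕ i) → exponents i ≡ 0
      bounded : ∀ i → 2 ^ exponents i ≤ z
      bounded i with prime? (toℕ i)
      ... | no ¬h = subst (λ e → 2 ^ e ≤ z) (sym (proper i ¬h)) (≤-trans (1≤∏ λ j → m^n>0 (base j) {{>-nonZero (1≤base j)}} (exponents j)) (≤-reflexive (sym factored)))
      ... | yes h = ≤-trans (^-monoˡ-≤ (exponents i) (≤-trans (2≤prime h) (≤-reflexive (sym (base-prime i h)))))
        (≤-trans (≤∏ (λ j → base j ^ exponents j) (λ j → m^n>0 (base j) {{>-nonZero (1≤base j)}} (exponents j)) i) (≤-reflexive (sym factored)))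

    unit : Fin k → Fin k → ℕ
    unit i j with i FinP.≟ j
    ... | yes _ = 1
    ... | no  _ = 0

    ∏^-unit : ∀ i → ∏^ base (unit i) ≡ base i
    ∏^-unit i = trans (∏^-without i base (unit i)) (trans (cong₂ _*_ (trans (cong (base i ^_) here) (^-identityʳ (base i))) (∏-ones _ elsewhere)) (*-identityʳ (base i)))
      where
      here : unit i i ≡ 1
      here with i FinP.≟ i
      ... | yes _ = refl
      ... | no ne = contradiction refl ne
      elsewhere : ∀ j → without i base j ^ unit i j ≡ 1
      elsewhere j with i FinP.≟ j
      ... | yes _ = refl
      ... | no  _ = refl

    from-list : ∀ ps → All Prime ps → All (_≤ 2 * q) ps → Exponents (product ps)
    from-list []       _          _           = record
      { exponents = λ _ → 0 ; factored = sym (∏-ones {k} (λ _ → 1) λ _ → refl) ; proper = λ _ _ → refl }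
    from-list (p ∷ ps) (hp ∷ hps) (p≤ ∷ ps≤) = record
      { exponents = λ j → unit i j + exponents j
      ; factored = trans (cong₂ _*_ (sym (trans (∏^-unit i) (trans (base-prime i hi) toℕ-i))) factored) (sym (∏^-+ base (unit i) exponents))
      ; proper = λ j ¬h → cong₂ _+_ (off j ¬h) (proper j ¬h) }
      where
      open Exponents (from-list ps hps ps≤)
      i = fromℕ< (s≤s p≤)
      toℕ-i : toℕ i ≡ p
      toℕ-i = FinP.toℕ-fromℕ< (s≤s p≤)
      hi : Prime (toℕ i)
      hi = subst Prime (sym toℕ-i) hp
      off : ∀ j → ¬ Prime (toℕ j) → unit i j ≡ 0
      off j ¬h with i FinP.≟ j
      ... | yes refl = contradiction hi ¬h
      ... | no  _    = refl

    exponents-of : ∀ z → 1 ≤ z → IsSmooth z → Exponents z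
    exponents-of z@(suc _) _ smooth = subst Exponents (sym isFactorisation)
      (from-list factors factorsPrime (All.tabulate λ {p} p∈ → smooth (All.lookup factorsPrime p∈)
        (subst (p ∣_) (sym isFactorisation) (∈⇒∣product p∈))))
      where
      open PrimeFactorisation (factorise z)

    smooth-divisor : ∀ {n z} → 1 ≤ q → z ∣ 2 * q ^ n → IsSmooth z
    smooth-divisor {n} 1≤q z∣ hp p∣z with euclidsLemma 2 (q ^ n) hp (∣-trans p∣z z∣)
    ... | inj₁ p∣2 = ≤-trans (∣⇒≤ p∣2) (*-monoʳ-≤ 2 1≤q)
    ... | inj₂ p∣q = ≤-trans (∣⇒≤ {{>-nonZero 1≤q}} (prime∣^ q n hp p∣q)) (m≤n*m q 2)

    Π : ℕ
    Π = ∏ base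

    -- If d is at most 2^(Π c), a number up to (q + 8) d² has exponents at most E c; the factor 2 in
    -- `D` allows c to be replaced by c - q.
    E D : ℕ
    E = q + 8 + 2 * Π
    D = 2 * E

    coprime-without : ∀ i → Prime (toℕ i) → ∀ j → Coprime (toℕ i) (without i base j)
    coprime-without i h j with i FinP.≟ j
    ... | yes _ = Cop.sym (Cop.1-coprimeTo _)
    ... | no i≢j with prime? (toℕ j)
    ...   | yes h′ = distinct-primes-coprime h h′ λ e → i≢j (FinP.toℕ-injective e)
    ...   | no  _  = Cop.sym (Cop.1-coprimeTo _)

    gap : ∀ i → Prime (toℕ i) → SAdicGap (toℕ i) k (without i base) D
    gap i h = s-adic-gap (toℕ i) k (without i base) D (2≤prime h) (coprime-without i h)

    threshold : Fin k → ℕ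
    threshold i with prime? (toℕ i)
    ... | yes h = proj₁ (gap i h)
    ... | no  _ = 0

    c₀ : ℕ
    c₀ = threshold (proj₁ (argmax threshold))

    gap-above : ∀ i → Prime (toℕ i) → ∀ c → c₀ ≤ c → (a b : Fin k → ℕ) → (∀ j → a j ≤ D * c) → (∀ j → b j ≤ D * c) →
      + (toℕ i ^ c) ℤD.∣ + ∏^ (without i base) a ℤ.- + ∏^ (without i base) b → ∏^ (without i base) a ≡ ∏^ (without i base) b
    gap-above i h c c₀≤c with prime? (toℕ i) | ≤-trans (proj₂ (argmax threshold) i) c₀≤c
    ... | yes h′ | le = proj₂ (gap i h′) c le
    ... | no ¬h  | _  = contradiction h ¬h

    -- From here on c exceeds q, and c - q is at least `c₀` and at least half of c.
    Cmax : ℕ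
    Cmax = 2 * q + c₀ + 1

    module Bounded (6≤q : 6 ≤ q) (n : ℕ) (lz : LloydZeros q n) where

      open LloydZeros lz

      1≤q : 1 ≤ q
      1≤q = ≤-trans (s≤s z≤n) 6≤q

      instance
        d≢0 : NonZero d
        d≢0 = >-nonZero 1≤d

      module Large (ed : Exponents d) (i₀ : Fin k) (max : ∀ j → Exponents.exponents ed j ≤ Exponents.exponents ed i₀)
        (large : Cmax ≤ Exponents.exponents ed i₀) where

        open Exponents ed using () renaming (exponents to cs; factored to d≡; proper to d-proper)

        s c c′ : ℕ
        s = toℕ i₀
        c = cs i₀
        -- Dividing x and x + d by their common power of s costs at most q in the exponent of the
        -- modulus.
        c′ = c ∸ q

        2q≤c : 2 * q ≤ c
        2q≤c = ≤-trans (≤-trans (m≤m+n (2 * q) c₀) (m≤m+n (2 * q + c₀) 1)) large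

        q<c : q < c
        q<c = <-≤-trans (≤-<-trans (m≤n*m q 2) (≤-<-trans (m≤m+n (2 * q) c₀) (≤-reflexive (+-comm 1 (2 * q + c₀))))) large

        1≤c : 1 ≤ c
        1≤c = ≤-trans (s≤s z≤n) q<c

        c≤2c′ : c ≤ 2 * c′
        c≤2c′ = +-cancelʳ-≤ (2 * q) c (2 * c′) (begin
          c + 2 * q            ≤⟨ +-monoʳ-≤ c 2q≤c ⟩
          c + c                ≡⟨ cong (λ x → x + x) (sym (m∸n+n≡m (<⇒≤ q<c))) ⟩
          c′ + q + (c′ + q)    ≡⟨ lemma c′ q ⟩
          2 * c′ + 2 * q       ∎)
          where
          open ≤-Reasoning
          lemma : ∀ a b → a + b + (a + b) ≡ 2 * a + 2 * b
          lemma = solve-∀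

        c₀≤c′ : c₀ ≤ c′
        c₀≤c′ = +-cancelʳ-≤ q c₀ c′ (≤-trans (≤-trans (≤-trans (≤-reflexive (+-comm c₀ q)) (+-monoˡ-≤ c₀ (m≤n*m q 2))) (m≤m+n (2 * q + c₀) 1))
          (≤-trans large (≤-reflexive (sym (m∸n+n≡m (<⇒≤ q<c))))))

        prime-s : Prime s
        prime-s with prime? s
        ... | yes h = h
        ... | no ¬h = contradiction (≤-trans 1≤c (≤-reflexive (d-proper i₀ ¬h))) λ ()

        2≤s : 2 ≤ s
        2≤s = 2≤prime prime-s

        instance
          s≢0 : NonZero s
          s≢0 = >-nonZero (≤-trans (s≤s z≤n) 2≤s)

        base≡s : base i₀ ≡ s
        base≡s = base-prime i₀ prime-s

        split : ∀ {z} (e : Exponents z) → z ≡ s ^ Exponents.exponents e i₀ * ∏^ (without i₀ base) (Exponents.exponents e)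
        split e = trans (Exponents.factored e) (trans (∏^-without i₀ base (Exponents.exponents e))
          (cong (λ b → b ^ Exponents.exponents e i₀ * ∏^ (without i₀ base) (Exponents.exponents e)) base≡s))

        s^c∣d : s ^ c ∣ d
        s^c∣d = subst (s ^ c ∣_) (sym (split ed)) (m∣m*n _)

        -- This is where the maximality of c enters: all exponents of d are at most c, so log d is
        -- O(c).
        d≤ : d ≤ 2 ^ (Π * c)
        d≤ = begin
          d                 ≡⟨ d≡ ⟩
          ∏^ base cs        ≤⟨ ∏^-bound base cs c 1≤base max ⟩
          Π ^ c             ≤⟨ ^-monoˡ-≤ c (<⇒≤ (n<2^n Π)) ⟩
          (2 ^ Π) ^ c       ≡⟨ ^-*-assoc 2 Π c ⟩
          2 ^ (Π * c)       ∎
          where open ≤-Reasoning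

        exponent-bound : ∀ {z} (e : Exponents z) → z ≤ (q + 8) * (d * d) → ∀ j → Exponents.exponents e j ≤ D * c′
        exponent-bound {z} e z≤ j = ≤-trans (2^-cancel-≤ (begin
            2 ^ Exponents.exponents e j                     ≤⟨ Exponents.bounded e j ⟩
            z                                               ≤⟨ z≤ ⟩
            (q + 8) * (d * d)                               ≤⟨ *-mono-≤ (<⇒≤ (n<2^n (q + 8))) (*-mono-≤ d≤ d≤) ⟩
            2 ^ (q + 8) * (2 ^ (Π * c) * 2 ^ (Π * c))       ≡⟨ trans (cong (2 ^ (q + 8) *_) (sym (^-distribˡ-+-* 2 (Π * c) (Π * c)))) (sym (^-distribˡ-+-* 2 (q + 8) _)) ⟩
            2 ^ (q + 8 + (Π * c + Π * c))                   ≤⟨ ^-monoʳ-≤ 2 (+-monoˡ-≤ (Π * c + Π * c) (≤-trans (≤-reflexive (sym (*-identityʳ (q + 8)))) (*-monoʳ-≤ (q + 8) 1≤c))) ⟩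
            2 ^ ((q + 8) * c + (Π * c + Π * c))             ≡⟨ cong (2 ^_) (lemma q Π c) ⟩
            2 ^ (E * c)                                     ∎))
          (≤-trans (*-monoʳ-≤ E c≤2c′) (≤-reflexive (lemma₂ E c′)))
          where
          open ≤-Reasoning
          lemma : ∀ q Π c → (q + 8) * c + (Π * c + Π * c) ≡ (q + 8 + 2 * Π) * c
          lemma = solve-∀
          lemma₂ : ∀ E c → E * (2 * c) ≡ 2 * E * c
          lemma₂ = solve-∀

        apply-gap : ∀ {y₁ y₂ t} (a b : Fin k → ℕ) → (∀ j → a j ≤ D * c′) → (∀ j → b j ≤ D * c′) →
          y₁ ≡ ∏^ (without i₀ base) a → y₂ ≡ ∏^ (without i₀ base) b → y₁ ≡ y₂ + t → s ^ c′ ∣ t → y₁ ≡ y₂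
        apply-gap {y₁} {y₂} {t} a b a≤ b≤ refl refl e s∣t = gap-above i₀ prime-s c′ c₀≤c′ a b a≤ b≤
          (subst (+ (s ^ c′) ℤD.∣_) (sym difference) (ℤD.∣ᵤ⇒∣ s∣t))
          where
          difference : + y₁ ℤ.- + y₂ ≡ + t
          difference = trans (cong (λ y → + y ℤ.- + y₂) e) (trans (ℤP.m-n≡m⊖n (y₂ + t) y₂) (trans (ℤP.⊖-≥ (m≤m+n y₂ t)) (cong +_ (m+n∸m≡n y₂ t))))

        s∤ : ∀ (a : Fin k → ℕ) → ¬ s ∣ ∏^ (without i₀ base) a
        s∤ a s∣ = contradiction (subst (2 ≤_) (coprime-∏ (λ j → coprime-^ʳ (a j) (coprime-without i₀ prime-s j)) (∣-refl , s∣)) 2≤s) λ { (s≤s ()) }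

        s^c′∣ : ∀ {m} → c′ ≤ m → s ^ c′ ∣ s ^ m
        s^c′∣ = ^-∣-^ s

        1≤d*d : 1 ≤ d * d
        1≤d*d = *-mono-≤ 1≤d 1≤d

        d≤d*d : d ≤ d * d
        d≤d*d = m≤m*n d d

        x+d≤ : x + d ≤ (q + 8) * (d * d)
        x+d≤ = begin
          x + d                                        ≤⟨ ≤-trans (m≤n*m (x + d) 4) (m≤m+n (4 * (x + d)) q) ⟩
          4 * (x + d) + q                              ≡⟨ upper ⟩
          q * (d * d) + 2 * d + 6                      ≤⟨ +-mono-≤ (+-monoʳ-≤ (q * (d * d)) (*-monoʳ-≤ 2 d≤d*d)) (≤-trans (≤-reflexive (sym (*-identityʳ 6))) (*-monoʳ-≤ 6 1≤d*d)) ⟩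
          q * (d * d) + 2 * (d * d) + 6 * (d * d)      ≡⟨ lemma q (d * d) ⟩
          (q + 8) * (d * d)                            ∎
          where
          open ≤-Reasoning
          lemma : ∀ q x → q * x + 2 * x + 6 * x ≡ (q + 8) * x
          lemma = solve-∀

        -- For q = 6 the larger zero is d (3 d + 1) / 2, and 3 d + 1 is close to 1.
        case-six : q ≡ 6 → ⊥
        case-six refl = contradiction (≤-trans (s≤s 1≤d) (≤-trans (+-monoʳ-≤ 1 (m≤n*m d 3)) (≤-reflexive (trans (+-comm 1 (3 * d)) u≡1)))) λ { (s≤s ()) }
          where
          u = 3 * d + 1
          u∣ : d * u ≡ 2 * (x + d)
          u∣ = *-cancelˡ-≡ _ _ 2 (+-cancelʳ-≡ 6 _ _ (trans (lemma₁ d) (trans (sym upper) (lemma₂ (x + d)))))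
            where
            lemma₁ : ∀ d → 2 * (d * (3 * d + 1)) + 6 ≡ 6 * (d * d) + 2 * d + 6
            lemma₁ = solve-∀
            lemma₂ : ∀ y → 4 * y + 6 ≡ 2 * (2 * y) + 6
            lemma₂ = solve-∀
          smooth-u : IsSmooth u
          smooth-u {p} hp p∣u with euclidsLemma 2 (x + d) hp (subst (p ∣_) u∣ (∣n⇒∣m*n d p∣u))
          ... | inj₁ p∣2 = ≤-trans (∣⇒≤ p∣2) (m≤m+n 2 10)
          ... | inj₂ p∣x+d = smooth-divisor {n} 1≤q x+d∣ hp p∣x+d
          eu : Exponents u
          eu = exponents-of u (m≤n+m 1 (3 * d)) smooth-u
          s∣d : s ∣ d
          s∣d = ∣-trans (subst (_∣ s ^ c) (*-identityʳ s) (^-∣-^ s 1≤c)) s^c∣d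
          -- s divides d and therefore not 3 d + 1, so u is a product over the other primes.
          e≡0 : Exponents.exponents eu i₀ ≡ 0
          e≡0 = zero-or (Exponents.exponents eu i₀) refl
            where
            zero-or : ∀ e → Exponents.exponents eu i₀ ≡ e → Exponents.exponents eu i₀ ≡ 0
            zero-or zero    eq = eq
            zero-or (suc e) eq = contradiction (subst (2 ≤_) (∣1⇒≡1 (∣m+n∣m⇒∣n {s} {3 * d} {1} s∣u (∣n⇒∣m*n 3 s∣d))) 2≤s) λ { (s≤s ()) }
              where
              s∣u : s ∣ u
              s∣u = subst (s ∣_) (sym (trans (split eu) (cong (λ e → s ^ e * ∏^ (without i₀ base) (Exponents.exponents eu)) eq))) (∣m⇒∣m*n _ (m∣m*n (s ^ e)))
          u≤ : u ≤ (6 + 8) * (d * d)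
          u≤ = ≤-trans (+-mono-≤ (*-monoʳ-≤ 3 d≤d*d) 1≤d*d) (≤-trans (≤-reflexive (lemma (d * d))) (*-monoˡ-≤ (d * d) (m≤m+n 4 10)))
            where
            lemma : ∀ x → 3 * x + x ≡ 4 * x
            lemma = solve-∀
          u≡1 : u ≡ 1
          u≡1 = apply-gap {t = 3 * d} (Exponents.exponents eu) (λ _ → 0) (exponent-bound eu u≤) (λ _ → z≤n)
            (trans (split eu) (trans (cong (λ e → s ^ e * ∏^ (without i₀ base) (Exponents.exponents eu)) e≡0) (*-identityˡ _)))
            (sym (∏-ones {k} (λ _ → 1) λ _ → refl)) (+-comm (3 * d) 1) (∣n⇒∣m*n 3 (∣-trans (s^c′∣ (m∸n≤m c q)) s^c∣d))

        case-more : 6 < q → ⊥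
        case-more 6<q = contradiction (+-cancelˡ-≡ x d 0 (trans x+d≡x (sym (+-identityʳ x)))) (λ e → contradiction (≤-trans 1≤d (≤-reflexive e)) λ ())
          where
          δ = q ∸ 6
          δ+6 : δ + 6 ≡ q
          δ+6 = m∸n+n≡m (<⇒≤ 6<q)
          1≤δ : 1 ≤ δ
          1≤δ = m<n⇒0<n∸m 6<q
          ex : Exponents x
          ex = exponents-of x 1≤x (smooth-divisor {n} 1≤q x∣)
          ez : Exponents (x + d)
          ez = exponents-of (x + d) (≤-trans 1≤x (m≤m+n x d)) (smooth-divisor {n} 1≤q x+d∣)
          i j y₁ y₂ : ℕ
          i = Exponents.exponents ez i₀
          j = Exponents.exponents ex i₀
          y₁ = ∏^ (without i₀ base) (Exponents.exponents ez)
          y₂ = ∏^ (without i₀ base) (Exponents.exponents ex)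
          s^∣d : ∀ {m} → m ≤ c → s ^ m ∣ d
          s^∣d m≤c = ∣-trans (^-∣-^ s m≤c) s^c∣d
          s^∣x : ∀ {m} → m ≤ j → s ^ m ∣ x
          s^∣x {m} m≤j = subst (s ^ m ∣_) (sym (split ex)) (∣m⇒∣m*n y₂ (^-∣-^ s m≤j))
          s^∣x+d : ∀ {m} → m ≤ i → s ^ m ∣ x + d
          s^∣x+d {m} m≤i = subst (s ^ m ∣_) (sym (split ez)) (∣m⇒∣m*n y₁ (^-∣-^ s m≤i))
          upper′ : 4 * (x + d) + δ ≡ q * (d * d) + 2 * d
          upper′ = +-cancelʳ-≡ 6 _ _ (trans (+-assoc (4 * (x + d)) δ 6) (trans (cong (_+_ (4 * (x + d))) δ+6) upper))
          lower′ : 4 * x + 2 * d + δ ≡ q * (d * d)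
          lower′ = +-cancelʳ-≡ 6 _ _ (trans (lemma (4 * x) (2 * d) δ) (trans (cong (λ z → 4 * x + z + 2 * d) δ+6) lower))
            where
            lemma : ∀ a b e → a + b + e + 6 ≡ a + (e + 6) + b
            lemma = solve-∀
          -- The equations for the zeros, read modulo s^(q+1), would force this power to divide q -
          -- 6 if it divided x or x + d. But 0 < q - 6 < 2^q; for q = 6 the difference is 0, hence
          -- the separate case.
          too-big : ¬ s ^ suc q ∣ δ
          too-big h = contradiction (∣⇒≤ {{>-nonZero 1≤δ}} h) (<⇒≱ (≤-<-trans (m∸n≤m q 6) (<-≤-trans (n<2^n q)
            (≤-trans (^-monoˡ-≤ q 2≤s) (^-monoʳ-≤ s (n≤1+n q))))))
          i≤q : i ≤ q
          i≤q = ≮⇒≥ λ q<i → too-big (∣m+n∣m⇒∣n (subst (s ^ suc q ∣_) (sym upper′)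
            (∣m∣n⇒∣m+n (∣n⇒∣m*n q (∣m⇒∣m*n d (s^∣d q<c))) (∣n⇒∣m*n 2 (s^∣d q<c)))) (∣n⇒∣m*n 4 (s^∣x+d q<i)))
          j≤q : j ≤ q
          j≤q = ≮⇒≥ λ q<j → too-big (∣m+n∣m⇒∣n (subst (s ^ suc q ∣_) (sym lower′) (∣n⇒∣m*n q (∣m⇒∣m*n d (s^∣d q<c))))
            (∣m∣n⇒∣m+n (∣n⇒∣m*n 4 (s^∣x q<j)) (∣n⇒∣m*n 2 (s^∣d q<c))))
          cancel-power : ∀ {m y} → s ^ suc m ∣ s ^ m * y → s ∣ y
          cancel-power {m} {y} h = *-cancelˡ-∣ (s ^ m) {{m^n≢0 s m}} (subst (_∣ s ^ m * y) (*-comm s (s ^ m)) h)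
          -- Both exponents are at most q < c while s^c divides d, so adding d does not change the
          -- power of s.
          i≡j : i ≡ j
          i≡j = decide (<-cmp i j)
            where
            decide : Tri (i < j) (i ≡ j) (j < i) → i ≡ j
            decide (tri≈ _ e _)  = e
            decide (tri< lt _ _) = contradiction (cancel-power {i} {y₁} (subst (s ^ suc i ∣_) (split ez)
              (∣m∣n⇒∣m+n (s^∣x lt) (s^∣d (≤-trans (s≤s i≤q) q<c))))) (s∤ (Exponents.exponents ez))
            decide (tri> _ _ gt) = contradiction (cancel-power {j} {y₂} (subst (s ^ suc j ∣_) (split ex)
              (∣m+n∣m⇒∣n (subst (s ^ suc j ∣_) (+-comm x d) (s^∣x+d gt)) (s^∣d (≤-trans (s≤s j≤q) q<c))))) (s∤ (Exponents.exponents ex))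
          t : ℕ
          t = s ^ (c ∸ i) * _∣_.quotient s^c∣d
          y₁≡ : y₁ ≡ y₂ + t
          y₁≡ = *-cancelˡ-≡ y₁ (y₂ + t) (s ^ i) {{m^n≢0 s i}} (begin
            s ^ i * y₁                                               ≡⟨ sym (split ez) ⟩
            x + d                                                    ≡⟨ cong₂ _+_ (trans (split ex) (cong (λ e → s ^ e * y₂) (sym i≡j))) (_∣_.equality s^c∣d) ⟩
            s ^ i * y₂ + _∣_.quotient s^c∣d * s ^ c                  ≡⟨ cong (λ p → s ^ i * y₂ + _∣_.quotient s^c∣d * p)
                                                                          (trans (cong (s ^_) (sym (m+[n∸m]≡n (≤-trans i≤q (<⇒≤ q<c))))) (^-distribˡ-+-* s i (c ∸ i))) ⟩
            s ^ i * y₂ + _∣_.quotient s^c∣d * (s ^ i * s ^ (c ∸ i))  ≡⟨ lemma (s ^ i) y₂ (_∣_.quotient s^c∣d) (s ^ (c ∸ i)) ⟩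
            s ^ i * (y₂ + t)                                         ∎)
            where
            open ≡-Reasoning
            lemma : ∀ a y q b → a * y + q * (a * b) ≡ a * (y + b * q)
            lemma = solve-∀
          y-equal : y₁ ≡ y₂
          y-equal = apply-gap {t = t} (Exponents.exponents ez) (Exponents.exponents ex)
            (exponent-bound ez x+d≤) (exponent-bound ex (≤-trans (m≤m+n x d) x+d≤)) refl refl y₁≡
            (∣m⇒∣m*n _ (s^c′∣ (∸-monoʳ-≤ c i≤q)))
          x+d≡x : x + d ≡ x
          x+d≡x = trans (split ez) (trans (cong₂ (λ e y → s ^ e * y) i≡j y-equal) (sym (split ex)))

        absurd : ⊥
        absurd = decide (<-cmp 6 q)
          where
          decide : Tri (6 < q) (6 ≡ q) (q < 6) → ⊥
          decide (tri< lt _ _) = case-more lt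
          decide (tri≈ _ e _)  = case-six (sym e)
          decide (tri> _ _ gt) = contradiction 6≤q (<⇒≱ gt)

      d-bounded : d ≤ Π ^ Cmax
      d-bounded = let ed = exponents-of d 1≤d (smooth-divisor {n} 1≤q d∣)
                      (i₀ , max) = argmax (Exponents.exponents ed) in
        ≤-trans (≤-reflexive (Exponents.factored ed)) (∏^-bound base (Exponents.exponents ed) Cmax 1≤base
          λ j → ≤-trans (max j) (<⇒≤ (≰⇒> λ large → Large.absurd ed i₀ max large)))

      -- `lengthₙ` is linear in n with coefficient 4 (q - 1), so a bound for d is one for n.
      n-bounded : n ≤ q * q * (Π ^ Cmax * Π ^ Cmax) + 8 * q
      n-bounded = ≤-trans (m≤n*m n 4) (+-cancelʳ-≤ (4 * n) (4 * n) _ (begin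
        4 * n + 4 * n                                            ≡⟨ lemma n ⟩
        4 * (2 * n)                                              ≤⟨ *-monoʳ-≤ 4 (*-monoˡ-≤ n (≤-trans (m≤m+n 2 4) 6≤q)) ⟩
        4 * (q * n)                                              ≤⟨ ≤-trans (m≤m+n (4 * (q * n)) (q * q)) (m≤m+n _ 8) ⟩
        4 * (q * n) + q * q + 8                                  ≡⟨ sym lengthₙ ⟩
        q * q * (d * d) + 8 * q + 4 * n                          ≤⟨ +-monoˡ-≤ (4 * n) (+-monoˡ-≤ (8 * q) (*-monoʳ-≤ (q * q) (*-mono-≤ d-bounded d-bounded))) ⟩
        q * q * (Π ^ Cmax * Π ^ Cmax) + 8 * q + 4 * n            ∎))
        where
        open ≤-Reasoning
        lemma : ∀ n → 4 * n + 4 * n ≡ 4 * (2 * n)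
        lemma = solve-∀

-- Enumeration of the codes of bounded length

open LloydsTheorem
open LengthBound
open import Data.Nat using (ℕ; zero; suc; z≤n; s≤s; _+_; _*_; _^_; _≤_)
open import Data.Nat.Properties
import Data.Fin.Properties as FinP
open import Data.Vec.Properties using (≡-dec; ∷-injective)
open import Data.List.Membership.Propositional.Properties using (∈-cartesianProductWith⁺; ∈-allFin; ∈-filter⁺; ∈-filter⁻; ∈-map⁺; ∈-++⁺ˡ; ∈-++⁺ʳ; ∈-concat⁺′; ∈-upTo⁺)
open import Data.List.Membership.Propositional.Properties.WithK using (unique∧set⇒bag)
open import Data.List.Relation.Binary.BagAndSetEquality using (∼bag⇒↭)
open import Data.List.Relation.Binary.Permutation.Propositional using (_↭_)
open import Data.List.Relation.Unary.Any using (here)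
open import Data.List.Relation.Unary.All using ([])
open import Data.List.Relation.Unary.AllPairs using ([]; _∷_)
open import Data.List.Relation.Unary.Unique.Propositional using (Unique)
open import Data.List.Relation.Unary.Unique.Propositional.Properties using (cartesianProductWith⁺; allFin⁺; filter⁺)
open import Function.Bundles using (mk⇔)

words : ∀ q n → List (Word q n)
words q zero    = [] ∷ []
words q (suc n) = cartesianProductWith _∷_ (allFin q) (words q n)

∈-words : ∀ {q n} (w : Word q n) → w ∈ words q n
∈-words []      = here refl
∈-words (a ∷ w) = ∈-cartesianProductWith⁺ _∷_ (∈-allFin a) (∈-words w)

words-unique : ∀ q n → Unique (words q n)
words-unique q zero    = [] ∷ []
words-unique q (suc n) = cartesianProductWith⁺ _∷_ ∷-injective (allFin⁺ q) (words-unique q n)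

sublists : ∀ {A : Set} → List A → List (List A)
sublists []       = [] ∷ []
sublists (x ∷ xs) = map (x ∷_) (sublists xs) ++ sublists xs

filter∈sublists : ∀ {A : Set} {P : A → Set} (P? : Decidable P) xs → filter P? xs ∈ sublists xs
filter∈sublists P? []       = here refl
filter∈sublists P? (x ∷ xs) with P? x
... | yes _ = ∈-++⁺ˡ (∈-map⁺ (x ∷_) (filter∈sublists P? xs))
... | no  _ = ∈-++⁺ʳ (map (x ∷_) (sublists xs)) (filter∈sublists P? xs)

module _ {q n : ℕ} (C : List (Word q n)) (unique : Unique C) where

  open import Data.List.Membership.DecPropositional (≡-dec {n = n} (FinP._≟_ {q})) using (_∈?_)

  -- Relisting the code in the order in which all words are enumerated makes it one of the finitely
  -- many sublists of that enumeration.
  canonical : List (Word q n)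
  canonical = filter (_∈? C) (words q n)

  ↭-canonical : C ↭ canonical
  ↭-canonical = ∼bag⇒↭ (unique∧set⇒bag unique (filter⁺ (_∈? C) (words-unique q n))
    (mk⇔ (λ w∈ → ∈-filter⁺ (_∈? C) (∈-words _) w∈) (λ w∈ → proj₂ (∈-filter⁻ (_∈? C) {xs = words q n} w∈))))

  canonical∈ : canonical ∈ sublists (words q n)
  canonical∈ = filter∈sublists (_∈? C) (words q n)

codes-up-to : ∀ q → ℕ → List (Σ ℕ λ n → List (Word q n))
codes-up-to q N = concatMap (λ n → map (n ,_) (sublists (words q n))) (upTo (suc N))

bounded⇒finite : ∀ q e N → (∀ n (C : List (Word q n)) → IsPerfectCode q e n C → n ≤ N) → FinitelyManyPerfectCodes q e
bounded⇒finite q e N bound = codes-up-to q N , λ n C _ perfect →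
  let unique = proj₁ (proj₁ perfect) in
  canonical C unique ,
  ∈-concat⁺′ (∈-map⁺ (n ,_) (canonical∈ C unique))
    (∈-map⁺ (λ n → map (n ,_) (sublists (words q n))) (∈-upTo⁺ (s≤s (bound n C perfect)))) ,
  ↭-canonical C unique

perfect-length-bounded : ∀ q → 6 ≤ q → ∃ λ N → ∀ n (C : List (Word q n)) → IsPerfectCode q 2 n C → n ≤ N
-- The added 2 covers the lengths 0 and 1, where no two words are at distance two.
perfect-length-bounded q 6≤q = N + 2 , bound
  where
  open Smooth q
  N = q * q * (Π ^ Cmax * Π ^ Cmax) + 8 * q
  bound : ∀ n (C : List (Word q n)) → IsPerfectCode q 2 n C → n ≤ N + 2
  bound zero          C perfect = z≤n
  bound (suc zero)    C perfect = ≤-trans (s≤s z≤n) (m≤n+m 2 N)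
  bound (suc (suc n)) C perfect = ≤-trans
    (Bounded.n-bounded 6≤q (2 + n) (lloyd-zeros q n C (≤-trans (m≤m+n 2 4) 6≤q) perfect)) (m≤m+n N 2)

theorem3 : (q : ℕ) → 6 ≤ q → ¬ IsPrimePower q → FinitelyManyPerfectCodes q 2
theorem3 q 6≤q _ = let (N , bound) = perfect-length-bounded q 6≤q in bounded⇒finite q 2 N bound
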